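{- Let $q$ be a prime power and $d\ge 2$ an integer. (a) If $(q,d)$ is one of the pairs $(2,2),(3,2),(2,3),(3,3),(4,3),(5,3),(2,4),(2,5),(2,6),(2,7)$, then every irreducible polynomial of degree $d$ in $\mathbb{F}_q[x]$ admits a visibly irreducible decomposition (VID) of degree $d$ over $\mathbb{F}_q$. (b) If $(q,d)=(3,5)$, then exactly half of all irreducible polynomials of degree $5$ in $\mathbb{F}_3[x]$ admit a VID of degree $5$ over $\mathbb{F}_3$. (c) For all other pairs $(q,d)$ (with $q$ a prime power and $d\ge 2$), no irreducible polynomial of degree $d$ in $\mathbb{F}_q[x]$ admits a VID of degree $d$ over $\mathbb{F}_q$.
   Context: $\mathbb{F}_q$ denotes the field with $q$ elements. A visibly irreducible decomposition (VID) of degree $d\ge 2$ over $\mathbb{F}_q$ is a sum $f_1(x)+f_2(x)+\cdots+f_r(x)=f(x)$ of $r\ge 2$ nonzero polynomials $f_i(x)\in\mathbb{F}_q[x]$ of degree at most $d$ such that: (VID-1) every irreducible polynomial $p(x)\in\mathbb{F}_q[x]$ of degree not exceeding $d/2$ divides all but exactly one of the $f_i(x)$; (VID-2) exactly one of the $f_i$ has degree $d$, the others having degree less than $d$. A polynomial $f$ admits a VID if it is equal to the sum $f_1+\cdots+f_r$ of some VID (for some $r\ge 2$). Irreducible polynomials have positive degree. In (b), the count may be taken up to scaling by $\mathbb{F}_3^\times$ (equivalently, among monic polynomials). -}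

module Defs where

open import Level using (_⊔_)
open import Algebra.Apartness.Bundles using (HeytingCommutativeRing; HeytingField)
open import Algebra.Bundles using (CommutativeRing; RawSemiring)
import Algebra.Definitions.RawSemiring as RawSemiringDefs
open import Data.Fin.Base using (Fin)
open import Data.List.Base using (List; []; _∷_; map)
open import Data.Nat.Base using (ℕ; zero; suc; _*_; _^_; _≤_)
open import Data.Nat.Primality using (Prime)
open import Data.Product.Base using (Σ; ∃-syntax; ∃₂; _×_; _,_; proj₁)
open import Data.Vec.Functional using (Vector)
open import Function.Bundles using (Inverse)
open import Relation.Binary.Bundles using (Setoid)
import Relation.Binary.Construct.On as On
open import Relation.Binary.PropositionalEquality as ≡ using (_≡_; _≢_)
open import Relation.Nullary.Negation using (¬_)
open import Relation.Unary using (Pred)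

IsPrimePower : ℕ → Set
IsPrimePower q = ∃₂ λ p k → Prime p × 1 ≤ k × q ≡ p ^ k

HasCardinality : ∀ {a ℓ} → Setoid a ℓ → ℕ → Set (a ⊔ ℓ)
HasCardinality S n = Inverse S (≡.setoid (Fin n))

-- Elements satisfying P, identified when they are equal in S regardless
-- of the proofs of P.
subsetoid : ∀ {a ℓ p} (S : Setoid a ℓ) → Pred (Setoid.Carrier S) p → Setoid (a ⊔ p) ℓ
subsetoid S P = On.setoid {B = Σ (Setoid.Carrier S) P} S proj₁

module Polynomials {c ℓ} (R : CommutativeRing c ℓ) where
  private module R = CommutativeRing R

  -- Coefficient lists, constant term first; trailing zeros are allowed and
  -- are made irrelevant by _≈ₚ_.
  Poly : Set c
  Poly = List R.Carrier

  coeff : Poly → ℕ → R.Carrier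
  coeff []      _       = R.0#
  coeff (a ∷ f) zero    = a
  coeff (a ∷ f) (suc i) = coeff f i

  infix 4 _≈ₚ_

  record _≈ₚ_ (f g : Poly) : Set ℓ where
    constructor mk≈ₚ
    field
      coeff-≈ : ∀ i → coeff f i R.≈ coeff g i

  open _≈ₚ_ public

  infixl 6 _+ₚ_
  infixl 7 _*ₚ_

  0ₚ 1ₚ : Poly
  0ₚ = []
  1ₚ = R.1# ∷ []

  _+ₚ_ : Poly → Poly → Poly
  []      +ₚ g       = g
  (a ∷ f) +ₚ []      = a ∷ f
  (a ∷ f) +ₚ (b ∷ g) = (a R.+ b) ∷ (f +ₚ g)

  -- (a + x f) g = a g + x (f g)
  _*ₚ_ : Poly → Poly → Poly
  []      *ₚ g = []
  (a ∷ f) *ₚ g = map (a R.*_) g +ₚ (R.0# ∷ (f *ₚ g))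

  polySetoid : Setoid c ℓ
  polySetoid = record
    { Carrier       = Poly
    ; _≈_           = _≈ₚ_
    ; isEquivalence = record
      { refl  = mk≈ₚ λ _ → R.refl
      ; sym   = λ p → mk≈ₚ λ i → R.sym (coeff-≈ p i)
      ; trans = λ p q → mk≈ₚ λ i → R.trans (coeff-≈ p i) (coeff-≈ q i)
      }
    }

  polyRawSemiring : RawSemiring c ℓ
  polyRawSemiring = record
    { Carrier = Poly
    ; _≈_     = _≈ₚ_
    ; _+_     = _+ₚ_
    ; _*_     = _*ₚ_
    ; 0#      = 0ₚ
    ; 1#      = 1ₚ
    }

  open RawSemiringDefs polyRawSemiring public
    using (sum; _∣_; _∤_; Irreducible)

  -- The zero polynomial has degree less than every n, and HasDegree for no n.
  Degree< Degree≤ HasDegree : Poly → ℕ → Set ℓ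
  Degree<   f n = ∀ i → n ≤ i → coeff f i R.≈ R.0#
  Degree≤   f n = Degree< f (suc n)
  HasDegree f n = ¬ (coeff f n R.≈ R.0#) × Degree≤ f n

  record IsVID (d : ℕ) {r : ℕ} (fs : Vector Poly r) : Set (c ⊔ ℓ) where
    field
      2≤r      : 2 ≤ r
      nonzero  : ∀ i → ¬ (fs i ≈ₚ 0ₚ)
      degree≤d : ∀ i → Degree≤ (fs i) d
      -- 2 * m ≤ d says m ≤ d/2 without rounding.
      vid₁     : ∀ p → Irreducible p → ∀ m → HasDegree p m → 2 * m ≤ d →
                 ∃[ i ] (p ∤ fs i × (∀ j → j ≢ i → p ∣ fs j))
      vid₂     : ∃[ i ] (HasDegree (fs i) d × (∀ j → j ≢ i → Degree< (fs j) d))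

  AdmitsVID : ℕ → Pred Poly (c ⊔ ℓ)
  AdmitsVID d f = ∃[ r ] Σ (Vector Poly r) λ fs → IsVID d fs × sum fs ≈ₚ f

  IrreducibleOfDegree : ℕ → Pred Poly (c ⊔ ℓ)
  IrreducibleOfDegree d f = Irreducible f × HasDegree f d

-- For a carrier with finitely many elements equality is decidable, the
-- apartness of a Heyting field is just inequality, and every nonzero element
-- is invertible: finite Heyting fields are exactly the finite fields.
module _ {c ℓ₁ ℓ₂} (F : HeytingField c ℓ₁ ℓ₂) where

  fieldRing : CommutativeRing c ℓ₁
  fieldRing = HeytingCommutativeRing.commutativeRing (HeytingField.heytingCommutativeRing F)

  HasOrder : ℕ → Set (c ⊔ ℓ₁)
  HasOrder = HasCardinality (CommutativeRing.setoid fieldRing)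

alwaysVID : List (ℕ × ℕ)
alwaysVID = (2 , 2) ∷ (3 , 2) ∷ (2 , 3) ∷ (3 , 3) ∷ (4 , 3) ∷ (5 , 3)
          ∷ (2 , 4) ∷ (2 , 5) ∷ (2 , 6) ∷ (2 , 7) ∷ []

{-# OPTIONS --safe #-}

-- Put m = ⌊ d /2⌋ and Q = q ^ m. In a VID the product of any two terms is divisible by every
-- irreducible polynomial of degree at most m, and if one of the two is the term of degree d, that
-- product has degree less than 2 d. Modulo any divisor g of W = X ^ Q - X the Frobenius map gives
-- h ^ Q ≡ h for all polynomials h. For g = p * p with h = p this yields p * p ∣ p, so W is
-- squarefree; for g irreducible of degree n the integral domain F[X] / g has q ^ n elements, all of
-- them roots of T ^ Q - T, so n ≤ m. Hence W divides the product and Q < 2 d, which leaves the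
-- listed pairs, (3 , 5) and (2 , 9); in the last case X ^ 3 + X + 1 is a further divisor.
--
-- For the remaining pairs F is the image of a concrete field of order 2, 3, 4 or 5, over which
-- irreducibility and the existence of a VID with two terms are decided by exhaustive search: two
-- polynomials with irreducible sum form a VID as soon as every small irreducible divides one of
-- them. For (3 , 5) three terms are impossible, since two terms of degree at most 4 would have a
-- product of degree at least Q = 9.

module Submission where

open import Defs
open import Algebra.Apartness.Bundles using (HeytingField)
open import Algebra.Bundles using (CommutativeRing; RawRing; AbelianGroup; CommutativeMonoid)
import Algebra.Definitions.RawSemiring
import Algebra.Properties.CommutativeMonoid.Sum
import Algebra.Properties.Semiring.Exp
import Algebra.Properties.Semiring.Mult
open import Data.Bool.Base using (Bool; true; false; not; _∧_; _∨_; _xor_; T)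
open import Data.Bool.ListAction using (all; any)
open import Data.Bool.Properties using (T-∧; T-∨; T-≡; T?)
open import Data.Empty using (⊥; ⊥-elim)
open import Data.Fin.Base using (Fin; zero; suc; toℕ; fromℕ; inject₁; inject≤; finToFun; funToFin; combine)
open import Data.Fin.Permutation using (Permutation′; permutation; _⟨$⟩ʳ_)
import Data.Fin.Properties as Fin
open import Data.List.Base using (List; []; _∷_; map; tabulate; _++_; filterᵇ; cartesianProductWith; upTo; length; lookup)
open import Data.List.Membership.Propositional using (_∈_; lose; find; _∉_)
open import Data.List.Membership.Propositional.Properties using (∈-cartesianProductWith⁺; ∈-++⁺ˡ; ∈-++⁺ʳ; ∈-++⁻; ∈-map⁺; ∈-map⁻; ∈-filter⁺; ∈-filter⁻; ∈-lookup; ∈-upTo⁺)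
open import Data.List.Relation.Unary.All as All using (All)
open import Data.List.Relation.Unary.All.Properties using (all⁺; all⁻)
open import Data.List.Relation.Unary.AllPairs using (AllPairs; []; _∷_)
open import Data.List.Relation.Unary.AllPairs.Properties using () renaming (filter⁺ to AllPairs-filter⁺)
open import Data.List.Relation.Unary.Any as Any using (here; there)
open import Data.List.Relation.Unary.Any.Properties using (any⁺; any⁻; lookup-index)
open import Data.Nat.Base as ℕ using (ℕ; zero; suc; _≤_; _<_; z≤n; s≤s; ⌊_/2⌋)
open import Data.Nat.Combinatorics using (_C_; nCn≡1; nC1≡n; nCk+nC[k+1]≡[n+1]C[k+1])
open import Data.Nat.Coprimality using (coprime-Bézout; prime⇒coprime)
open import Data.Nat.DivMod using (_%_; _/_; m≡m%n+[m/n]*n; m%n<n)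
open import Data.Nat.Divisibility using (m∣m*n; ∣⇒≤) renaming (_∣_ to _∣ℕ_; divides to dividesℕ)
open import Data.Nat.GCD using (module Bézout)
open import Data.Nat.Induction using (<-rec)
open import Data.Nat.Primality using (Prime; euclidsLemma; ¬prime[0]; prime⇒nonTrivial; prime⇒nonZero; prime?)
import Data.Nat.Properties as ℕ
open import Data.Product.Base using (_×_; _,_; ∃-syntax; proj₁; proj₂; ∃₂; ∃; map₁)
import Data.Product.Properties
open import Data.Sum.Base as Sum using (_⊎_; inj₁; inj₂; [_,_]′)
open import Data.Vec.Base as Vec using (Vec; []; _∷_; toList)
open import Data.Vec.Functional using (Vector)
open import Function.Bundles using (Inverse; Equivalence)
import Level
open import Relation.Binary.Definitions using (Decidable)
open import Relation.Binary.PropositionalEquality as ≡ using (_≡_; _≢_)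
import Relation.Binary.Reasoning.Setoid
open import Relation.Nullary.Decidable using (Dec; yes; no; map′; decidable-stable; ¬?; _×-dec_; from-yes; True; toWitness)
open import Relation.Nullary.Negation using (¬_; contradiction)
open import Relation.Unary using (Pred; _∩_)
open import Data.List.Membership.DecPropositional (Data.Product.Properties.≡-dec ℕ._≟_ ℕ._≟_) using (_∈?_)

-- Divisibility by W rests on a factorisation into irreducibles, and the existence of an irreducible
-- factor is proved only under a double negation. Divisibility by W inherits it, but the goal there
-- is the inequality Q ≤ n between natural numbers, which is decidable, so the double negation
-- disappears at that point. Of F only the order is known, so no search can run in it. The searches
-- run on plain data, and a map `ι` onto F that respects subtraction, multiplication and the zero
-- test carries their outcome over in both directions. For prime order `ι` sends n to n·1; for order
-- 4 an element ω other than 0 and 1 has to be found first. The pair (2 , 9) escapes the general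
-- bound because W contains only those irreducibles whose degree divides m, while VID-1 speaks of
-- all degrees up to m. Here m = 4, and X ^ 3 + X + 1 is one of the irreducibles that W lacks, since
-- 3 does not divide 4.

module IntegerSolver {c ℓ} (R : CommutativeRing c ℓ) where
  open import Algebra.Solver.Ring.AlmostCommutativeRing
  open import Data.Maybe.Base using (Maybe; just; nothing)
  open import Data.Nat.Properties using (_≟_)
  open import Relation.Nullary.Decidable.Core using (yes)
  open import Relation.Binary.PropositionalEquality.Core as ≡ using (_≡_)
  open CommutativeRing R hiding (zero)
  open import Algebra.Properties.Semiring.Mult semiring using (×-homo-+; ×1-homo-*) renaming (_×_ to _·_)
  open import Algebra.Properties.Semiring.Mult.TCOptimised semiring using (×ᵤ≈×) renaming (_×_ to _·′_)
  open import Algebra.Properties.Ring ring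
  open import Algebra.Properties.CommutativeSemigroup +-commutativeSemigroup using (interchange)
  open import Relation.Binary.Reasoning.Setoid setoid

  private
    -- (a , b) stands for the integer a − b.
    Z : Set
    Z = ℕ × ℕ

    -- Cancelling the common part gives each integer a single representative, so that `_≟Z_` may
    -- compare components.
    norm : Z → Z
    norm (a , b) = a ℕ.∸ b , b ℕ.∸ a

    coefficients : RawRing _ _
    coefficients = record
      { Carrier = Z
      ; _≈_ = _≡_
      ; _+_ = λ (a , b) (c , d) → norm (a ℕ.+ c , b ℕ.+ d)
      ; _*_ = λ (a , b) (c , d) → norm (a ℕ.* c ℕ.+ b ℕ.* d , a ℕ.* d ℕ.+ b ℕ.* c)
      ; -_ = λ (a , b) → b , a
      ; 0# = 0 , 0
      ; 1# = 1 , 0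
      }

    difference : Z → Carrier
    difference (a , b) = a · 1# - b · 1#

    -0≈0 : - 0# ≈ 0#
    -0≈0 = trans (sym (+-identityˡ _)) (-‿inverseʳ 0#)

    [a+b]-[c+d] : ∀ a b c d → (a + b) - (c + d) ≈ (a - c) + (b - d)
    [a+b]-[c+d] a b c d = trans (+-congˡ (sym (-‿+-comm c d))) (interchange a b (- c) (- d))

    difference-norm : ∀ z → difference (norm z) ≈ difference z
    difference-norm (zero  , zero)  = refl
    difference-norm (zero  , suc b) = refl
    difference-norm (suc a , zero)  = refl
    difference-norm (suc a , suc b) = begin
      difference (norm (a , b))       ≈⟨ difference-norm (a , b) ⟩
      difference (a , b)              ≈⟨ +-identityˡ _ ⟨
      0# + difference (a , b)         ≈⟨ +-congʳ (-‿inverseʳ 1#) ⟨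
      (1# - 1#) + difference (a , b)  ≈⟨ [a+b]-[c+d] _ _ _ _ ⟨
      difference (suc a , suc b)      ∎

    [a-b]*[c-d] : ∀ a b c d → (a - b) * (c - d) ≈ (a * c + b * d) - (a * d + b * c)
    [a-b]*[c-d] a b c d = begin
      (a - b) * (c - d)                    ≈⟨ x[y-z]≈xy-xz _ c d ⟩
      (a - b) * c - (a - b) * d            ≈⟨ +-cong ([y-z]x≈yx-zx c a b) (-‿cong ([y-z]x≈yx-zx d a b)) ⟩
      (a * c - b * c) - (a * d - b * d)    ≈⟨ [a+b]-[c+d] _ _ _ _ ⟩
      (a * c - a * d) + (- (b * c) - - (b * d))  ≈⟨ +-congˡ (-‿+-comm _ _) ⟩
      (a * c - a * d) - (b * c - b * d)    ≈⟨ +-congˡ (⁻¹-anti-homo‿- _ _) ⟩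
      (a * c - a * d) + (b * d - b * c)    ≈⟨ [a+b]-[c+d] _ _ _ _ ⟨
      (a * c + b * d) - (a * d + b * c)    ∎

    -- Agrees with difference, but sends (0 , 0) and (1 , 0) to 0# and 1# on the nose.
    ⟦_⟧ : Z → Carrier
    ⟦ a , zero ⟧      = a ·′ 1#
    ⟦ a , b@(suc _) ⟧ = a ·′ 1# - b ·′ 1#

    ⟦⟧≈difference : ∀ z → ⟦ z ⟧ ≈ difference z
    ⟦⟧≈difference (a , zero)      = trans (sym (×ᵤ≈× a 1#)) (trans (sym (+-identityʳ _)) (+-congˡ (sym -0≈0)))
    ⟦⟧≈difference (a , b@(suc _)) = sym (+-cong (×ᵤ≈× a 1#) (-‿cong (×ᵤ≈× b 1#)))

    morphism : coefficients -Raw-AlmostCommutative⟶ fromCommutativeRing R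
    morphism = record
      { ⟦_⟧    = ⟦_⟧
      ; +-homo = λ x@(a , b) y@(c , d) → begin
          ⟦ norm (a ℕ.+ c , b ℕ.+ d) ⟧         ≈⟨ ⟦⟧≈difference (norm (a ℕ.+ c , b ℕ.+ d)) ⟩
          difference (norm (a ℕ.+ c , b ℕ.+ d))  ≈⟨ difference-norm (a ℕ.+ c , b ℕ.+ d) ⟩
          difference (a ℕ.+ c , b ℕ.+ d)       ≈⟨ +-cong (×-homo-+ 1# a c) (-‿cong (×-homo-+ 1# b d)) ⟩
          _                                    ≈⟨ [a+b]-[c+d] _ _ _ _ ⟩
          difference x + difference y          ≈⟨ +-cong (⟦⟧≈difference x) (⟦⟧≈difference y) ⟨
          ⟦ x ⟧ + ⟦ y ⟧                        ∎
      ; *-homo = λ x@(a , b) y@(c , d) → let z = a ℕ.* c ℕ.+ b ℕ.* d , a ℕ.* d ℕ.+ b ℕ.* c in begin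
          ⟦ norm z ⟧                   ≈⟨ ⟦⟧≈difference (norm z) ⟩
          difference (norm z)          ≈⟨ difference-norm z ⟩
          difference z                 ≈⟨ +-cong (·-homo-+* a c b d) (-‿cong (·-homo-+* a d b c)) ⟩
          _                            ≈⟨ [a-b]*[c-d] _ _ _ _ ⟨
          difference x * difference y  ≈⟨ *-cong (⟦⟧≈difference x) (⟦⟧≈difference y) ⟨
          ⟦ x ⟧ * ⟦ y ⟧                ∎
      ; -‿homo = λ x@(a , b) → begin
          ⟦ b , a ⟧           ≈⟨ ⟦⟧≈difference (b , a) ⟩
          difference (b , a)  ≈⟨ ⁻¹-anti-homo‿- _ _ ⟨
          - difference x      ≈⟨ -‿cong (⟦⟧≈difference x) ⟨
          - ⟦ x ⟧             ∎
      ; 0-homo = refl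
      ; 1-homo = refl
      }
      where
      ·-homo-+* : ∀ a c b d → (a ℕ.* c ℕ.+ b ℕ.* d) · 1# ≈ (a · 1#) * (c · 1#) + (b · 1#) * (d · 1#)
      ·-homo-+* a c b d = trans (×-homo-+ 1# (a ℕ.* c) (b ℕ.* d)) (+-cong (×1-homo-* a c) (×1-homo-* b d))

    _≟Z_ : ∀ x y → Maybe (⟦ x ⟧ ≈ ⟦ y ⟧)
    (a , b) ≟Z (c , d) with a ≟ c | b ≟ d
    ... | yes ≡.refl | yes ≡.refl = just refl
    ... | _          | _          = nothing

  open import Algebra.Solver.Ring coefficients (fromCommutativeRing R) morphism _≟Z_ public
    using (Polynomial; solve; _:=_; _:+_; _:*_; _:-_; :-_; con)

  :0 :1 : ∀ {n} → Polynomial n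
  :0 = con (0 , 0)
  :1 = con (1 , 0)

-- The polynomial ring and degree bounds

module PolynomialRing {c ℓ} (R : CommutativeRing c ℓ) where
  open CommutativeRing R hiding (zero)
  open Polynomials R
  open import Algebra.Properties.Ring ring using (-0#≈0#)
  open import Relation.Binary.Bundles using (Setoid)
  open Setoid polySetoid using () renaming (refl to ≈ₚ-refl; sym to ≈ₚ-sym; trans to ≈ₚ-trans)

  infixr 7 _·ₚ_

  _·ₚ_ : Carrier → Poly → Poly
  a ·ₚ f = map (a *_) f

  -ₚ_ : Poly → Poly
  -ₚ f = map -_ f

  coeff-+ : ∀ f g i → coeff (f +ₚ g) i ≈ coeff f i + coeff g i
  coeff-+ []      g       i       = sym (+-identityˡ _)
  coeff-+ (a ∷ f) []      i       = sym (+-identityʳ _)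
  coeff-+ (a ∷ f) (b ∷ g) zero    = refl
  coeff-+ (a ∷ f) (b ∷ g) (suc i) = coeff-+ f g i

  coeff-· : ∀ a f i → coeff (a ·ₚ f) i ≈ a * coeff f i
  coeff-· a []      i       = sym (zeroʳ a)
  coeff-· a (b ∷ f) zero    = refl
  coeff-· a (b ∷ f) (suc i) = coeff-· a f i

  coeff-neg : ∀ f i → coeff (-ₚ f) i ≈ - coeff f i
  coeff-neg []      i       = sym -0#≈0#
  coeff-neg (b ∷ f) zero    = refl
  coeff-neg (b ∷ f) (suc i) = coeff-neg f i

  ∷-cong : ∀ {a b f g} → a ≈ b → f ≈ₚ g → a ∷ f ≈ₚ b ∷ g
  ∷-cong a≈b f≈g = mk≈ₚ λ where
    zero    → a≈b
    (suc i) → coeff-≈ f≈g i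

  tail-≈ : ∀ {a b f g} → a ∷ f ≈ₚ b ∷ g → f ≈ₚ g
  tail-≈ p = mk≈ₚ λ i → coeff-≈ p (suc i)

  0∷[]≈[] : 0# ∷ [] ≈ₚ []
  0∷[]≈[] = mk≈ₚ λ { zero → refl ; (suc i) → refl }

  ∷≈[] : ∀ {a f} → a ≈ 0# → f ≈ₚ [] → a ∷ f ≈ₚ []
  ∷≈[] a≈0 f≈[] = ≈ₚ-trans (∷-cong a≈0 f≈[]) 0∷[]≈[]

  +ₚ-cong : ∀ {f f′ g g′} → f ≈ₚ f′ → g ≈ₚ g′ → f +ₚ g ≈ₚ f′ +ₚ g′
  +ₚ-cong {f} {f′} {g} {g′} p q = mk≈ₚ λ i →
    trans (coeff-+ f g i) (trans (+-cong (coeff-≈ p i) (coeff-≈ q i)) (sym (coeff-+ f′ g′ i)))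

  ·ₚ-cong : ∀ {a b f g} → a ≈ b → f ≈ₚ g → a ·ₚ f ≈ₚ b ·ₚ g
  ·ₚ-cong {a} {b} {f} {g} p q = mk≈ₚ λ i →
    trans (coeff-· a f i) (trans (*-cong p (coeff-≈ q i)) (sym (coeff-· b g i)))

  +ₚ-abelianGroup : AbelianGroup c ℓ
  +ₚ-abelianGroup = record
    { Carrier = Poly ; _≈_ = _≈ₚ_ ; _∙_ = _+ₚ_ ; ε = 0ₚ ; _⁻¹ = -ₚ_
    ; isAbelianGroup = record
      { isGroup = record
        { isMonoid = record
          { isSemigroup = record
            { isMagma = record
              { isEquivalence = Setoid.isEquivalence polySetoid
              ; ∙-cong        = +ₚ-cong
              }
            ; assoc = λ f g h → mk≈ₚ λ i → trans (coeff-+ (f +ₚ g) h i) (trans (+-congʳ (coeff-+ f g i))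
                (trans (+-assoc _ _ _) (sym (trans (coeff-+ f (g +ₚ h) i) (+-congˡ (coeff-+ g h i))))))
            }
          ; identity = (λ _ → ≈ₚ-refl) , +ₚ-identityʳ
          }
        ; inverse = (λ f → ≈ₚ-trans (+ₚ-comm (-ₚ f) f) (+ₚ-inverseʳ f)) , +ₚ-inverseʳ
        ; ⁻¹-cong = λ {f} {g} p → mk≈ₚ λ i → trans (coeff-neg f i) (trans (-‿cong (coeff-≈ p i)) (sym (coeff-neg g i)))
        }
      ; comm = +ₚ-comm
      }
    }
    where
    +ₚ-comm : ∀ f g → f +ₚ g ≈ₚ g +ₚ f
    +ₚ-comm f g = mk≈ₚ λ i → trans (coeff-+ f g i) (trans (+-comm _ _) (sym (coeff-+ g f i)))
    +ₚ-identityʳ : ∀ f → f +ₚ [] ≈ₚ f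
    +ₚ-identityʳ []      = ≈ₚ-refl
    +ₚ-identityʳ (a ∷ f) = ≈ₚ-refl
    +ₚ-inverseʳ : ∀ f → f +ₚ (-ₚ f) ≈ₚ []
    +ₚ-inverseʳ f = mk≈ₚ λ i →
      trans (coeff-+ f (-ₚ f) i) (trans (+-congˡ (coeff-neg f i)) (-‿inverseʳ _))

  private
    open module P = AbelianGroup +ₚ-abelianGroup using ()
    open import Algebra.Properties.CommutativeSemigroup P.commutativeSemigroup
      using (interchange; x∙yz≈y∙xz)
    open import Relation.Binary.Reasoning.Setoid polySetoid

    shift : Poly → Poly
    shift = 0# ∷_

    shift-+ : ∀ f g → shift (f +ₚ g) ≈ₚ shift f +ₚ shift g
    shift-+ f g = ∷-cong (sym (+-identityˡ 0#)) ≈ₚ-refl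

    ·ₚ-distribˡ : ∀ a f g → a ·ₚ (f +ₚ g) ≈ₚ a ·ₚ f +ₚ a ·ₚ g
    ·ₚ-distribˡ a f g = mk≈ₚ λ i → trans (coeff-· a (f +ₚ g) i) (trans (*-congˡ (coeff-+ f g i))
      (trans (distribˡ a _ _) (sym (trans (coeff-+ (a ·ₚ f) (a ·ₚ g) i) (+-cong (coeff-· a f i) (coeff-· a g i))))))

    ·ₚ-distribʳ : ∀ f a b → (a + b) ·ₚ f ≈ₚ a ·ₚ f +ₚ b ·ₚ f
    ·ₚ-distribʳ f a b = mk≈ₚ λ i → trans (coeff-· (a + b) f i) (trans (distribʳ _ a b)
      (sym (trans (coeff-+ (a ·ₚ f) (b ·ₚ f) i) (+-cong (coeff-· a f i) (coeff-· b f i)))))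

    ·ₚ-assoc : ∀ a b f → (a * b) ·ₚ f ≈ₚ a ·ₚ b ·ₚ f
    ·ₚ-assoc a b f = mk≈ₚ λ i → trans (coeff-· (a * b) f i) (trans (*-assoc a b _)
      (sym (trans (coeff-· a (b ·ₚ f) i) (*-congˡ (coeff-· b f i)))))

  0·ₚ : ∀ f → 0# ·ₚ f ≈ₚ []
  0·ₚ f = mk≈ₚ λ i → trans (coeff-· 0# f i) (zeroˡ _)

  1·ₚ : ∀ f → 1# ·ₚ f ≈ₚ f
  1·ₚ f = mk≈ₚ λ i → trans (coeff-· 1# f i) (*-identityˡ _)

  private
    *ₚ-zeroˡ : ∀ f g → f ≈ₚ [] → f *ₚ g ≈ₚ []
    *ₚ-zeroˡ []      g p = ≈ₚ-refl
    *ₚ-zeroˡ (a ∷ f) g p = begin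
      a ·ₚ g +ₚ shift (f *ₚ g)  ≈⟨ +ₚ-cong (·ₚ-cong (coeff-≈ p 0) ≈ₚ-refl) (∷≈[] refl (*ₚ-zeroˡ f g (mk≈ₚ λ i → coeff-≈ p (suc i)))) ⟩
      0# ·ₚ g +ₚ []             ≈⟨ P.identityʳ _ ⟩
      0# ·ₚ g                   ≈⟨ 0·ₚ g ⟩
      []                        ∎

    *ₚ-congʳ : ∀ f f′ g → f ≈ₚ f′ → f *ₚ g ≈ₚ f′ *ₚ g
    *ₚ-congʳ []      f′       g p = ≈ₚ-sym (*ₚ-zeroˡ f′ g (≈ₚ-sym p))
    *ₚ-congʳ (a ∷ f) []       g p = *ₚ-zeroˡ (a ∷ f) g p
    *ₚ-congʳ (a ∷ f) (b ∷ f′) g p =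
      +ₚ-cong (·ₚ-cong (coeff-≈ p 0) ≈ₚ-refl) (∷-cong refl (*ₚ-congʳ f f′ g (tail-≈ p)))

    *ₚ-congˡ : ∀ f {g g′} → g ≈ₚ g′ → f *ₚ g ≈ₚ f *ₚ g′
    *ₚ-congˡ []      p = ≈ₚ-refl
    *ₚ-congˡ (a ∷ f) p = +ₚ-cong (·ₚ-cong refl p) (∷-cong refl (*ₚ-congˡ f p))

    *ₚ-distribʳ : ∀ h f g → (f +ₚ g) *ₚ h ≈ₚ f *ₚ h +ₚ g *ₚ h
    *ₚ-distribʳ h []      g       = ≈ₚ-refl
    *ₚ-distribʳ h (a ∷ f) []      = ≈ₚ-sym (P.identityʳ _)
    *ₚ-distribʳ h (a ∷ f) (b ∷ g) = begin
      (a + b) ·ₚ h +ₚ shift ((f +ₚ g) *ₚ h)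
        ≈⟨ +ₚ-cong (·ₚ-distribʳ h a b) (≈ₚ-trans (∷-cong refl (*ₚ-distribʳ h f g)) (shift-+ (f *ₚ h) (g *ₚ h))) ⟩
      (a ·ₚ h +ₚ b ·ₚ h) +ₚ (shift (f *ₚ h) +ₚ shift (g *ₚ h))
        ≈⟨ interchange (a ·ₚ h) (b ·ₚ h) (shift (f *ₚ h)) (shift (g *ₚ h)) ⟩
      (a ·ₚ h +ₚ shift (f *ₚ h)) +ₚ (b ·ₚ h +ₚ shift (g *ₚ h))
        ∎

    -- Multiplication recurses on its left factor. Expanding the right factor instead is the step
    -- that the induction for `*ₚ-comm` needs.
    *ₚ-∷ : ∀ f b g → f *ₚ (b ∷ g) ≈ₚ b ·ₚ f +ₚ shift (f *ₚ g)
    *ₚ-∷ []      b g = ≈ₚ-sym 0∷[]≈[]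
    *ₚ-∷ (a ∷ f) b g = ∷-cong (+-congʳ (*-comm a b)) (begin
      a ·ₚ g +ₚ f *ₚ (b ∷ g)                 ≈⟨ +ₚ-cong ≈ₚ-refl (*ₚ-∷ f b g) ⟩
      a ·ₚ g +ₚ (b ·ₚ f +ₚ shift (f *ₚ g))   ≈⟨ x∙yz≈y∙xz (a ·ₚ g) (b ·ₚ f) (shift (f *ₚ g)) ⟩
      b ·ₚ f +ₚ (a ·ₚ g +ₚ shift (f *ₚ g))   ∎)

    *ₚ-[] : ∀ f → f *ₚ [] ≈ₚ []
    *ₚ-[] []      = ≈ₚ-refl
    *ₚ-[] (a ∷ f) = ∷≈[] refl (*ₚ-[] f)

    *ₚ-comm : ∀ f g → f *ₚ g ≈ₚ g *ₚ f
    *ₚ-comm []      g = ≈ₚ-sym (*ₚ-[] g)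
    *ₚ-comm (a ∷ f) g = ≈ₚ-trans (+ₚ-cong ≈ₚ-refl (∷-cong refl (*ₚ-comm f g))) (≈ₚ-sym (*ₚ-∷ g a f))

    ·ₚ-*ₚ : ∀ a f g → (a ·ₚ f) *ₚ g ≈ₚ a ·ₚ (f *ₚ g)
    ·ₚ-*ₚ a []      g = ≈ₚ-refl
    ·ₚ-*ₚ a (b ∷ f) g = begin
      (a * b) ·ₚ g +ₚ shift ((a ·ₚ f) *ₚ g)  ≈⟨ +ₚ-cong (·ₚ-assoc a b g) (∷-cong (sym (zeroʳ a)) (·ₚ-*ₚ a f g)) ⟩
      a ·ₚ b ·ₚ g +ₚ a ·ₚ shift (f *ₚ g)     ≈⟨ ·ₚ-distribˡ a (b ·ₚ g) (shift (f *ₚ g)) ⟨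
      a ·ₚ (b ·ₚ g +ₚ shift (f *ₚ g))        ∎

  shift-*ₚ : ∀ f g → (0# ∷ f) *ₚ g ≈ₚ 0# ∷ (f *ₚ g)
  shift-*ₚ f g = +ₚ-cong (0·ₚ g) ≈ₚ-refl

  private
    *ₚ-assoc : ∀ f g h → (f *ₚ g) *ₚ h ≈ₚ f *ₚ (g *ₚ h)
    *ₚ-assoc []      g h = ≈ₚ-refl
    *ₚ-assoc (a ∷ f) g h = begin
      (a ·ₚ g +ₚ shift (f *ₚ g)) *ₚ h        ≈⟨ *ₚ-distribʳ h (a ·ₚ g) (shift (f *ₚ g)) ⟩
      (a ·ₚ g) *ₚ h +ₚ shift (f *ₚ g) *ₚ h   ≈⟨ +ₚ-cong (·ₚ-*ₚ a g h) (shift-*ₚ (f *ₚ g) h) ⟩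
      a ·ₚ (g *ₚ h) +ₚ shift ((f *ₚ g) *ₚ h) ≈⟨ +ₚ-cong ≈ₚ-refl (∷-cong refl (*ₚ-assoc f g h)) ⟩
      a ·ₚ (g *ₚ h) +ₚ shift (f *ₚ (g *ₚ h)) ∎

    *ₚ-identityˡ : ∀ f → 1ₚ *ₚ f ≈ₚ f
    *ₚ-identityˡ f = begin
      1# ·ₚ f +ₚ shift []  ≈⟨ +ₚ-cong (1·ₚ f) 0∷[]≈[] ⟩
      f +ₚ []              ≈⟨ P.identityʳ f ⟩
      f                    ∎

  polyRing : CommutativeRing c ℓ
  polyRing = record
    { Carrier = Poly ; _≈_ = _≈ₚ_ ; _+_ = _+ₚ_ ; _*_ = _*ₚ_ ; -_ = -ₚ_ ; 0# = 0ₚ ; 1# = 1ₚ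
    ; isCommutativeRing = record
      { isRing = record
        { +-isAbelianGroup = P.isAbelianGroup
        ; *-cong     = λ {f} {f′} {g} p q → ≈ₚ-trans (*ₚ-congʳ f f′ g p) (*ₚ-congˡ f′ q)
        ; *-assoc    = *ₚ-assoc
        ; *-identity = *ₚ-identityˡ , λ f → ≈ₚ-trans (*ₚ-comm f 1ₚ) (*ₚ-identityˡ f)
        ; distrib    = (λ h f g → ≈ₚ-trans (*ₚ-comm h (f +ₚ g)) (≈ₚ-trans (*ₚ-distribʳ h f g)
                         (+ₚ-cong (*ₚ-comm f h) (*ₚ-comm g h))))
                     , *ₚ-distribʳ
        }
      ; *-comm = *ₚ-comm
      }
    }

  X : Poly
  X = 0# ∷ 1# ∷ []

  const : Carrier → Poly
  const a = a ∷ []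

  X*ₚ : ∀ f → X *ₚ f ≈ₚ 0# ∷ f
  X*ₚ f = ≈ₚ-trans (shift-*ₚ 1ₚ f) (∷-cong refl (*ₚ-identityˡ f))

  const-*ₚ : ∀ a f → const a *ₚ f ≈ₚ a ·ₚ f
  const-*ₚ a f = ≈ₚ-trans (+ₚ-cong ≈ₚ-refl 0∷[]≈[]) (P.identityʳ _)

  -- Turns a list cell into a ring expression, so that long division and Horner steps become
  -- instances of ring identities.
  ∷≈const+X* : ∀ a f → a ∷ f ≈ₚ const a +ₚ X *ₚ f
  ∷≈const+X* a f = ≈ₚ-trans (∷-cong (sym (+-identityʳ a)) ≈ₚ-refl) (+ₚ-cong (≈ₚ-refl {const a}) (≈ₚ-sym (X*ₚ f)))

  Degree<-resp : ∀ {f g n} → f ≈ₚ g → Degree< f n → Degree< g n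
  Degree<-resp f≈g f<n i n≤i = trans (sym (coeff-≈ f≈g i)) (f<n i n≤i)

  Degree<-mono : ∀ {f m n} → m ≤ n → Degree< f m → Degree< f n
  Degree<-mono m≤n f<m i n≤i = f<m i (≤-trans m≤n n≤i)
    where open import Data.Nat.Properties using (≤-trans)

  Degree<-+ : ∀ {f g n} → Degree< f n → Degree< g n → Degree< (f +ₚ g) n
  Degree<-+ {f} {g} f<n g<n i n≤i =
    trans (coeff-+ f g i) (trans (+-cong (f<n i n≤i) (g<n i n≤i)) (+-identityˡ 0#))

  Degree<-neg : ∀ {f n} → Degree< f n → Degree< (-ₚ f) n
  Degree<-neg {f} f<n i n≤i = trans (coeff-neg f i) (trans (-‿cong (f<n i n≤i)) -0#≈0#)

  Degree<-· : ∀ {a f n} → Degree< f n → Degree< (a ·ₚ f) n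
  Degree<-· {a} {f} f<n i n≤i = trans (coeff-· a f i) (trans (*-congˡ (f<n i n≤i)) (zeroʳ a))

  Degree<0⇒≈0 : ∀ {f} → Degree< f 0 → f ≈ₚ 0ₚ
  Degree<0⇒≈0 f<0 = mk≈ₚ λ i → f<0 i z≤n

  Degree<-tail : ∀ {a f n} → Degree< (a ∷ f) (suc n) → Degree< f n
  Degree<-tail p i n≤i = p (suc i) (s≤s n≤i)

  Degree<-∷ : ∀ {a f n} → Degree< f n → Degree< (a ∷ f) (suc n)
  Degree<-∷ p (suc i) (s≤s n≤i) = p i n≤i

  Degree≤-* : ∀ f {g m n} → Degree≤ f m → Degree≤ g n → Degree≤ (f *ₚ g) (m ℕ.+ n)
  Degree≤-* []      p q i _ = refl
  Degree≤-* (a ∷ f) {g} {m} {n} p q = Degree<-+ {a ·ₚ g}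
    (Degree<-mono {a ·ₚ g} (s≤s (m≤n+m n m)) (Degree<-· {a} {g} q)) (high m p)
    where
    open import Data.Nat.Properties using (m≤n+m)
    -- The shift raises the degree by one. For `m` equal to 0 this would break the bound, but then
    -- the tail `f` vanishes.
    high : ∀ m → Degree≤ (a ∷ f) m → Degree≤ (0# ∷ f *ₚ g) (m ℕ.+ n)
    high zero    p = Degree<-∷ (λ i _ → coeff-≈ (*ₚ-zeroˡ f g (Degree<0⇒≈0 (Degree<-tail p))) i)
    high (suc m) p = Degree<-∷ (Degree≤-* f (Degree<-tail p) q)

  coeff-* : ∀ f {g m n} → Degree≤ f m → Degree≤ g n → coeff (f *ₚ g) (m ℕ.+ n) ≈ coeff f m * coeff g n
  coeff-* []      p q = sym (zeroˡ _)
  coeff-* (a ∷ f) {g} {zero} {n} p q =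
    trans (coeff-+ (a ·ₚ g) _ n) (trans (+-cong
      (coeff-· a g n) (coeff-≈ (∷≈[] refl (*ₚ-zeroˡ f g (Degree<0⇒≈0 (Degree<-tail p)))) n)) (+-identityʳ _))
  coeff-* (a ∷ f) {g} {suc m} {n} p q =
    trans (coeff-+ (a ·ₚ g) _ (suc (m ℕ.+ n))) (trans (+-cong
      (Degree<-· {a} {g} q (suc (m ℕ.+ n)) (s≤s (m≤n+m n m))) (coeff-* f (Degree<-tail p) q)) (+-identityˡ _))
    where open import Data.Nat.Properties using (m≤n+m)

  Monic : Poly → ℕ → Set ℓ
  Monic f n = coeff f n ≈ 1# × Degree≤ f n

  Monic-1 : Monic 1ₚ 0
  Monic-1 = refl , λ { (suc i) _ → refl }

-- Binomial coefficients and the Frobenius map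

[k+1]*[n+1]C[k+1]≡[n+1]*nCk : ∀ n k → suc k ℕ.* (suc n C suc k) ≡ suc n ℕ.* (n C k)
[k+1]*[n+1]C[k+1]≡[n+1]*nCk zero zero = ≡.refl
[k+1]*[n+1]C[k+1]≡[n+1]*nCk zero (suc k) = ℕ.*-zeroʳ (suc (suc k))
[k+1]*[n+1]C[k+1]≡[n+1]*nCk (suc n) zero = begin
  1 ℕ.* (suc (suc n) C 1)               ≡⟨ ℕ.*-identityˡ _ ⟩
  suc (suc n) C 1                       ≡⟨ nC1≡n (suc (suc n)) ⟩
  suc (suc n)                           ≡⟨ ℕ.*-identityʳ _ ⟨
  suc (suc n) ℕ.* (suc n C 0)           ∎
  where open ≡.≡-Reasoning
[k+1]*[n+1]C[k+1]≡[n+1]*nCk (suc n) (suc k) = begin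
  suc (suc k) ℕ.* (suc (suc n) C suc (suc k))       ≡⟨ ≡.cong (suc (suc k) ℕ.*_) (nCk+nC[k+1]≡[n+1]C[k+1] (suc n) (suc k)) ⟨
  suc (suc k) ℕ.* (a ℕ.+ b)                         ≡⟨ ℕ.*-distribˡ-+ (suc (suc k)) a b ⟩
  a ℕ.+ suc k ℕ.* a ℕ.+ suc (suc k) ℕ.* b           ≡⟨ ≡.cong₂ (λ x y → a ℕ.+ x ℕ.+ y) ([k+1]*[n+1]C[k+1]≡[n+1]*nCk n k) ([k+1]*[n+1]C[k+1]≡[n+1]*nCk n (suc k)) ⟩
  a ℕ.+ suc n ℕ.* (n C k) ℕ.+ suc n ℕ.* (n C suc k) ≡⟨ ℕ.+-assoc a _ _ ⟩
  a ℕ.+ (suc n ℕ.* (n C k) ℕ.+ suc n ℕ.* (n C suc k)) ≡⟨ ≡.cong (a ℕ.+_) (ℕ.*-distribˡ-+ (suc n) (n C k) (n C suc k)) ⟨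
  a ℕ.+ suc n ℕ.* ((n C k) ℕ.+ (n C suc k))         ≡⟨ ≡.cong (λ x → a ℕ.+ suc n ℕ.* x) (nCk+nC[k+1]≡[n+1]C[k+1] n k) ⟩
  suc (suc n) ℕ.* a                                 ∎
  where
  open ≡.≡-Reasoning
  a = suc n C suc k
  b = suc n C suc (suc k)

-- By the absorption identity p divides the product of k + 1 and the binomial coefficient, and it
-- cannot divide the smaller positive number k + 1.
p∣pCk : ∀ {p} k → Prime p → suc k < p → p ∣ℕ p C suc k
p∣pCk {suc n} k p-prime k<p with euclidsLemma (suc k) (suc n C suc k) p-prime
    (≡.subst (suc n ∣ℕ_) (≡.sym ([k+1]*[n+1]C[k+1]≡[n+1]*nCk n k)) (m∣m*n (n C k)))
... | inj₁ p∣k = contradiction (∣⇒≤ p∣k) (ℕ.<⇒≱ k<p)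
... | inj₂ p∣C = p∣C

module Frobenius {c ℓ} (R : CommutativeRing c ℓ) where
  open CommutativeRing R hiding (zero)
  open import Algebra.Properties.Semiring.Exp semiring using (_^_; ^-congˡ; ^-assocʳ)
  open import Algebra.Properties.Semiring.Mult semiring using (×-congˡ; ×-congʳ; ×-assocˡ; ×-assoc-*) renaming (_×_ to _·_)
  open import Algebra.Properties.CommutativeSemiring.Binomial commutativeSemiring using (theorem; binomialTerm)
  open import Algebra.Properties.Semiring.Sum semiring using (sum; sum-init-last; sum-cong-≋; sum-replicate-zero)
  open import Relation.Binary.Reasoning.Setoid setoid

  -- Minimality of `n` is not asked for: the order q of a finite field also satisfies this, and the
  -- prime p is extracted from it later.
  Characteristic : ℕ → Set ℓ
  Characteristic n = n · 1# ≈ 0#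

  ∣⇒·≈0 : ∀ {p n} → Characteristic p → p ∣ℕ n → ∀ x → n · x ≈ 0#
  ∣⇒·≈0 {p} char (dividesℕ k ≡.refl) x = begin
    (k ℕ.* p) · x        ≈⟨ ×-congˡ (ℕ.*-comm k p) ⟩
    (p ℕ.* k) · x        ≈⟨ ×-assocˡ x p k ⟨
    p · (k · x)          ≈⟨ ×-congʳ p (*-identityˡ (k · x)) ⟨
    p · (1# * (k · x))   ≈⟨ ×-assoc-* p 1# (k · x) ⟨
    (p · 1#) * (k · x)   ≈⟨ *-congʳ char ⟩
    0# * (k · x)         ≈⟨ zeroˡ _ ⟩
    0#                   ∎

  frobenius : ∀ {p} → Prime p → Characteristic p → ∀ x y → (x + y) ^ p ≈ x ^ p + y ^ p
  frobenius {zero}  p-prime char x y = contradiction p-prime ¬prime[0]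
  frobenius {suc n} p-prime char x y = begin
    (x + y) ^ suc n                                                 ≈⟨ theorem (suc n) x y ⟩
    t zero + sum (λ k → t (suc k))                                  ≈⟨ +-congˡ (sum-init-last (λ k → t (suc k))) ⟩
    t zero + (sum (λ k → t (suc (inject₁ k))) + t (suc (fromℕ n)))  ≈⟨ +-cong t₀ (+-cong (trans (sum-cong-≋ middle) (sum-replicate-zero n)) tₙ) ⟩
    y ^ suc n + (0# + x ^ suc n)                                    ≈⟨ +-congˡ (+-identityˡ _) ⟩
    y ^ suc n + x ^ suc n                                           ≈⟨ +-comm _ _ ⟩
    x ^ suc n + y ^ suc n                                           ∎
    where
    t = binomialTerm x y (suc n)
    t₀ : t zero ≈ y ^ suc n
    t₀ = trans (+-identityʳ _) (*-identityˡ _)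
    tₙ : t (suc (fromℕ n)) ≈ x ^ suc n
    tₙ rewrite Fin.toℕ-fromℕ n | nCn≡1 (suc n) | ℕ.n∸n≡0 n = trans (+-identityʳ _) (*-identityʳ _)
    middle : ∀ k → t (suc (inject₁ k)) ≈ 0#
    middle k = ∣⇒·≈0 char (p∣pCk (toℕ (inject₁ k)) p-prime
      (s≤s (≡.subst (_< n) (≡.sym (Fin.toℕ-inject₁ k)) (Fin.toℕ<n k)))) _

  module _ {p} (p-prime : Prime p) (char : Characteristic p) where

    frobenius^ : ∀ k x y → (x + y) ^ (p ℕ.^ k) ≈ x ^ (p ℕ.^ k) + y ^ (p ℕ.^ k)
    frobenius^ zero    x y = trans (*-identityʳ _) (+-cong (sym (*-identityʳ x)) (sym (*-identityʳ y)))
    frobenius^ (suc k) x y = begin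
      (x + y) ^ (p ℕ.* p ℕ.^ k)                      ≈⟨ ^-assocʳ (x + y) p (p ℕ.^ k) ⟨
      ((x + y) ^ p) ^ (p ℕ.^ k)                      ≈⟨ ^-congˡ (p ℕ.^ k) (frobenius p-prime char x y) ⟩
      (x ^ p + y ^ p) ^ (p ℕ.^ k)                    ≈⟨ frobenius^ k (x ^ p) (y ^ p) ⟩
      (x ^ p) ^ (p ℕ.^ k) + (y ^ p) ^ (p ℕ.^ k)      ≈⟨ +-cong (^-assocʳ x p (p ℕ.^ k)) (^-assocʳ y p (p ℕ.^ k)) ⟩
      x ^ (p ℕ.* p ℕ.^ k) + y ^ (p ℕ.* p ℕ.^ k)      ∎

-- Quotient rings

module Quotient {c ℓ} (R : CommutativeRing c ℓ) (m : CommutativeRing.Carrier R) where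
  open CommutativeRing R hiding (zero)
  open IntegerSolver R
  open import Algebra.Definitions.RawMagma *-rawMagma using (_∣_; _,_)
  open import Algebra.Properties.Semiring.Divisibility semiring using (_∣0)
  open import Algebra.Properties.Semigroup.Divisibility *-semigroup using (x∣ʳy⇒x∣ʳzy)
  open import Algebra.Properties.Magma.Divisibility *-magma using (∣ʳ-respʳ-≈)
  open import Level using (_⊔_)

  infix 4 _≋_
  record _≋_ (x y : Carrier) : Set (c ⊔ ℓ) where
    constructor mod
    field m∣x-y : m ∣ x - y
  open _≋_ public

  ≈⇒≋ : ∀ {x y} → x ≈ y → x ≋ y
  ≈⇒≋ {x} {y} x≈y = mod (∣ʳ-respʳ-≈ (trans (sym (-‿inverseʳ y)) (+-congʳ (sym x≈y))) (m ∣0))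

  private
    ∣-+ : ∀ {x y} → m ∣ x → m ∣ y → m ∣ x + y
    ∣-+ (k , km≈x) (l , lm≈y) = k + l , trans (distribʳ m k l) (+-cong km≈x lm≈y)

    ∣-combine : ∀ {x y z} → m ∣ x → m ∣ y → x + y ≈ z → m ∣ z
    ∣-combine p q eq = ∣ʳ-respʳ-≈ eq (∣-+ p q)

  -- Only the equality is coarsened, so each element serves as its own residue class, and the ring
  -- laws are inherited through `≈⇒≋`.
  quotientRing : CommutativeRing c (c ⊔ ℓ)
  quotientRing = record
    { Carrier = Carrier ; _≈_ = _≋_ ; _+_ = _+_ ; _*_ = _*_ ; -_ = -_ ; 0# = 0# ; 1# = 1#
    ; isCommutativeRing = record
      { isRing = record
        { +-isAbelianGroup = record
          { isGroup = record
            { isMonoid = record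
              { isSemigroup = record
                { isMagma = record
                  { isEquivalence = record
                    { refl  = ≈⇒≋ refl
                    ; sym   = λ {x} {y} (mod p) → mod (∣ʳ-respʳ-≈
                        (solve 2 (λ x y → (:- :1) :* (x :- y) := y :- x) refl x y) (x∣ʳy⇒x∣ʳzy (- 1#) p))
                    ; trans = λ {x} {y} {z} (mod p) (mod q) → mod (∣-combine p q
                        (solve 3 (λ x y z → (x :- y) :+ (y :- z) := x :- z) refl x y z))
                    }
                  ; ∙-cong = λ {x} {y} {u} {v} (mod p) (mod q) → mod (∣-combine p q
                      (solve 4 (λ x y u v → (x :- y) :+ (u :- v) := (x :+ u) :- (y :+ v)) refl x y u v))
                  }
                ; assoc = λ x y z → ≈⇒≋ (+-assoc x y z)
                }
              ; identity = (λ x → ≈⇒≋ (+-identityˡ x)) , (λ x → ≈⇒≋ (+-identityʳ x))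
              }
            ; inverse = (λ x → ≈⇒≋ (-‿inverseˡ x)) , (λ x → ≈⇒≋ (-‿inverseʳ x))
            ; ⁻¹-cong = λ {x} {y} (mod p) → mod (∣ʳ-respʳ-≈
                (solve 2 (λ x y → (:- :1) :* (x :- y) := :- x :- :- y) refl x y) (x∣ʳy⇒x∣ʳzy (- 1#) p))
            }
          ; comm = λ x y → ≈⇒≋ (+-comm x y)
          }
        ; *-cong = λ {x} {y} {u} {v} (mod p) (mod q) → mod (∣-combine (x∣ʳy⇒x∣ʳzy u p) (x∣ʳy⇒x∣ʳzy y q)
            (solve 4 (λ x y u v → u :* (x :- y) :+ y :* (u :- v) := x :* u :- y :* v) refl x y u v))
        ; *-assoc    = λ x y z → ≈⇒≋ (*-assoc x y z)
        ; *-identity = (λ x → ≈⇒≋ (*-identityˡ x)) , (λ x → ≈⇒≋ (*-identityʳ x))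
        ; distrib    = (λ x y z → ≈⇒≋ (distribˡ x y z)) , (λ x y z → ≈⇒≋ (distribʳ x y z))
        }
      ; *-comm = λ x y → ≈⇒≋ (*-comm x y)
      }
    }

  ∣⇒≋0 : ∀ {x} → m ∣ x → x ≋ 0#
  ∣⇒≋0 {x} m∣x = mod (∣ʳ-respʳ-≈ (solve 1 (λ x → x := x :- :0) refl x) m∣x)

  ≋0⇒∣ : ∀ {x} → x ≋ 0# → m ∣ x
  ≋0⇒∣ {x} (mod p) = ∣ʳ-respʳ-≈ (solve 1 (λ x → x :- :0 := x) refl x) p

-- Evaluation and the number of roots

NoZeroDivisors : ∀ {c ℓ} → CommutativeRing c ℓ → Set _
NoZeroDivisors R = ∀ x y → x * y ≈ 0# → x ≈ 0# ⊎ y ≈ 0#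
  where open CommutativeRing R

module Evaluation {c ℓ} (R : CommutativeRing c ℓ) where
  open CommutativeRing R hiding (zero)
  open Polynomials R
  open PolynomialRing R using (Degree<-tail; Degree<0⇒≈0)
  open IntegerSolver R
  open import Algebra.Properties.Semiring.Exp semiring using (_^_)
  open import Relation.Binary.Reasoning.Setoid setoid

  eval : Poly → Carrier → Carrier
  eval []      x = 0#
  eval (a ∷ f) x = a + x * eval f x

  eval-+ : ∀ f g x → eval (f +ₚ g) x ≈ eval f x + eval g x
  eval-+ []      g       x = sym (+-identityˡ _)
  eval-+ (a ∷ f) []      x = sym (+-identityʳ _)
  eval-+ (a ∷ f) (b ∷ g) x = trans (+-congˡ (*-congˡ (eval-+ f g x)))
    (solve 5 (λ a b x u v → a :+ b :+ x :* (u :+ v) := (a :+ x :* u) :+ (b :+ x :* v)) refl a b x _ _)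

  eval-≈0 : ∀ f x → f ≈ₚ 0ₚ → eval f x ≈ 0#
  eval-≈0 []      x p = refl
  eval-≈0 (a ∷ f) x p = trans (+-cong (coeff-≈ p 0) (trans (*-congˡ (eval-≈0 f x (mk≈ₚ λ i → coeff-≈ p (suc i)))) (zeroʳ x)))
    (+-identityˡ 0#)

  monomial : ℕ → Poly
  monomial zero    = 1ₚ
  monomial (suc n) = 0# ∷ monomial n

  eval-monomial : ∀ n x → eval (monomial n) x ≈ x ^ n
  eval-monomial zero    x = trans (+-congˡ (zeroʳ x)) (+-identityʳ 1#)
  eval-monomial (suc n) x = trans (+-identityˡ _) (*-congˡ (eval-monomial n x))

  coeff-monomial : ∀ n → coeff (monomial n) n ≈ 1#
  coeff-monomial zero    = refl
  coeff-monomial (suc n) = coeff-monomial n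

  coeff-monomial-≢ : ∀ n i → n ≢ i → coeff (monomial n) i ≈ 0#
  coeff-monomial-≢ zero    zero    p = contradiction ≡.refl p
  coeff-monomial-≢ zero    (suc i) p = refl
  coeff-monomial-≢ (suc n) zero    p = refl
  coeff-monomial-≢ (suc n) (suc i) p = coeff-monomial-≢ n i (λ eq → p (≡.cong suc eq))

  -- Synthetic division: the values that Horner's rule produces at `r` are the coefficients of the
  -- quotient of `f` by X - r, up to a trailing zero.
  deflate : Carrier → Poly → Poly
  deflate r []      = []
  deflate r (a ∷ f) = eval f r ∷ deflate r f

  eval-deflate : ∀ r f x → eval f x ≈ (x - r) * eval (deflate r f) x + eval f r
  eval-deflate r []      x = solve 2 (λ x r → :0 := (x :- r) :* :0 :+ :0) refl x r
  eval-deflate r (a ∷ f) x = trans (+-congˡ (*-congˡ (eval-deflate r f x)))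
    (solve 5 (λ a x r u v → a :+ x :* ((x :- r) :* u :+ v) := (x :- r) :* (v :+ x :* u) :+ (a :+ r :* v)) refl
      a x r _ _)

  coeff-deflate : ∀ r f n → Degree≤ f (suc n) → coeff (deflate r f) n ≈ coeff f (suc n)
  coeff-deflate r []      n       p = refl
  coeff-deflate r (a ∷ []) zero   p = refl
  coeff-deflate r (a ∷ b ∷ f) zero p = trans (+-congˡ (trans (*-congˡ
    (eval-≈0 f r (Degree<0⇒≈0 (Degree<-tail (Degree<-tail p))))) (zeroʳ r))) (+-identityʳ b)
  coeff-deflate r (a ∷ f) (suc n) p = coeff-deflate r f n (Degree<-tail p)

  deflate-degree : ∀ r f n → Degree≤ f n → Degree< (deflate r f) n
  deflate-degree r []      n       p i       n≤i       = refl
  deflate-degree r (a ∷ f) zero    p zero    n≤i       = eval-≈0 f r (Degree<0⇒≈0 (Degree<-tail p))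
  deflate-degree r (a ∷ f) zero    p (suc i) n≤i       =
    deflate-degree r f 0 (λ j _ → Degree<-tail p j z≤n) i z≤n
  deflate-degree r (a ∷ f) (suc n) p (suc i) (s≤s n≤i) = deflate-degree r f n (Degree<-tail p) i n≤i

  module _ (noZeroDivisors : NoZeroDivisors R) where

    -- Stated over a ring without zero divisors rather than over F, because it will be applied to T
    -- ^ Q - T with coefficients in a residue ring of polynomials.
    too-many-roots : ∀ n f → HasDegree f n → (r : Fin (suc n) → Carrier) →
      (∀ i → eval f (r i) ≈ 0#) → (∀ {i j} → r i ≈ r j → i ≡ j) → ⊥
    too-many-roots zero [] (lc , _) r root inj = lc refl
    too-many-roots zero (a ∷ f) (lc , deg) r root inj = lc (begin
      a                          ≈⟨ +-identityʳ a ⟨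
      a + 0#                     ≈⟨ +-congˡ (zeroʳ _) ⟨
      a + r zero * 0#            ≈⟨ +-congˡ (*-congˡ (eval-≈0 f _ (Degree<0⇒≈0 (Degree<-tail deg)))) ⟨
      eval (a ∷ f) (r zero)      ≈⟨ root zero ⟩
      0#                         ∎)
    too-many-roots (suc n) f (lc , deg) r root inj =
      too-many-roots n (deflate r₀ f)
        ((λ p → lc (trans (sym (coeff-deflate r₀ f n deg)) p)) , deflate-degree r₀ f (suc n) deg)
        (λ i → r (suc i)) root′ (λ p → Fin.suc-injective (inj p))
      where
      r₀ = r zero
      root′ : ∀ i → eval (deflate r₀ f) (r (suc i)) ≈ 0#
      root′ i with noZeroDivisors (r (suc i) - r₀) (eval (deflate r₀ f) (r (suc i))) (begin
          (r (suc i) - r₀) * eval (deflate r₀ f) (r (suc i))             ≈⟨ +-identityʳ _ ⟨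
          (r (suc i) - r₀) * eval (deflate r₀ f) (r (suc i)) + 0#        ≈⟨ +-congˡ (root zero) ⟨
          (r (suc i) - r₀) * eval (deflate r₀ f) (r (suc i)) + eval f r₀ ≈⟨ eval-deflate r₀ f (r (suc i)) ⟨
          eval f (r (suc i))                                             ≈⟨ root (suc i) ⟩
          0#                                                             ∎)
      ... | inj₁ p = contradiction (inj (x∙y⁻¹≈ε⇒x≈y _ _ p)) λ ()
        where open import Algebra.Properties.AbelianGroup +-abelianGroup using (x∙y⁻¹≈ε⇒x≈y)
      ... | inj₂ p = p

-- Discrete fields and finite fields

module _ {c ℓ} (M : CommutativeMonoid c ℓ) where
  open CommutativeMonoid M
  open import Algebra.Properties.CommutativeMonoid.Sum M using (sum; sum-cong-≋; sum-replicate-zero)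

  sum-single : ∀ {n} (k : Fin n) (t : Fin n → Carrier) → (∀ i → i ≢ k → t i ≈ ε) → sum t ≈ t k
  sum-single {suc n} zero    t p = trans (∙-congˡ (trans (sum-cong-≋ (λ i → p (suc i) λ ())) (sum-replicate-zero n))) (identityʳ _)
  sum-single {suc n} (suc k) t p = trans (∙-cong (p zero λ ()) (sum-single k (λ i → t (suc i)) λ i i≢k → p (suc i) λ eq → i≢k (Fin.suc-injective eq)))
    (identityˡ _)

-- The interface through which polynomial arithmetic sees the field. A Heyting field need not have
-- decidable equality; the finite order supplies it.
record IsDiscreteField {c ℓ} (R : CommutativeRing c ℓ) : Set (c Level.⊔ ℓ) where
  open CommutativeRing R
  field
    _≟_     : Decidable _≈_
    1≉0     : ¬ 1# ≈ 0#
    inverse : ∀ {x} → ¬ x ≈ 0# → ∃[ y ] y * x ≈ 1#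

  noZeroDivisors : NoZeroDivisors R
  noZeroDivisors x y xy≈0 with x ≟ 0#
  ... | yes x≈0 = inj₁ x≈0
  ... | no  x≉0 = let x⁻¹ , x⁻¹x≈1 = inverse x≉0 in inj₂ (begin
    y                ≈⟨ *-identityˡ y ⟨
    1# * y           ≈⟨ *-congʳ x⁻¹x≈1 ⟨
    x⁻¹ * x * y      ≈⟨ *-assoc x⁻¹ x y ⟩
    x⁻¹ * (x * y)    ≈⟨ *-congˡ xy≈0 ⟩
    x⁻¹ * 0#         ≈⟨ zeroʳ x⁻¹ ⟩
    0#               ∎)
    where open import Relation.Binary.Reasoning.Setoid setoid

  x*y≉0 : ∀ {x y} → ¬ x ≈ 0# → ¬ y ≈ 0# → ¬ x * y ≈ 0#
  x*y≉0 x≉0 y≉0 xy≈0 = [ x≉0 , y≉0 ]′ (noZeroDivisors _ _ xy≈0)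

  *-cancelʳ-≉0 : ∀ {x y z} → ¬ z ≈ 0# → x * z ≈ y * z → x ≈ y
  *-cancelʳ-≉0 {x} {y} {z} z≉0 xz≈yz = [ x∙y⁻¹≈ε⇒x≈y x y , (λ z≈0 → contradiction z≈0 z≉0) ]′
    (noZeroDivisors (x - y) z (trans ([y-z]x≈yx-zx z x y) (x≈y⇒x∙y⁻¹≈ε xz≈yz)))
    where
    open import Algebra.Properties.Group +-group using (x∙y⁻¹≈ε⇒x≈y; x≈y⇒x∙y⁻¹≈ε)
    open import Algebra.Properties.Ring ring using ([y-z]x≈yx-zx)

module FiniteField {c ℓ₁ ℓ₂} (F : HeytingField c ℓ₁ ℓ₂) {q} (order : HasOrder F q) where
  private module H = HeytingField F
  open CommutativeRing (fieldRing F) hiding (zero)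
  open Inverse order using (to-cong; strictlyInverseˡ; strictlyInverseʳ) renaming (to to index; from to element) public
  open import Algebra.Properties.Group +-group using (x∙y⁻¹≈ε⇒x≈y; x≈y⇒x∙y⁻¹≈ε; //-rightDividesˡ; //-rightDividesʳ; identityʳ-unique)
  open import Algebra.Properties.Semiring.Exp semiring using (_^_)
  open import Algebra.Properties.Semiring.Mult semiring using () renaming (_×_ to _·_)
  open import Relation.Binary.Reasoning.Setoid setoid
  open Frobenius (fieldRing F) using (Characteristic)
  private
    module Σ+ = Algebra.Properties.CommutativeMonoid.Sum +-commutativeMonoid
    module Π* = Algebra.Properties.CommutativeMonoid.Sum *-commutativeMonoid

  element-index : ∀ x → element (index x) ≈ x
  element-index = strictlyInverseʳ

  index-injective : ∀ {x y} → index x ≡ index y → x ≈ y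
  index-injective {x} {y} eq = trans (sym (element-index x)) (trans (reflexive (≡.cong element eq)) (element-index y))

  element-injective : ∀ {i j} → element i ≈ element j → i ≡ j
  element-injective {i} {j} p = ≡.trans (≡.sym (strictlyInverseˡ i)) (≡.trans (to-cong p) (strictlyInverseˡ j))

  isDiscreteField : IsDiscreteField (fieldRing F)
  isDiscreteField = record { _≟_ = _≟_ ; 1≉0 = 1≉0 ; inverse = inverse }
    where
    _≟_ : Decidable _≈_
    x ≟ y = map′ index-injective to-cong (index x Fin.≟ index y)

    1≉0 : ¬ 1# ≈ 0#
    -- If 1 were 0, then 0 would be its own inverse and hence be apart from itself.
    1≉0 1≈0 = proj₂ (H.tight 0# 0#) refl (H.invertible⇒# (0# , trans (zeroˡ _) (sym 1≈0) , trans (zeroʳ _) (sym 1≈0)))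

    inverse : ∀ {x} → ¬ x ≈ 0# → ∃[ y ] y * x ≈ 1#
    inverse {x} x≉0 with Fin.any? (λ i → (element i * x) ≟ 1#)
    ... | yes (i , p) = element i , p
    -- Apartness from 0 would provide an inverse, which the search has excluded; tightness then
    -- makes x equal to 0.
    ... | no ¬p = contradiction (proj₁ (H.tight x 0#) λ x#0 →
      let y , yx≈1 , _ = H.#⇒invertible x#0 in
      ¬p (index y , trans (*-cong (element-index y) (sym (x-0≈x x))) yx≈1)) x≉0
      where
      x-0≈x : ∀ x → x - 0# ≈ x
      x-0≈x x = trans (+-congˡ -0#≈0#) (+-identityʳ x)
        where open import Algebra.Properties.Ring ring using (-0#≈0#)

  open IsDiscreteField isDiscreteField

  private
    permute : (s t : Carrier → Carrier) → (∀ {x y} → x ≈ y → s x ≈ s y) → (∀ {x y} → x ≈ y → t x ≈ t y) →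
              (∀ x → s (t x) ≈ x) → (∀ x → t (s x) ≈ x) → Permutation′ q
    permute s t s-cong t-cong st ts = permutation (λ i → index (s (element i))) (λ i → index (t (element i)))
      (λ i → ≡.trans (to-cong (trans (s-cong (element-index _)) (st _))) (strictlyInverseˡ i))
      (λ i → ≡.trans (to-cong (trans (t-cong (element-index _)) (ts _))) (strictlyInverseˡ i))

  -- Translation by 1 permutes the field, so the sum of all elements does not change when 1 is added
  -- to each of its q terms.
  q·1≈0 : Characteristic q
  q·1≈0 = identityʳ-unique (Σ+.sum element) (q · 1#) (begin
    Σ+.sum element + q · 1#                              ≈⟨ +-congˡ (Σ+.sum-replicate q) ⟨
    Σ+.sum element + Σ+.sum {q} (λ _ → 1#)               ≈⟨ Σ+.∑-distrib-+ element (λ _ → 1#) ⟨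
    Σ+.sum (λ i → element i + 1#)                        ≈⟨ Σ+.sum-cong-≋ (λ i → element-index (element i + 1#)) ⟨
    Σ+.sum (λ i → element (π ⟨$⟩ʳ i))                    ≈⟨ Σ+.sum-permute element π ⟨
    Σ+.sum element                                       ∎)
    where
    π = permute (_+ 1#) (_- 1#) +-congʳ +-congʳ (//-rightDividesˡ 1#) (//-rightDividesʳ 1#)

  -- For a ≠ 0, multiplication by a permutes the field; to get an identity of products over the
  -- whole field, 0 is replaced by 1, and the missing factor a is supplied by e at index 0.
  x^q≈x : ∀ a → a ^ q ≈ a
  x^q≈x a with a ≟ 0#
  ... | yes a≈0 = trans (^-congˡ q a≈0) (trans (0^ (index 0#)) (sym a≈0))
    where
    open import Algebra.Properties.Semiring.Exp semiring using (^-congˡ)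
    0^ : ∀ {n} → Fin n → 0# ^ n ≈ 0#
    0^ {suc n} _ = zeroˡ _
  ... | no a≉0 = *-cancelʳ-≉0 Πu≉0 (begin
    a ^ q * Π*.sum u                                ≈⟨ *-congʳ (Π*.sum-replicate q) ⟨
    Π*.sum {q} (λ _ → a) * Π*.sum u                 ≈⟨ Π*.∑-distrib-+ (λ _ → a) u ⟨
    Π*.sum (λ i → a * u i)                          ≈⟨ Π*.sum-cong-≋ a*u≈e*uπ ⟩
    Π*.sum (λ i → e i * u (π ⟨$⟩ʳ i))               ≈⟨ Π*.∑-distrib-+ e (λ i → u (π ⟨$⟩ʳ i)) ⟩
    Π*.sum e * Π*.sum (λ i → u (π ⟨$⟩ʳ i))          ≈⟨ *-cong Πe≈a (sym (Π*.sum-permute u π)) ⟩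
    a * Π*.sum u                                    ∎)
    where
    a⁻¹ = proj₁ (inverse a≉0)
    a⁻¹a≈1 = proj₂ (inverse a≉0)
    π = permute (a *_) (a⁻¹ *_) *-congˡ *-congˡ
      (λ x → trans (sym (*-assoc _ _ _)) (trans (*-congʳ (trans (*-comm _ _) a⁻¹a≈1)) (*-identityˡ x)))
      (λ x → trans (sym (*-assoc _ _ _)) (trans (*-congʳ a⁻¹a≈1) (*-identityˡ x)))

    u e : Fin q → Carrier
    u i with element i ≟ 0#
    ... | yes _ = 1#
    ... | no  _ = element i
    e i with element i ≟ 0#
    ... | yes _ = a
    ... | no  _ = 1#

    u≉0 : ∀ i → ¬ u i ≈ 0#
    u≉0 i with element i ≟ 0#
    ... | yes _   = 1≉0
    ... | no  x≉0 = x≉0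

    Πu≉0 : ¬ Π*.sum u ≈ 0#
    Πu≉0 = product≉0 u u≉0
      where
      product≉0 : ∀ {n} (t : Fin n → Carrier) → (∀ i → ¬ t i ≈ 0#) → ¬ Π*.sum t ≈ 0#
      product≉0 {zero}  t p = 1≉0
      product≉0 {suc n} t p = x*y≉0 (p zero) (product≉0 (λ i → t (suc i)) (λ i → p (suc i)))

    Πe≈a : Π*.sum e ≈ a
    Πe≈a = trans (sum-single *-commutativeMonoid (index 0#) e e-other) e-zero
      where
      e-other : ∀ i → i ≢ index 0# → e i ≈ 1#
      e-other i i≢ with element i ≟ 0#
      ... | yes p = contradiction (element-injective (trans p (sym (element-index 0#)))) i≢
      ... | no  _ = refl
      e-zero : e (index 0#) ≈ a
      e-zero with element (index 0#) ≟ 0#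
      ... | yes _ = refl
      ... | no ¬p = contradiction (element-index 0#) ¬p

    a*u≈e*uπ : ∀ i → a * u i ≈ e i * u (π ⟨$⟩ʳ i)
    a*u≈e*uπ i with element i ≟ 0# | element (π ⟨$⟩ʳ i) ≟ 0#
    ... | yes p | yes _  = refl
    ... | yes p | no ¬p′ = contradiction (trans (element-index _) (trans (*-congˡ p) (zeroʳ a))) ¬p′
    ... | no ¬p | yes p′ = contradiction (trans (sym (element-index _)) p′) (x*y≉0 a≉0 ¬p)
    ... | no ¬p | no _   = trans (sym (element-index _)) (sym (*-identityˡ _))

-- Division and divisibility of polynomials over a field

module Identities {c ℓ} (R : CommutativeRing c ℓ) where
  open import Algebra.Definitions.RawMagma (CommutativeRing.*-rawMagma R) using (_∣_; _,_)
  open CommutativeRing R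
  open IntegerSolver R

  -- One step of long division: from f = u g + r to a + x f. The identity holds for every b, which
  -- is chosen later to cancel a leading coefficient.
  division-step : ∀ a x u g r b → a + x * (u * g + r) ≈ (x * u + b) * g + ((a + x * r) - b * g)
  division-step = solve 6 (λ a x u g r b →
    a :+ x :* (u :* g :+ r) := (x :* u :+ b) :* g :+ ((a :+ x :* r) :- b :* g)) refl

  associate : ∀ k h {p} → k * h ≈ p → k ∣ 1# → p ∣ h
  associate k h kh≈p (e , ek≈1) = e , trans (*-congˡ (sym kh≈p)) (trans (sym (*-assoc e k h)) (trans (*-congʳ ek≈1) (*-identityˡ h)))

  module _ {m : Carrier} where
    open Quotient R m
    private module Q = CommutativeRing quotientRing
    open import Relation.Binary.Reasoning.Setoid Q.setoid
    open import Algebra.Properties.Magma.Divisibility *-magma using (x∣ʳyx)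

    -- Modulo m the remainder r equals - v f, so an inverse of r yields one of f: Euclid's algorithm
    -- read backwards.
    inverse-step : ∀ w v f r → m ≈ v * f + r → w * r ≋ 1# → - (w * v) * f ≋ 1#
    inverse-step w v f r m≈vf+r wr≋1 = begin
      - (w * v) * f            ≈⟨ ≈⇒≋ (solve 4 (λ w v f r → :- (w :* v) :* f := w :* r :- w :* (v :* f :+ r)) refl w v f r) ⟩
      w * r - w * (v * f + r)  ≈⟨ ≈⇒≋ (+-congˡ (-‿cong (*-congˡ m≈vf+r))) ⟨
      w * r - w * m            ≈⟨ Q.+-cong wr≋1 (Q.-‿cong (∣⇒≋0 (x∣ʳyx m w))) ⟩
      1# - 0#                  ≈⟨ ≈⇒≋ (solve 0 (:1 :- :0 := :1) refl) ⟩
      1#                       ∎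

    cancel-unit : ∀ u f g → u * f ≋ 1# → f * g ≋ 0# → g ≋ 0#
    cancel-unit u f g uf≋1 fg≋0 = begin
      g            ≈⟨ Q.*-identityˡ g ⟨
      1# * g       ≈⟨ Q.*-congʳ uf≋1 ⟨
      u * f * g    ≈⟨ Q.*-assoc u f g ⟩
      u * (f * g)  ≈⟨ Q.*-congˡ fg≋0 ⟩
      u * 0#       ≈⟨ Q.zeroʳ u ⟩
      0#           ∎

    remainder-≋ : ∀ f u r → f ≈ u * m + r → f ≋ r
    remainder-≋ f u r f≈um+r = Q.trans (≈⇒≋ f≈um+r) (Q.trans (Q.+-congʳ (∣⇒≋0 (x∣ʳyx m u))) (Q.+-identityˡ r))

module FieldPolynomials {c ℓ} (R : CommutativeRing c ℓ) (isDiscreteField : IsDiscreteField R) where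
  open CommutativeRing R hiding (zero)
  open IsDiscreteField isDiscreteField
  open Polynomials R
  open PolynomialRing R
  module A = CommutativeRing polyRing
  open Identities polyRing
  open Algebra.Definitions.RawSemiring polyRawSemiring using (mkIrred; module Irreducible)
  open import Algebra.Definitions.RawMagma A.*-rawMagma using (_,_)
  open import Algebra.Properties.Semigroup.Divisibility A.*-semigroup using (∣ʳ-trans; x∣ʳy⇒x∣ʳzy) public
  open import Algebra.Properties.Magma.Divisibility A.*-magma using (∣ʳ-respʳ-≈; ∣ʳ-respˡ-≈; x∣ʳyx) public
  open import Algebra.Properties.Semiring.Divisibility A.semiring using (0∣x⇒x≈0)
  open import Algebra.Properties.CommutativeSemigroup.Divisibility A.*-commutativeSemigroup using (x∣xy) public

  -- Lists may end in zeros, so the degree is not their length and has to be found by testing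
  -- coefficients.
  degree? : ∀ f → f ≈ₚ 0ₚ ⊎ ∃[ n ] HasDegree f n
  degree? []      = inj₁ A.refl
  degree? (a ∷ f) with degree? f
  ... | inj₂ (n , lc , f≤n) = inj₂ (suc n , lc , Degree<-∷ f≤n)
  ... | inj₁ f≈0 with a ≟ 0#
  ...   | yes a≈0 = inj₁ (∷≈[] a≈0 f≈0)
  ...   | no  a≉0 = inj₂ (0 , a≉0 , Degree<-∷ λ i _ → coeff-≈ f≈0 i)

  HasDegree-resp : ∀ {f g n} → f ≈ₚ g → HasDegree f n → HasDegree g n
  HasDegree-resp f≈g (lc , f≤n) = (λ p → lc (trans (coeff-≈ f≈g _) p)) , Degree<-resp f≈g f≤n

  HasDegree⇒≉0 : ∀ {f n} → HasDegree f n → ¬ f ≈ₚ 0ₚ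
  HasDegree⇒≉0 (lc , _) f≈0 = lc (coeff-≈ f≈0 _)

  ≉0⇒HasDegree : ∀ {f} → ¬ f ≈ₚ 0ₚ → ∃[ n ] HasDegree f n
  ≉0⇒HasDegree {f} f≉0 = [ (λ f≈0 → contradiction f≈0 f≉0) , (λ d → d) ]′ (degree? f)

  HasDegree∧Degree<⇒< : ∀ {f m n} → HasDegree f m → Degree< f n → m < n
  HasDegree∧Degree<⇒< {m = m} (lc , _) f<n = ℕ.≰⇒> λ n≤m → lc (f<n m n≤m)

  HasDegree-unique : ∀ {f m n} → HasDegree f m → HasDegree f n → m ≡ n
  HasDegree-unique {f} d@(_ , ≤m) d′@(_ , ≤n) =
    ℕ.≤-antisym (ℕ.s≤s⁻¹ (HasDegree∧Degree<⇒< {f} d ≤n)) (ℕ.s≤s⁻¹ (HasDegree∧Degree<⇒< {f} d′ ≤m))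

  Monic⇒HasDegree : ∀ {f n} → Monic f n → HasDegree f n
  Monic⇒HasDegree (lc , f≤n) = (λ p → 1≉0 (trans (sym lc) p)) , f≤n

  HasDegree-* : ∀ f {g m n} → HasDegree f m → HasDegree g n → HasDegree (f *ₚ g) (m ℕ.+ n)
  HasDegree-* f (lf , f≤m) (lg , g≤n) =
    (λ p → x*y≉0 lf lg (trans (sym (coeff-* f f≤m g≤n)) p)) , Degree≤-* f f≤m g≤n

  poly-noZeroDivisors : NoZeroDivisors polyRing
  poly-noZeroDivisors f g fg≈0 with degree? f | degree? g
  ... | inj₁ f≈0     | _            = inj₁ f≈0
  ... | inj₂ _       | inj₁ g≈0     = inj₂ g≈0
  ... | inj₂ (m , d) | inj₂ (n , e) = contradiction fg≈0 (HasDegree⇒≉0 (HasDegree-* f d e))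

  *ₚ-cancelʳ : ∀ f g {h} → ¬ h ≈ₚ 0ₚ → f *ₚ h ≈ₚ g *ₚ h → f ≈ₚ g
  *ₚ-cancelʳ f g {h} h≉0 fh≈gh = [ x∙y⁻¹≈ε⇒x≈y f g , (λ h≈0 → contradiction h≈0 h≉0) ]′
    (poly-noZeroDivisors (f A.- g) h (A.trans ([y-z]x≈yx-zx h f g) (x≈y⇒x∙y⁻¹≈ε fh≈gh)))
    where
    open import Algebra.Properties.Group A.+-group using (x∙y⁻¹≈ε⇒x≈y; x≈y⇒x∙y⁻¹≈ε)
    open import Algebra.Properties.Ring A.ring using ([y-z]x≈yx-zx)

  *ₚ-cancelʳ-∣ : ∀ {f g h} → ¬ h ≈ₚ 0ₚ → f *ₚ h ∣ g *ₚ h → f ∣ g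
  *ₚ-cancelʳ-∣ {f} {g} {h} h≉0 (k , kfh≈gh) = k , *ₚ-cancelʳ (k *ₚ f) g h≉0 (A.trans (A.*-assoc k f h) kfh≈gh)

  cofactor-degree : ∀ f g {m n} → HasDegree g m → HasDegree (f *ₚ g) n → ∃[ k ] HasDegree f k × k ℕ.+ m ≡ n
  cofactor-degree f g dg dfg with degree? f
  ... | inj₁ f≈0     = contradiction (A.trans (A.*-congʳ {g} {f} {0ₚ} f≈0) (A.zeroˡ g)) (HasDegree⇒≉0 dfg)
  ... | inj₂ (k , d) = k , d , HasDegree-unique {f *ₚ g} (HasDegree-* f d dg) dfg

  divisor-degree : ∀ {f g n} → f ∣ g → HasDegree g n → ∃[ m ] HasDegree f m × m ≤ n
  divisor-degree {f} {g} (k , kf≈g) dg with degree? f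
  ... | inj₁ f≈0     = contradiction (A.trans (A.sym kf≈g) (A.trans (A.*-congˡ {k} {f} {0ₚ} f≈0) (A.zeroʳ k))) (HasDegree⇒≉0 dg)
  ... | inj₂ (m , d) with cofactor-degree k f d (HasDegree-resp (A.sym kf≈g) dg)
  ...   | l , _ , eq = m , d , ℕ.m+n≤o⇒n≤o l (ℕ.≤-reflexive eq)

  ∣⇒degree≤ : ∀ {f g m n} → f ∣ g → HasDegree f m → HasDegree g n → m ≤ n
  ∣⇒degree≤ {f} f∣g df dg with divisor-degree f∣g dg
  ... | m , d , m≤n = ≡.subst (_≤ _) (HasDegree-unique {f} d df) m≤n

  HasDegree-1 : HasDegree 1ₚ 0
  HasDegree-1 = Monic⇒HasDegree {1ₚ} Monic-1

  unit⇒degree0 : ∀ {f} → f ∣ 1ₚ → HasDegree f 0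
  unit⇒degree0 {f} f∣1 with divisor-degree f∣1 HasDegree-1
  ... | zero , d , z≤n = d

  degree0⇒unit : ∀ f → HasDegree f 0 → f ∣ 1ₚ
  degree0⇒unit []      (lc , _) = contradiction refl lc
  degree0⇒unit (a ∷ f) (a≉0 , deg) = let b , ba≈1 = inverse a≉0 in const b , (begin
    const b *ₚ (a ∷ f)  ≈⟨ const-*ₚ b (a ∷ f) ⟩
    b ·ₚ (a ∷ f)        ≈⟨ ∷-cong ba≈1 (·ₚ-cong refl (Degree<0⇒≈0 (Degree<-tail deg))) ⟩
    1ₚ                  ∎)
    where open Relation.Binary.Reasoning.Setoid polySetoid

  ∣-+ : ∀ {f g h} → f ∣ g → f ∣ h → f ∣ g +ₚ h
  ∣-+ {f} (k , kf≈g) (l , lf≈h) = k +ₚ l , A.trans (A.distribʳ f k l) (A.+-cong kf≈g lf≈h)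

  ∣-*-split : ∀ {p f g} → p ∣ f → p ∣ f *ₚ g
  ∣-*-split {p} {f} {g} p∣f = ∣ʳ-respʳ-≈ (A.*-comm g f) (x∣ʳy⇒x∣ʳzy g p∣f)

  divMod : ∀ {g n} → HasDegree g n → ∀ f → ∃₂ λ u r → f ≈ₚ u *ₚ g +ₚ r × Degree< r n
  divMod dg [] = [] , [] , A.refl , λ _ _ → refl
  divMod {g} {n} dg@(lc , g≤n) (a ∷ f) with divMod {g} dg f
  ... | u , r , f≈ug+r , r<n = X *ₚ u +ₚ B , (a ∷ r) A.- B *ₚ g , (let open Relation.Binary.Reasoning.Setoid polySetoid in begin
    a ∷ f                                             ≈⟨ ∷≈const+X* a f ⟩
    const a +ₚ X *ₚ f                                 ≈⟨ A.+-cong (A.refl {const a}) (A.*-congˡ {X} {f} {u *ₚ g +ₚ r} f≈ug+r) ⟩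
    const a +ₚ X *ₚ (u *ₚ g +ₚ r)                     ≈⟨ division-step (const a) X u g r B ⟩
    (X *ₚ u +ₚ B) *ₚ g +ₚ ((const a +ₚ X *ₚ r) A.- B *ₚ g)
      ≈⟨ A.+-cong (A.refl {(X *ₚ u +ₚ B) *ₚ g}) (A.+-cong {a ∷ r} {const a +ₚ X *ₚ r} {A.- (B *ₚ g)} (∷≈const+X* a r) A.refl) ⟨
    (X *ₚ u +ₚ B) *ₚ g +ₚ ((a ∷ r) A.- B *ₚ g)        ∎) , r′<n
    where
    lc⁻¹ b : Carrier
    lc⁻¹ = proj₁ (inverse lc)
    -- `a ∷ r` has degree at most n. This multiple of `g` agrees with it at n, so that the
    -- difference drops below n.
    b = coeff (a ∷ r) n * lc⁻¹
    B : Poly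
    B = const b
    bg≈ : B *ₚ g ≈ₚ b ·ₚ g
    bg≈ = const-*ₚ b g
    r′<n : Degree< ((a ∷ r) A.- B *ₚ g) n
    r′<n i n≤i with ℕ.m≤n⇒m<n∨m≡n n≤i
    ... | inj₁ n<i = Degree<-+ {a ∷ r} { -ₚ (B *ₚ g)} (Degree<-∷ {a} {r} r<n)
      (Degree<-neg {B *ₚ g} (Degree<-resp {b ·ₚ g} (A.sym bg≈) (Degree<-· {b} {g} g≤n))) i n<i
    ... | inj₂ ≡.refl = begin
      coeff ((a ∷ r) A.- B *ₚ g) n                  ≈⟨ coeff-+ (a ∷ r) (-ₚ (B *ₚ g)) n ⟩
      coeff (a ∷ r) n + coeff (-ₚ (B *ₚ g)) n       ≈⟨ +-congˡ (coeff-neg (B *ₚ g) n) ⟩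
      coeff (a ∷ r) n - coeff (B *ₚ g) n            ≈⟨ +-congˡ (-‿cong (coeff-≈ bg≈ n)) ⟩
      coeff (a ∷ r) n - coeff (b ·ₚ g) n            ≈⟨ +-congˡ (-‿cong (coeff-· b g n)) ⟩
      coeff (a ∷ r) n - coeff (a ∷ r) n * lc⁻¹ * coeff g n  ≈⟨ +-congˡ (-‿cong (*-assoc _ _ _)) ⟩
      coeff (a ∷ r) n - coeff (a ∷ r) n * (lc⁻¹ * coeff g n)  ≈⟨ +-congˡ (-‿cong (*-congˡ (proj₂ (inverse lc)))) ⟩
      coeff (a ∷ r) n - coeff (a ∷ r) n * 1#        ≈⟨ +-congˡ (-‿cong (*-identityʳ _)) ⟩
      coeff (a ∷ r) n - coeff (a ∷ r) n             ≈⟨ -‿inverseʳ _ ⟩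
      0#                                            ∎
      where open Relation.Binary.Reasoning.Setoid setoid

  Degree<⇒∤ : ∀ {p f n} → HasDegree p n → Degree< f n → p ∣ f → f ≈ₚ 0ₚ
  Degree<⇒∤ {p} {f} dp f<n p∣f with degree? f
  ... | inj₁ f≈0     = f≈0
  ... | inj₂ (m , d) = contradiction (∣⇒degree≤ p∣f dp d) (ℕ.<⇒≱ (HasDegree∧Degree<⇒< {f} d f<n))

  irreducible⇒degree : ∀ {p} → Irreducible p → ∃[ n ] HasDegree p (suc n)
  irreducible⇒degree {p} (mkIrred p∤1 split) with degree? p
  -- The factorisation 0 = 0 * 0 would make 0 a unit.
  ... | inj₁ p≈0           = ⊥-elim ([ 0∤1 , 0∤1 ]′ (split {0ₚ} {0ₚ} p≈0))
    where
    0∤1 : ¬ 0ₚ ∣ 1ₚ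
    0∤1 0∣1 = HasDegree⇒≉0 HasDegree-1 (0∣x⇒x≈0 0∣1)
  ... | inj₂ (zero , d)    = contradiction (degree0⇒unit p d) p∤1
  ... | inj₂ (suc n , d)   = n , d

  irreducible-factor : ∀ {p f g m n} → Irreducible p → f *ₚ g ≈ₚ p → HasDegree f (suc m) → HasDegree g (suc n) → ⊥
  irreducible-factor {p} {f} {g} (mkIrred p∤1 split) fg≈p df dg with split {f} {g} (A.sym fg≈p)
  ... | inj₁ f∣1 = contradiction (HasDegree-unique {f} (unit⇒degree0 f∣1) df) λ ()
  ... | inj₂ g∣1 = contradiction (HasDegree-unique {g} (unit⇒degree0 g∣1) dg) λ ()

  module _ {p} (p-irr : Irreducible p) where
    private
      n : ℕ
      n = suc (proj₁ (irreducible⇒degree {p} p-irr))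
      dp : HasDegree p n
      dp = proj₂ (irreducible⇒degree {p} p-irr)
    open Quotient polyRing p
    private module Q = CommutativeRing quotientRing

    -- Euclid's algorithm with p as the dividend at every stage: dividing p by f leaves a remainder
    -- of smaller degree. It is not zero when f has positive degree below n, for then f would be a
    -- proper factor of the irreducible p.
    inverse-mod : ∀ k → ∀ f → HasDegree f k → k < n → ∃[ u ] u *ₚ f ≋ 1ₚ
    inverse-mod = <-rec _ step
      where
      step : ∀ k → (∀ {j} → j < k → ∀ f → HasDegree f j → j < n → ∃[ u ] u *ₚ f ≋ 1ₚ) →
             ∀ f → HasDegree f k → k < n → ∃[ u ] u *ₚ f ≋ 1ₚ
      step zero    rec f df k<n = let u , uf≈1 = degree0⇒unit f df in u , ≈⇒≋ uf≈1
      step (suc k) rec f df k<n with divMod {f} df p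
      ... | v , r , p≈vf+r , r<k with degree? r
      ...   | inj₂ (j , dr) =
        let j<k = HasDegree∧Degree<⇒< {r} dr r<k
            w , wr≋1 = rec j<k r dr (ℕ.<-trans j<k k<n)
        in -ₚ (w *ₚ v) , inverse-step w v f r p≈vf+r wr≋1
      ...   | inj₁ r≈0 with cofactor-degree v f df (HasDegree-resp {p} {v *ₚ f} p≈vf dp)
        where
        p≈vf : p ≈ₚ v *ₚ f
        p≈vf = A.trans p≈vf+r (A.trans (A.+-cong (A.refl {v *ₚ f}) r≈0) (A.+-identityʳ (v *ₚ f)))
      ...     | zero  , _  , eq = contradiction (≡.subst (suc k <_) (≡.sym eq) k<n) (ℕ.n≮n _)
      ...     | suc l , dv , _  = ⊥-elim (irreducible-factor {p} {v} {f} p-irr (A.sym {p} {v *ₚ f} p≈vf) dv df)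
        where
        p≈vf : p ≈ₚ v *ₚ f
        p≈vf = A.trans p≈vf+r (A.trans (A.+-cong (A.refl {v *ₚ f}) r≈0) (A.+-identityʳ (v *ₚ f)))

    private
      reduce : ∀ f → f ≋ 0ₚ ⊎ ∃[ u ] u *ₚ f ≋ 1ₚ
      reduce f with divMod {p} dp f
      ... | u , r , f≈up+r , r<n = Sum.map
          (λ r≈0 → Q.trans {f} {r} {0ₚ} f≋r (≈⇒≋ r≈0))
          (λ (k , dr) → let v , vr≋1 = inverse-mod k r dr (HasDegree∧Degree<⇒< {r} dr r<n) in
            v , Q.trans {v *ₚ f} {v *ₚ r} {1ₚ} (Q.*-congˡ {v} {f} {r} f≋r) vr≋1)
          (degree? r)
        where
        f≋r : f ≋ r
        f≋r = remainder-≋ f u r f≈up+r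

    quotient-noZeroDivisors : NoZeroDivisors quotientRing
    quotient-noZeroDivisors f g fg≋0 = Sum.map₂ (λ (u , uf≋1) → cancel-unit u f g uf≋1 fg≋0) (reduce f)

    irreducible⇒prime : ∀ {f g} → p ∣ f *ₚ g → p ∣ f ⊎ p ∣ g
    irreducible⇒prime {f} {g} p∣fg = Sum.map ≋0⇒∣ ≋0⇒∣ (quotient-noZeroDivisors f g (∣⇒≋0 p∣fg))

  -- Units are recognised by their degree, so the classical argument needs no excluded middle:
  -- under the assumption that f has no irreducible factor, f itself is irreducible.
  irreducible-factor-exists : ∀ n f → HasDegree f (suc n) → ¬ ¬ (∃[ p ] (Irreducible p × p ∣ f))
  irreducible-factor-exists = <-rec _ step
    where
    step : ∀ n → (∀ {m} → m < n → ∀ f → HasDegree f (suc m) → ¬ ¬ (∃[ p ] (Irreducible p × p ∣ f))) →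
           ∀ f → HasDegree f (suc n) → ¬ ¬ (∃[ p ] (Irreducible p × p ∣ f))
    step n rec f df none = none (f , mkIrred f∤1 split , A.1# , A.*-identityˡ f)
      where
      f∤1 : ¬ f ∣ 1ₚ
      f∤1 f∣1 = contradiction (HasDegree-unique {f} (unit⇒degree0 f∣1) df) λ ()
      split : ∀ {x y} → f ≈ₚ x *ₚ y → x ∣ 1ₚ ⊎ y ∣ 1ₚ
      split {x} {y} f≈xy with degree? y
      ... | inj₁ y≈0 = contradiction (A.trans f≈xy (A.trans (A.*-congˡ {x} {y} {0ₚ} y≈0) (A.zeroʳ x))) (HasDegree⇒≉0 df)
      ... | inj₂ (zero , dy) = inj₂ (degree0⇒unit y dy)
      ... | inj₂ (suc l , dy) with cofactor-degree x y dy (HasDegree-resp f≈xy df)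
      ...   | zero  , dx , _  = inj₁ (degree0⇒unit x dx)
      ...   | suc k , dx , eq = ⊥-elim (rec (≡.subst (k <_) (ℕ.suc-injective eq) (ℕ.m<m+n k (s≤s z≤n))) x dx
        λ (p , p-irr , p∣x) → none (p , p-irr , ∣ʳ-respʳ-≈ (A.sym f≈xy) (∣-*-split {p} {x} {y} p∣x)))

  irreducible-∣-sym : ∀ h p → Irreducible h → Irreducible p → h ∣ p → p ∣ h
  irreducible-∣-sym h p h-irr p-irr (k , kh≈p) =
    [ associate k h kh≈p , (λ h∣1 → ⊥-elim (Irreducible.p∤1 h-irr h∣1)) ]′ (Irreducible.split-∣1 p-irr {k} {h} (A.sym kh≈p))

  ∣-*-monoʳ : ∀ f g h {k l} → f *ₚ h ≈ₚ k → g *ₚ h ≈ₚ l → f ∣ g → k ∣ l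
  ∣-*-monoʳ f g h fh≈k gh≈l f∣g = ∣ʳ-respˡ-≈ fh≈k (∣ʳ-respʳ-≈ gh≈l (x∣ʳy⇒xz∣ʳyz h f∣g))
    where open import Algebra.Properties.Semigroup.Divisibility A.*-semigroup using (x∣ʳy⇒xz∣ʳyz)

  -- Induction on the degree, removing one irreducible factor p from both f and g. An irreducible h
  -- dividing what remains of f divides what remains of g or else p; in the second case h and p are
  -- associates, and p * p divides f.
  squarefree-∣ : ∀ n f g → HasDegree f n →
    (∀ p → Irreducible p → ¬ p *ₚ p ∣ f) → (∀ p → Irreducible p → p ∣ f → p ∣ g) → ¬ ¬ f ∣ g
  squarefree-∣ = <-rec _ step
    where
    step : ∀ n → (∀ {j} → j < n → ∀ f g → HasDegree f j →
      (∀ p → Irreducible p → ¬ p *ₚ p ∣ f) → (∀ p → Irreducible p → p ∣ f → p ∣ g) → ¬ ¬ f ∣ g) →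
      ∀ f g → HasDegree f n → (∀ p → Irreducible p → ¬ p *ₚ p ∣ f) → (∀ p → Irreducible p → p ∣ f → p ∣ g) → ¬ ¬ f ∣ g
    step zero    rec f g df squarefree factors f∤g = f∤g (∣ʳ-trans (degree0⇒unit f df) (g , A.*-identityʳ g))
    step (suc n) rec f g df squarefree factors f∤g = irreducible-factor-exists n f df λ (p , p-irr , f′ , f′p≈f) →
      let g′ , g′p≈g = factors p p-irr (f′ , f′p≈f) in split-off p p-irr f′ f′p≈f g′ g′p≈g
      where
      module _ p (p-irr : Irreducible p) f′ (f′p≈f : f′ *ₚ p ≈ₚ f) g′ (g′p≈g : g′ *ₚ p ≈ₚ g) where
        ∣-f : ∀ h → h ∣ f′ → h ∣ f
        ∣-f h h∣f′ = ∣ʳ-respʳ-≈ f′p≈f (∣-*-split {h} {f′} {p} h∣f′)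

        factors′ : ∀ h → Irreducible h → h ∣ f′ → h ∣ g′
        factors′ h h-irr h∣f′ = [ (λ h∣g′ → h∣g′)
          , (λ h∣p → ⊥-elim (squarefree p p-irr (∣-*-monoʳ p f′ p A.refl f′p≈f
              (∣ʳ-trans {p} {h} {f′} (irreducible-∣-sym h p h-irr p-irr h∣p) h∣f′)))) ]′
          (irreducible⇒prime h-irr {g′} {p} (∣ʳ-respʳ-≈ (A.sym g′p≈g) (factors h h-irr (∣-f h h∣f′))))

        split-off : ⊥
        split-off =
          let m , dp = irreducible⇒degree p-irr
              j , df′ , eq = cofactor-degree f′ p dp (HasDegree-resp {f} {f′ *ₚ p} (A.sym f′p≈f) df)
          in rec (≡.subst (j <_) eq (ℕ.m<m+n j (s≤s z≤n))) f′ g′ df′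
            (λ h h-irr hh∣f′ → squarefree h h-irr (∣-f (h *ₚ h) hh∣f′)) factors′
            (λ f′∣g′ → f∤g (∣-*-monoʳ f′ g′ p f′p≈f g′p≈g f′∣g′))

-- The polynomial X ^ Q - X and its irreducible factors

module T^n-T {c ℓ} (R : CommutativeRing c ℓ) where
  open CommutativeRing R hiding (zero)
  open Polynomials R
  open PolynomialRing R
  open Evaluation R
  open IntegerSolver R
  open import Algebra.Properties.Semiring.Exp semiring using (_^_)

  -- Needed over two rings: over F it is W, and over a residue ring modulo a factor of W it is the
  -- polynomial that would get too many roots.
  T^_-T : ℕ → Poly
  T^ n -T = monomial n +ₚ (0# ∷ - 1# ∷ [])

  eval-T^n-T : ∀ n x → eval (T^ n -T) x ≈ x ^ n - x
  eval-T^n-T n x = trans (eval-+ (monomial n) _ x)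
    (+-cong (eval-monomial n x) (solve 1 (λ x → :0 :+ x :* (:- :1 :+ x :* :0) := :- x) refl x))

  HasDegree-T^n-T : ∀ {n} → ¬ 1# ≈ 0# → 1 < n → HasDegree (T^ n -T) n
  HasDegree-T^n-T {n} 1≉0 1<n = (λ p → 1≉0 (trans (sym lc) p)) , λ i n<i →
      trans (coeff-+ (monomial n) _ i) (trans (+-cong (coeff-monomial-≢ n i (ℕ.<⇒≢ n<i)) (high i (ℕ.<-trans 1<n n<i))) (+-identityʳ 0#))
    where
    high : ∀ i → 1 < i → coeff (0# ∷ - 1# ∷ []) i ≈ 0#
    high (suc zero)    (s≤s ())
    high (suc (suc i)) _ = refl
    lc : coeff (T^ n -T) n ≈ 1#
    lc = trans (coeff-+ (monomial n) _ n) (trans (+-cong (coeff-monomial n) (high n 1<n)) (+-identityʳ 1#))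

funToFin-cong : ∀ {m n} {f g : Fin m → Fin n} → (∀ i → f i ≡ g i) → funToFin f ≡ funToFin g
funToFin-cong {zero}  eq = ≡.refl
funToFin-cong {suc m} eq = ≡.cong₂ combine (eq zero) (funToFin-cong (λ i → eq (suc i)))

finToFun-injective : ∀ {m n} (i j : Fin (n ℕ.^ m)) → (∀ k → finToFun {m = n} {m} i k ≡ finToFun j k) → i ≡ j
finToFun-injective {m} {n} i j eq = ≡.trans (≡.sym (Fin.funToFin-finToFin {m} {n} i))
  (≡.trans (funToFin-cong {m} eq) (Fin.funToFin-finToFin {m} {n} j))

module FixedPoints {c ℓ} (R : CommutativeRing c ℓ) (Q : ℕ) where
  open CommutativeRing R hiding (zero)
  open import Algebra.Properties.Semiring.Exp semiring using (_^_; ^-congˡ)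
  open import Algebra.Properties.CommutativeSemiring.Exp commutativeSemiring using (^-distrib-*)

  Fixed : Carrier → Set ℓ
  Fixed x = x ^ Q ≈ x

  Fixed-resp : ∀ x y → x ≈ y → Fixed x → Fixed y
  Fixed-resp x y x≈y x-fixed = trans (^-congˡ Q (sym x≈y)) (trans x-fixed x≈y)

  Fixed-* : ∀ x y → Fixed x → Fixed y → Fixed (x * y)
  Fixed-* x y x-fixed y-fixed = trans (^-distrib-* x y Q) (*-cong x-fixed y-fixed)

  Fixed-+ : (∀ x y → (x + y) ^ Q ≈ x ^ Q + y ^ Q) → ∀ x y → Fixed x → Fixed y → Fixed (x + y)
  Fixed-+ additive x y x-fixed y-fixed = trans (additive x y) (+-cong x-fixed y-fixed)

  -- As Q is at least 2, x ^ Q contains the factor x * x.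
  square-zero⇒Fixed⇒0 : 1 < Q → ∀ x → x * x ≈ 0# → Fixed x → x ≈ 0#
  square-zero⇒Fixed⇒0 (s≤s (s≤s z≤n)) x xx≈0 x-fixed =
    trans (sym x-fixed) (trans (sym (*-assoc x x _)) (trans (*-congʳ xx≈0) (zeroˡ _)))

module SmallFactors {c ℓ₁ ℓ₂} (F : HeytingField c ℓ₁ ℓ₂) {p k : ℕ} (p-prime : Prime p) (1≤k : 1 ≤ k)
                    (order : HasOrder F (p ℕ.^ k)) where
  private
    q = p ℕ.^ k
    R = fieldRing F
  open CommutativeRing R hiding (zero)
  open FiniteField F order
  open IsDiscreteField isDiscreteField
  open Polynomials R
  open PolynomialRing R
  open FieldPolynomials R isDiscreteField
  open Evaluation R using (monomial)
  open T^n-T R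
  open Algebra.Definitions.RawSemiring polyRawSemiring using (module Irreducible)
  open import Algebra.Definitions.RawMagma A.*-rawMagma using (_,_)
  open Frobenius R using (Characteristic)
  open Algebra.Properties.Semiring.Exp semiring using (_^_; ^-congˡ; ^-assocʳ)
  open Algebra.Properties.Semiring.Mult semiring using (×1-homo-*) renaming (_×_ to _·_)

  -- The vanishing element q·1 is the k-th power of p·1, and a field has no zero divisors.
  p·1≈0 : Characteristic p
  p·1≈0 = p^j·1≈0⇒p·1≈0 k q·1≈0
    where
    p^j·1≈0⇒p·1≈0 : ∀ j → Characteristic (p ℕ.^ j) → Characteristic p
    p^j·1≈0⇒p·1≈0 zero    char = contradiction (trans (sym (+-identityʳ 1#)) char) 1≉0
    p^j·1≈0⇒p·1≈0 (suc j) char = [ (λ z → z) , p^j·1≈0⇒p·1≈0 j ]′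
      (noZeroDivisors _ _ (trans (sym (×1-homo-* p (p ℕ.^ j))) char))

  1<q : 1 < q
  1<q = ℕ.<-≤-trans (ℕ.nonTrivial⇒n>1 p) (ℕ.≤-trans (ℕ.≤-reflexive (≡.sym (ℕ.^-identityʳ p))) (ℕ.^-monoʳ-≤ p 1≤k))
    where instance
      _ = prime⇒nonTrivial p-prime
      _ = prime⇒nonZero p-prime
    
  x^[q^m]≈x : ∀ m x → x ^ (q ℕ.^ m) ≈ x
  x^[q^m]≈x zero    x = *-identityʳ x
  x^[q^m]≈x (suc m) x = trans (sym (^-assocʳ x q (q ℕ.^ m))) (trans (^-congˡ (q ℕ.^ m) (x^q≈x x)) (x^[q^m]≈x m x))

  module _ (m : ℕ) (1≤m : 1 ≤ m) where
    private
      Q = q ℕ.^ m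
      W = T^ Q -T

    1<Q : 1 < Q
    1<Q = ℕ.<-≤-trans 1<q (ℕ.≤-trans (ℕ.≤-reflexive (≡.sym (ℕ.^-identityʳ q))) (ℕ.^-monoʳ-≤ q 1≤m))
      where instance _ = ℕ.>-nonZero (ℕ.<-trans (s≤s z≤n) 1<q)

    HasDegree-W : HasDegree W Q
    HasDegree-W = HasDegree-T^n-T {Q} 1≉0 1<Q

    module Residues (g : Poly) (g∣W : g ∣ W) where
      open Quotient polyRing g public
      module B = CommutativeRing quotientRing
      open FixedPoints quotientRing Q public
      private
        module BExp = Algebra.Properties.Semiring.Exp B.semiring
        module BMult = Algebra.Properties.Semiring.Mult B.semiring
        module BFrobenius = Frobenius quotientRing

        const-^ : ∀ n a → const a BExp.^ n ≋ const (a ^ n)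
        const-^ zero    a = B.refl {1ₚ}
        const-^ (suc n) a = B.trans {const a *ₚ (const a BExp.^ n)} {const a *ₚ const (a ^ n)} {const (a * a ^ n)}
          (B.*-congˡ {const a} {const a BExp.^ n} {const (a ^ n)} (const-^ n a)) (≈⇒≋ (const-*ₚ a (const (a ^ n))))

        const-· : ∀ n → n BMult.× 1ₚ ≋ const (n · 1#)
        const-· zero    = ≈⇒≋ (A.sym 0∷[]≈[])
        const-· (suc n) = B.+-cong {1ₚ} {1ₚ} {n BMult.× 1ₚ} {const (n · 1#)} (B.refl {1ₚ}) (const-· n)

        characteristic : BFrobenius.Characteristic p
        characteristic = B.trans {p BMult.× 1ₚ} {const (p · 1#)} {0ₚ} (const-· p) (≈⇒≋ (∷≈[] p·1≈0 A.refl))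

        monomial≋X^ : ∀ n → monomial n ≋ X BExp.^ n
        monomial≋X^ zero    = B.refl {1ₚ}
        monomial≋X^ (suc n) = B.trans {monomial (suc n)} {X *ₚ monomial n} {X *ₚ (X BExp.^ n)}
          (≈⇒≋ (A.sym (X*ₚ (monomial n)))) (B.*-congˡ {X} {monomial n} {X BExp.^ n} (monomial≋X^ n))

        const-fixed : ∀ a → Fixed (const a)
        const-fixed a = B.trans {const a BExp.^ Q} {const (a ^ Q)} {const a} (const-^ Q a) (≈⇒≋ (∷-cong (x^[q^m]≈x m a) A.refl))

        X-fixed : Fixed X
        X-fixed = B.trans {X BExp.^ Q} {monomial Q} {X} (B.sym {monomial Q} {X BExp.^ Q} (monomial≋X^ Q))
          (mod (∣ʳ-respʳ-≈ (A.+-cong (A.refl {monomial Q}) (∷-cong {0#} { - 0#} (sym -0#≈0#) A.refl)) g∣W))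
          where open import Algebra.Properties.Ring ring using (-0#≈0#)

      additive : ∀ x y → (x +ₚ y) BExp.^ Q ≋ (x BExp.^ Q) +ₚ (y BExp.^ Q)
      additive = ≡.subst (λ n → ∀ x y → (x +ₚ y) BExp.^ n ≋ (x BExp.^ n) +ₚ (y BExp.^ n)) (≡.sym (ℕ.^-*-assoc p k m))
        (BFrobenius.frobenius^ {p} p-prime characteristic (k ℕ.* m))

      -- Constants are fixed because c ^ q = c in F, and X is fixed because g divides X ^ Q - X.
      -- Fixed elements are closed under products, and under sums because Q is a power of the
      -- characteristic; Horner's scheme then reaches every polynomial.
      fixed : ∀ f → Fixed f
      fixed []      = Fixed-resp (const 0#) [] (≈⇒≋ 0∷[]≈[]) (const-fixed 0#)
      fixed (a ∷ f) = Fixed-resp (const a +ₚ X *ₚ f) (a ∷ f) (≈⇒≋ (A.sym (∷≈const+X* a f)))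
        (Fixed-+ additive (const a) (X *ₚ f) (const-fixed a) (Fixed-* X f X-fixed (fixed f)))

    irreducible-∣W⇒degree≤ : ∀ g → Irreducible g → g ∣ W → ∀ n → HasDegree g n → n ≤ m
    irreducible-∣W⇒degree≤ g g-irr g∣W n dg = ℕ.≮⇒≥ λ m<n →
      -- If m < n, there are q ^ n > Q residues modulo g. The first Q + 1 of them already exceed the
      -- degree of T ^ Q - T.
      too-many-roots (quotient-noZeroDivisors g-irr) Q T^Q-T (HasDegree-T^Q-T 1≇0 1<Q)
        (λ i → representative (inject≤ i (Q<q^n m<n)))
        (λ i → B.trans {eval T^Q-T (r m<n i)} (eval-T^Q-T Q (r m<n i)) (∣⇒≋0 (m∣x-y (fixed (r m<n i)))))
        (λ {i} {j} eq → Fin.inject≤-injective _ _ i j (representative-injective _ _ eq))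
      where
      open Residues g g∣W
      open Evaluation quotientRing using (eval; too-many-roots)
      open T^n-T quotientRing using () renaming (T^_-T to T^_-T′; eval-T^n-T to eval-T^Q-T; HasDegree-T^n-T to HasDegree-T^Q-T)
      T^Q-T = T^ Q -T′

      1≇0 : ¬ 1ₚ ≋ 0ₚ
      1≇0 1≋0 = Irreducible.p∤1 g-irr (≋0⇒∣ 1≋0)

      Q<q^n : m < n → Q < q ℕ.^ n
      Q<q^n m<n = ℕ.^-monoʳ-< q 1<q m<n

      representative : Fin (q ℕ.^ n) → Poly
      representative i = tabulate λ k → element (finToFun {m = q} {n} i k)

      r : m < n → Fin (suc Q) → Poly
      r m<n i = representative (inject≤ i (Q<q^n m<n))

      Degree<-tabulate : ∀ {n} (v : Fin n → Carrier) → Degree< (tabulate v) n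
      Degree<-tabulate {zero}  v i       _         = refl
      Degree<-tabulate {suc n} v (suc i) (s≤s n≤i) = Degree<-tabulate (λ k → v (suc k)) i n≤i

      coeff-tabulate : ∀ {n} (v : Fin n → Carrier) k → coeff (tabulate v) (toℕ k) ≡ v k
      coeff-tabulate v zero    = ≡.refl
      coeff-tabulate v (suc k) = coeff-tabulate (λ k → v (suc k)) k

      -- The difference of two representatives has degree below n, and g of degree n divides such a
      -- polynomial only if it is zero.
      representative-injective : ∀ i j → representative i ≋ representative j → i ≡ j
      representative-injective i j (mod g∣d) = finToFun-injective {n} {q} i j λ k → element-injective
        (trans (reflexive (≡.sym (coeff-tabulate _ k))) (trans (coeff-≈ equal (toℕ k)) (reflexive (coeff-tabulate _ k))))
        where
        equal : representative i ≈ₚ representative j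
        equal = x∙y⁻¹≈ε⇒x≈y (representative i) (representative j) (Degree<⇒∤ dg
          (Degree<-+ {representative i} { -ₚ representative j} (Degree<-tabulate _) (Degree<-neg {representative j} (Degree<-tabulate _))) g∣d)
          where open import Algebra.Properties.Group A.+-group using (x∙y⁻¹≈ε⇒x≈y)

    W-squarefree : ∀ g → Irreducible g → ¬ g *ₚ g ∣ W
    W-squarefree g g-irr gg∣W = Irreducible.p∤1 g-irr (*ₚ-cancelʳ-∣ {g} {1ₚ} {g} (HasDegree⇒≉0 (proj₂ (irreducible⇒degree g-irr)))
      (∣ʳ-respʳ-≈ (A.sym (A.*-identityˡ g)) (≋0⇒∣ (square-zero⇒Fixed⇒0 1<Q g (∣⇒≋0 (1ₚ , A.*-identityˡ (g *ₚ g))) (fixed g)))))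
      where
      open Residues (g *ₚ g) gg∣W

    W∣ : ∀ f → (∀ p → Irreducible p → ∀ n → HasDegree p n → n ≤ m → p ∣ f) → ¬ ¬ W ∣ f
    W∣ f small = squarefree-∣ Q W f HasDegree-W W-squarefree λ p p-irr p∣W → let n , dp = irreducible⇒degree p-irr in
      small p p-irr (suc n) dp (irreducible-∣W⇒degree≤ p p-irr p∣W (suc n) dp)

    -- The comparison of Q and n is decidable, so the double negation carried by `W∣` can be removed
    -- here.
    Q≤degree : ∀ f {n} → HasDegree f n → (∀ p → Irreducible p → ∀ n → HasDegree p n → n ≤ m → p ∣ f) → Q ≤ n
    Q≤degree f {n} df small = decidable-stable (Q ℕ.≤? n) λ Q≰n → W∣ f small λ W∣f → Q≰n (∣⇒degree≤ W∣f HasDegree-W df)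

-- Exhaustive search over a concrete field

-- No laws are required: an arithmetic gets its meaning from the map ι of IsModel.
record Arithmetic : Set₁ where
  infixl 6 _-_
  infixl 7 _*_
  field
    Carrier     : Set
    0# 1#       : Carrier
    _-_ _*_     : Carrier → Carrier → Carrier
    isZero      : Carrier → Bool
    elements    : List Carrier

module Computation (K : Arithmetic) where
  open Arithmetic K

  -- shift c r = (r′ , l) where c + X r = r′ + l X ^ n; coefficients are listed from the constant term on.
  shift : ∀ {n} → Carrier → Vec Carrier n → Vec Carrier n × Carrier
  shift c []      = [] , c
  shift c (a ∷ r) = map₁ (c ∷_) (shift a r)

  -- A vector s of length n also stands for the monic polynomial X ^ n + s.
  remainder : ∀ {n} → Vec Carrier n → List Carrier → Vec Carrier n
  remainder s []      = Vec.replicate _ 0#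
  remainder s (c ∷ f) = eliminate (shift c (remainder s f))
    where
    eliminate : Vec Carrier _ × Carrier → Vec Carrier _
    eliminate (r , l) = Vec.zipWith (λ a b → a - l * b) r s

  allZero : ∀ {n} → Vec Carrier n → Bool
  allZero []      = true
  allZero (a ∷ v) = isZero a ∧ allZero v

  infix 7 _divides_
  _divides_ : ∀ {n} → Vec Carrier n → List Carrier → Bool
  s divides f = allZero (remainder s f)

  monic : ∀ {n} → Vec Carrier n → List Carrier
  monic s = toList s ++ 1# ∷ []

  minus : List Carrier → List Carrier → List Carrier
  minus f       []      = f
  minus []      (b ∷ g) = (0# - b) ∷ minus [] g
  minus (a ∷ f) (b ∷ g) = (a - b) ∷ minus f g

  leading : ∀ {n} → Vec Carrier (suc n) → Carrier
  leading (a ∷ [])    = a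
  leading (_ ∷ b ∷ f) = leading (b ∷ f)

  vectors : ∀ n → List (Vec Carrier n)
  vectors zero    = [] ∷ []
  vectors (suc n) = cartesianProductWith _∷_ elements (vectors n)

  -- Degree 0 is left out: the constant 1 divides everything and would make every irreducibility
  -- test fail.
  monics : ℕ → List (∃ (Vec Carrier))
  monics zero    = []
  monics (suc n) = monics n ++ map (suc n ,_) (vectors (suc n))

  -- Meant for f of degree d: a proper factorisation has a factor of degree at most d / 2.
  irreducible? : ℕ → List Carrier → Bool
  irreducible? d f = all (λ (_ , s) → not (s divides f)) (monics ⌊ d /2⌋)

  smallIrreducibles : ℕ → List (∃ (Vec Carrier))
  smallIrreducibles d = filterᵇ (λ (k , s) → irreducible? k (monic s)) (monics ⌊ d /2⌋)

  splits? : List (∃ (Vec Carrier)) → List Carrier → List Carrier → Bool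
  splits? ss f g = all (λ (_ , s) → s divides g ∨ s divides minus f g) ss

  -- `g` runs through the candidates for the term of degree below d. The other term f - g then has
  -- the degree d of f, so only `g` has to be tested for being nonzero.
  vid? : List (∃ (Vec Carrier)) → ∀ d → List Carrier → Bool
  vid? ss d f = any (λ g → not (allZero g) ∧ splits? ss f (toList g)) (vectors d)

  ofDegree : ∀ d → List (Vec Carrier (suc d))
  ofDegree d = filterᵇ (λ f → not (isZero (leading f))) (vectors (suc d))

  irreducibles : ∀ d → List (Vec Carrier (suc d))
  irreducibles d = filterᵇ (λ f → irreducible? d (toList f)) (ofDegree d)

  irreduciblesWithVID : ∀ d → List (Vec Carrier (suc d))
  irreduciblesWithVID d = filterᵇ (λ f → vid? (smallIrreducibles d) d (toList f)) (irreducibles d)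

  allAdmitVID? : ℕ → Bool
  allAdmitVID? d = allAdmit (smallIrreducibles d)
    where
    -- The small irreducibles depend on d alone, and one list is shared by all `f`.
    allAdmit : List (∃ (Vec Carrier)) → Bool
    allAdmit ss = all (λ f → vid? ss d (toList f)) (irreducibles d)

  distinct? : ∀ {n} → List (Vec Carrier n) → Bool
  distinct? []       = true
  distinct? (v ∷ vs) = all (λ w → not (allZero (Vec.zipWith _-_ v w))) vs ∧ distinct? vs

-- Every natural number counts as a residue, reduced or not, hence the reduction inside `isZero`.
-- Subtraction adds (q - 1) b because q - 1 represents -1; truncated subtraction is thereby avoided.
modular : ℕ → Arithmetic
modular q-1 = record
  { Carrier = ℕ ; 0# = 0 ; 1# = 1
  ; _-_ = λ a b → (a ℕ.+ q-1 ℕ.* b) % q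
  ; _*_ = λ a b → (a ℕ.* b) % q
  ; isZero = λ a → (a % q) ℕ.≡ᵇ 0
  ; elements = upTo q
  }
  where q = suc q-1

-- (a , b) stands for a + b ω, where ω² = ω + 1.
𝔽₄ : Arithmetic
𝔽₄ = record
  { Carrier = Bool × Bool ; 0# = false , false ; 1# = true , false
  ; _-_ = λ (a , b) (c , d) → (a xor c) , (b xor d)
  ; _*_ = λ (a , b) (c , d) → ((a ∧ c) xor (b ∧ d)) , ((a ∧ d) xor (b ∧ c) xor (b ∧ d))
  ; isZero = λ (a , b) → not a ∧ not b
  ; elements = (false , false) ∷ (true , false) ∷ (false , true) ∷ (true , true) ∷ []
  }

-- Correctness of the search

module RemainderIdentity {c ℓ} (R : CommutativeRing c ℓ) where
  open CommutativeRing R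
  open IntegerSolver R
  open import Algebra.Definitions.RawMagma *-rawMagma using (_∣_; _,_)
  open import Relation.Binary.Reasoning.Setoid setoid

  -- Here t is X ^ n and m = X ^ n + s is the divisor. Modulo m the overflow l t becomes - l s,
  -- which is what `remainder` subtracts.
  remainder-step : ∀ c x u m r r′ l s t → c + x * r ≈ r′ + l * t → m ≈ s + t →
    c + x * (u * m + r) ≈ (x * u + l) * m + (r′ - l * s)
  remainder-step c x u m r r′ l s t c+xr≈ m≈ = begin
    c + x * (u * m + r)                      ≈⟨ solve 5 (λ c x u m r → c :+ x :* (u :* m :+ r) := x :* u :* m :+ (c :+ x :* r)) refl c x u m r ⟩
    x * u * m + (c + x * r)                  ≈⟨ +-congˡ c+xr≈ ⟩
    x * u * m + (r′ + l * t)                 ≈⟨ solve 5 (λ y r′ l t s → y :+ (r′ :+ l :* t) := y :+ (l :* (s :+ t) :+ (r′ :- l :* s))) refl (x * u * m) r′ l t s ⟩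
    x * u * m + (l * (s + t) + (r′ - l * s)) ≈⟨ +-congˡ (+-congʳ (*-congˡ m≈)) ⟨
    x * u * m + (l * m + (r′ - l * s))       ≈⟨ solve 6 (λ x u m l r′ s → x :* u :* m :+ (l :* m :+ (r′ :- l :* s)) := (x :* u :+ l) :* m :+ (r′ :- l :* s)) refl x u m l r′ s ⟩
    (x * u + l) * m + (r′ - l * s)           ∎

  shift-step : ∀ c x a r r′ l t → a + x * r ≈ r′ + l * t → c + x * (a + x * r) ≈ (c + x * r′) + l * (x * t)
  shift-step c x a r r′ l t eq = trans (+-congˡ (*-congˡ eq))
    (solve 5 (λ c x r′ l t → c :+ x :* (r′ :+ l :* t) := (c :+ x :* r′) :+ l :* (x :* t)) refl c x r′ l t)

  ∣-remainder : ∀ f u m r → f ≈ u * m + r → m ∣ f → m ∣ r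
  ∣-remainder f u m r f≈um+r (v , vm≈f) = v - u , (begin
    (v - u) * m        ≈⟨ solve 3 (λ v u m → (v :- u) :* m := v :* m :- u :* m) refl v u m ⟩
    v * m - u * m      ≈⟨ +-congʳ (trans vm≈f f≈um+r) ⟩
    u * m + r - u * m  ≈⟨ solve 2 (λ y r → y :+ r :- y := r) refl (u * m) r ⟩
    r                  ∎)

-- `ι` may identify elements, as it does for ℕ modulo q. The zero test has to be exact for negative
-- answers to be reliable, and `elements` has to reach all of F for the search to be exhaustive.
record IsModel {c ℓ} (K : Arithmetic) (R : CommutativeRing c ℓ) : Set (c Level.⊔ ℓ) where
  private module K = Arithmetic K
  open CommutativeRing R
  field
    ι           : K.Carrier → Carrier
    ι-0         : ι K.0# ≈ 0#
    ι-1         : ι K.1# ≈ 1#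
    ι--         : ∀ a b → ι (a K.- b) ≈ ι a - ι b
    ι-*         : ∀ a b → ι (a K.* b) ≈ ι a * ι b
    isZero⇒ι≈0  : ∀ a → T (K.isZero a) → ι a ≈ 0#
    ι≈0⇒isZero  : ∀ a → ι a ≈ 0# → T (K.isZero a)
    ι-surjective : ∀ x → ∃[ a ] a ∈ K.elements × ι a ≈ x

T-not : ∀ {b} → T (not b) → ¬ T b
T-not {false} _ ()

not-T : ∀ {b} → ¬ T b → T (not b)
not-T {false} _  = _
not-T {true}  ¬t = ¬t _

-- Together with the converse `≤-⌊n/2⌋`, this translates between 2 m ≤ d in VID-1 and the rounded
-- bound used by the search.
⌊n/2⌋-≤ : ∀ {m n} → m ≤ ⌊ n /2⌋ → 2 ℕ.* m ≤ n
⌊n/2⌋-≤ {m} {n} m≤ = ℕ.≤-trans (ℕ.*-monoʳ-≤ 2 m≤) (2*⌊n/2⌋≤n n)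
  where
  2*⌊n/2⌋≤n : ∀ n → 2 ℕ.* ⌊ n /2⌋ ≤ n
  2*⌊n/2⌋≤n zero          = z≤n
  2*⌊n/2⌋≤n (suc zero)    = z≤n
  2*⌊n/2⌋≤n (suc (suc n)) = ≡.subst (_≤ suc (suc n)) (≡.sym (ℕ.*-suc 2 ⌊ n /2⌋)) (s≤s (s≤s (2*⌊n/2⌋≤n n)))

≤-⌊n/2⌋ : ∀ {m n} → 2 ℕ.* m ≤ n → m ≤ ⌊ n /2⌋
≤-⌊n/2⌋ {m} {n} 2m≤n = ≡.subst (_≤ ⌊ n /2⌋) (≡.trans (≡.cong (λ k → ⌊ m ℕ.+ k /2⌋) (ℕ.+-identityʳ m)) (≡.sym (ℕ.n≡⌊n+n/2⌋ m))) (ℕ.⌊n/2⌋-mono 2m≤n)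

module Correctness {c ℓ} (R : CommutativeRing c ℓ) (isDiscreteField : IsDiscreteField R)
                   (K : Arithmetic) (model : IsModel K R) where
  private module K = Arithmetic K
  open CommutativeRing R hiding (zero)
  open IsDiscreteField isDiscreteField
  open Polynomials R
  open PolynomialRing R
  open FieldPolynomials R isDiscreteField
  open Evaluation R using (monomial; coeff-monomial; coeff-monomial-≢)
  open T^n-T R using (T^_-T)
  open Computation K
  open Arithmetic K using (isZero)
  open IsModel model
  open RemainderIdentity polyRing
  open Identities polyRing using (associate)
  open Algebra.Definitions.RawSemiring polyRawSemiring using (mkIrred; module Irreducible)
  open import Algebra.Definitions.RawMagma A.*-rawMagma using (_,_)

  ⟦_⟧ : List K.Carrier → Poly
  ⟦_⟧ = map ι

  ⟦_⟧ᵥ : ∀ {n} → Vec K.Carrier n → Poly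
  ⟦ v ⟧ᵥ = ⟦ toList v ⟧

  ⟦⟧ᵥ-degree : ∀ {n} (v : Vec K.Carrier n) → Degree< ⟦ v ⟧ᵥ n
  ⟦⟧ᵥ-degree []      i _ = refl
  ⟦⟧ᵥ-degree (a ∷ v) = Degree<-∷ {ι a} {⟦ v ⟧ᵥ} (⟦⟧ᵥ-degree v)

  ⟦⟧ᵥ-surjective : ∀ n f → Degree< f n → ∃[ v ] v ∈ vectors n × ⟦ v ⟧ᵥ ≈ₚ f
  ⟦⟧ᵥ-surjective zero    f f<0 = [] , here ≡.refl , A.sym (Degree<0⇒≈0 {f} f<0)
  ⟦⟧ᵥ-surjective (suc n) []      _ with ι-surjective 0# | ⟦⟧ᵥ-surjective n [] (λ _ _ → refl)
  ... | a , a∈ , ιa≈0 | v , v∈ , v≈ = a ∷ v , ∈-cartesianProductWith⁺ _∷_ a∈ v∈ , ∷≈[] ιa≈0 v≈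
  ⟦⟧ᵥ-surjective (suc n) (x ∷ f) f<n with ι-surjective x | ⟦⟧ᵥ-surjective n f (Degree<-tail {x} {f} f<n)
  ... | a , a∈ , ιa≈x | v , v∈ , v≈ = a ∷ v , ∈-cartesianProductWith⁺ _∷_ a∈ v∈ , ∷-cong ιa≈x v≈

  allZero⇒≈0 : ∀ {n} (v : Vec K.Carrier n) → T (allZero v) → ⟦ v ⟧ᵥ ≈ₚ 0ₚ
  allZero⇒≈0 []      _ = A.refl
  allZero⇒≈0 (a ∷ v) t = let ta , tv = Equivalence.to T-∧ t in ∷≈[] (isZero⇒ι≈0 a ta) (allZero⇒≈0 v tv)

  ≈0⇒allZero : ∀ {n} (v : Vec K.Carrier n) → ⟦ v ⟧ᵥ ≈ₚ 0ₚ → T (allZero v)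
  ≈0⇒allZero []      _   = _
  ≈0⇒allZero (a ∷ v) v≈0 = Equivalence.from T-∧ (ι≈0⇒isZero a (coeff-≈ v≈0 0) , ≈0⇒allZero v (mk≈ₚ λ i → coeff-≈ v≈0 (suc i)))

  ⟦minus⟧ : ∀ f g → ⟦ minus f g ⟧ ≈ₚ ⟦ f ⟧ A.- ⟦ g ⟧
  ⟦minus⟧ f       []      = A.sym (A.+-identityʳ ⟦ f ⟧)
  ⟦minus⟧ []      (b ∷ g) = ∷-cong (trans (ι-- K.0# b) (trans (+-congʳ ι-0) (+-identityˡ _))) (⟦minus⟧ [] g)
  ⟦minus⟧ (a ∷ f) (b ∷ g) = ∷-cong (ι-- a b) (⟦minus⟧ f g)

  ⟦_⟧ₘ : ∀ {n} → Vec K.Carrier n → Poly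
  ⟦ s ⟧ₘ = ⟦ monic s ⟧

  ⟦⟧ₘ≈ : ∀ {n} (s : Vec K.Carrier n) → ⟦ s ⟧ₘ ≈ₚ ⟦ s ⟧ᵥ +ₚ monomial n
  ⟦⟧ₘ≈ []      = ∷-cong ι-1 A.refl
  ⟦⟧ₘ≈ (a ∷ s) = ∷-cong (sym (+-identityʳ (ι a))) (⟦⟧ₘ≈ s)

  ⟦⟧ₘ-monic : ∀ {n} (s : Vec K.Carrier n) → Monic ⟦ s ⟧ₘ n
  ⟦⟧ₘ-monic []      = ι-1 , λ { (suc i) _ → refl }
  ⟦⟧ₘ-monic (a ∷ s) = let lc , deg = ⟦⟧ₘ-monic s in lc , Degree<-∷ {ι a} {⟦ s ⟧ₘ} deg

  ⟦⟧ₘ-degree : ∀ {n} (s : Vec K.Carrier n) → HasDegree ⟦ s ⟧ₘ n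
  ⟦⟧ₘ-degree s = Monic⇒HasDegree {⟦ s ⟧ₘ} (⟦⟧ₘ-monic s)

  ⟦shift⟧ : ∀ {n} a (r : Vec K.Carrier n) → let r′ , l = shift a r in
    const (ι a) +ₚ X *ₚ ⟦ r ⟧ᵥ ≈ₚ ⟦ r′ ⟧ᵥ +ₚ const (ι l) *ₚ monomial n
  ⟦shift⟧ a []      = A.trans (A.sym (∷≈const+X* (ι a) [])) (A.sym (A.*-identityʳ (const (ι a))))
  ⟦shift⟧ a (b ∷ r) with shift b r | ⟦shift⟧ b r
  ... | r′ , l | eq = begin
    const (ι a) +ₚ X *ₚ (ι b ∷ ⟦ r ⟧ᵥ)                ≈⟨ A.+-cong {const (ι a)} A.refl (A.*-cong {X} A.refl (∷≈const+X* (ι b) ⟦ r ⟧ᵥ)) ⟩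
    const (ι a) +ₚ X *ₚ (const (ι b) +ₚ X *ₚ ⟦ r ⟧ᵥ)  ≈⟨ shift-step (const (ι a)) X (const (ι b)) ⟦ r ⟧ᵥ ⟦ r′ ⟧ᵥ (const (ι l)) (monomial _) eq ⟩
    (const (ι a) +ₚ X *ₚ ⟦ r′ ⟧ᵥ) +ₚ const (ι l) *ₚ (X *ₚ monomial _)
      ≈⟨ A.+-cong {const (ι a) +ₚ X *ₚ ⟦ r′ ⟧ᵥ} (A.sym (∷≈const+X* (ι a) ⟦ r′ ⟧ᵥ)) (A.*-cong {const (ι l)} A.refl (X*ₚ (monomial _))) ⟩
    (ι a ∷ ⟦ r′ ⟧ᵥ) +ₚ const (ι l) *ₚ (0# ∷ monomial _) ∎
    where open Relation.Binary.Reasoning.Setoid polySetoid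

  ⟦zipWith⟧ : ∀ {n} l (r s : Vec K.Carrier n) →
    ⟦ Vec.zipWith (λ a b → a K.- l K.* b) r s ⟧ᵥ ≈ₚ ⟦ r ⟧ᵥ A.- const (ι l) *ₚ ⟦ s ⟧ᵥ
  ⟦zipWith⟧ l r s = A.trans (go r s) (A.+-cong {⟦ r ⟧ᵥ} A.refl (A.-‿cong {ι l ·ₚ ⟦ s ⟧ᵥ} (A.sym (const-*ₚ (ι l) ⟦ s ⟧ᵥ))))
    where
    go : ∀ {n} (r s : Vec K.Carrier n) → ⟦ Vec.zipWith (λ a b → a K.- l K.* b) r s ⟧ᵥ ≈ₚ ⟦ r ⟧ᵥ A.- ι l ·ₚ ⟦ s ⟧ᵥ
    go []      []      = A.refl
    go (a ∷ r) (b ∷ s) = ∷-cong (trans (ι-- a (l K.* b)) (+-congˡ (-‿cong (ι-* l b)))) (go r s)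

  ⟦replicate⟧ : ∀ n → ⟦ Vec.replicate n K.0# ⟧ᵥ ≈ₚ 0ₚ
  ⟦replicate⟧ zero    = A.refl
  ⟦replicate⟧ (suc n) = ∷≈[] ι-0 (⟦replicate⟧ n)

  ⟦remainder⟧ : ∀ {n} (s : Vec K.Carrier n) f → ∃[ u ] ⟦ f ⟧ ≈ₚ u *ₚ ⟦ s ⟧ₘ +ₚ ⟦ remainder s f ⟧ᵥ
  ⟦remainder⟧ {n} s [] = [] , A.sym (⟦replicate⟧ n)
  ⟦remainder⟧ {n} s (a ∷ f) with ⟦remainder⟧ s f | shift a (remainder s f) | ⟦shift⟧ a (remainder s f)
  ... | u , f≈ | r′ , l | eq = X *ₚ u +ₚ const (ι l) , (begin
    ι a ∷ ⟦ f ⟧                                        ≈⟨ ∷≈const+X* (ι a) ⟦ f ⟧ ⟩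
    const (ι a) +ₚ X *ₚ ⟦ f ⟧                          ≈⟨ A.+-cong {const (ι a)} A.refl (A.*-cong {X} A.refl f≈) ⟩
    const (ι a) +ₚ X *ₚ (u *ₚ ⟦ s ⟧ₘ +ₚ ⟦ r ⟧ᵥ)        ≈⟨ remainder-step (const (ι a)) X u ⟦ s ⟧ₘ ⟦ r ⟧ᵥ ⟦ r′ ⟧ᵥ (const (ι l)) ⟦ s ⟧ᵥ (monomial n) eq (⟦⟧ₘ≈ s) ⟩
    (X *ₚ u +ₚ const (ι l)) *ₚ ⟦ s ⟧ₘ +ₚ (⟦ r′ ⟧ᵥ A.- const (ι l) *ₚ ⟦ s ⟧ᵥ)
      ≈⟨ A.+-cong {(X *ₚ u +ₚ const (ι l)) *ₚ ⟦ s ⟧ₘ} A.refl (⟦zipWith⟧ l r′ s) ⟨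
    (X *ₚ u +ₚ const (ι l)) *ₚ ⟦ s ⟧ₘ +ₚ ⟦ Vec.zipWith (λ a b → a K.- l K.* b) r′ s ⟧ᵥ ∎)
    where
    open Relation.Binary.Reasoning.Setoid polySetoid
    r = remainder s f

  divides⇒∣ : ∀ {n} (s : Vec K.Carrier n) f → T (s divides f) → ⟦ s ⟧ₘ ∣ ⟦ f ⟧
  divides⇒∣ s f t = let u , f≈ = ⟦remainder⟧ s f in
    u , A.sym (A.trans f≈ (A.trans (A.+-cong {u *ₚ ⟦ s ⟧ₘ} A.refl (allZero⇒≈0 (remainder s f) t)) (A.+-identityʳ (u *ₚ ⟦ s ⟧ₘ))))

  ∣⇒divides : ∀ {n} (s : Vec K.Carrier n) f → ⟦ s ⟧ₘ ∣ ⟦ f ⟧ → T (s divides f)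
  ∣⇒divides s f s∣f = let u , f≈ = ⟦remainder⟧ s f in
    ≈0⇒allZero (remainder s f) (Degree<⇒∤ (⟦⟧ₘ-degree s) (⟦⟧ᵥ-degree (remainder s f))
      (∣-remainder ⟦ f ⟧ u ⟦ s ⟧ₘ ⟦ remainder s f ⟧ᵥ f≈ s∣f))

  ∈-monics⁺ : ∀ {h n} (s : Vec K.Carrier n) → 1 ≤ n → n ≤ h → s ∈ vectors n → (n , s) ∈ monics h
  ∈-monics⁺ {zero}  s (s≤s _) () s∈
  ∈-monics⁺ {suc h} {n} s 1≤n n≤h s∈ with n ℕ.≟ suc h
  ... | yes ≡.refl = ∈-++⁺ʳ (monics h) (∈-map⁺ (suc h ,_) s∈)
  ... | no  n≢1+h  = ∈-++⁺ˡ (∈-monics⁺ s 1≤n (ℕ.s≤s⁻¹ (ℕ.≤∧≢⇒< n≤h n≢1+h)) s∈)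

  ∈-monics⁻ : ∀ h {n} {s : Vec K.Carrier n} → (n , s) ∈ monics h → 1 ≤ n × n ≤ h
  ∈-monics⁻ (suc h) ns∈ with ∈-++⁻ (monics h) ns∈
  ... | inj₁ ns∈h = let 1≤n , n≤h = ∈-monics⁻ h ns∈h in 1≤n , ℕ.m≤n⇒m≤1+n n≤h
  ... | inj₂ ns∈map with ∈-map⁻ (suc h ,_) ns∈map
  ...   | _ , _ , ≡.refl = s≤s z≤n , ℕ.≤-refl

  -- The search sees monic polynomials only. After scaling, p and X ^ n have the same leading
  -- coefficient, so their difference has degree below n and lifts to a vector.
  normalise : ∀ {n} p → HasDegree p n → ∃[ s ] s ∈ vectors n × ∃[ a ] ¬ a ≈ 0# × const a *ₚ p ≈ₚ ⟦ s ⟧ₘ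
  normalise {n} p (lc , p≤n) with inverse lc
  ... | a , a*lc≈1 with ⟦⟧ᵥ-surjective n (a ·ₚ p A.- monomial n) low
    where
    low : Degree< (a ·ₚ p A.- monomial n) n
    low i n≤i = trans (coeff-+ (a ·ₚ p) (-ₚ monomial n) i) (trans (+-cong (coeff-· a p i) (coeff-neg (monomial n) i)) (cases (n ℕ.≟ i)))
      where
      cases : Dec (n ≡ i) → a * coeff p i - coeff (monomial n) i ≈ 0#
      cases (yes ≡.refl) = trans (+-cong a*lc≈1 (-‿cong (coeff-monomial n))) (-‿inverseʳ 1#)
      cases (no n≢i)     = trans (+-cong (trans (*-congˡ (p≤n i (ℕ.≤∧≢⇒< n≤i n≢i))) (zeroʳ a))
        (-‿cong (coeff-monomial-≢ n i n≢i))) (-‿inverseʳ 0#)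
  ...   | s , s∈ , s≈ = s , s∈ , a , (λ a≈0 → 1≉0 (trans (sym a*lc≈1) (trans (*-congʳ a≈0) (zeroˡ _))))
    , A.trans (const-*ₚ a p) (A.trans (A.sym (difference-+ (a ·ₚ p) (monomial n))) (A.trans
        (A.+-cong {a ·ₚ p A.- monomial n} {⟦ s ⟧ᵥ} {monomial n} {monomial n} (A.sym s≈) A.refl) (A.sym (⟦⟧ₘ≈ s))))
    where open import Algebra.Properties.Group A.+-group using () renaming (//-rightDividesˡ to //-left)
          difference-+ : ∀ f g → f A.- g +ₚ g ≈ₚ f
          difference-+ f g = //-left g f

  const-unit : ∀ {a} → ¬ a ≈ 0# → const a ∣ 1ₚ
  const-unit {a} a≉0 = degree0⇒unit (const a) (a≉0 , λ { (suc i) _ → refl })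

  normalise-∣ : ∀ p {a m} → ¬ a ≈ 0# → const a *ₚ p ≈ₚ m → p ∣ m × m ∣ p
  normalise-∣ p {a} {m} a≉0 eq = (const a , eq) , associate (const a) p eq (const-unit a≉0)

  irreducible?⇒Irreducible : ∀ {d} f → 1 ≤ d → HasDegree ⟦ f ⟧ d → T (irreducible? d f) → Irreducible ⟦ f ⟧
  irreducible?⇒Irreducible {suc d} f _ df t = mkIrred f∤1 split
    where
    f∤1 : ¬ ⟦ f ⟧ ∣ 1ₚ
    f∤1 f∣1 = contradiction (HasDegree-unique {⟦ f ⟧} (unit⇒degree0 f∣1) df) λ ()
    no-small-divisor : ∀ {n} p → HasDegree p (suc n) → suc n ≤ ⌊ suc d /2⌋ → ¬ p ∣ ⟦ f ⟧
    no-small-divisor p dp n≤ p∣f with normalise p dp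
    ... | s , s∈ , a , a≉0 , eq = T-not (All.lookup (all⁺ _ (monics ⌊ suc d /2⌋) t) (∈-monics⁺ s (s≤s z≤n) n≤ s∈))
      (∣⇒divides s f (∣ʳ-trans (proj₂ (normalise-∣ p a≉0 eq)) p∣f))
    split : ∀ {x y} → ⟦ f ⟧ ≈ₚ x *ₚ y → x ∣ 1ₚ ⊎ y ∣ 1ₚ
    split {x} {y} f≈xy with divisor-degree {y} (x , A.sym f≈xy) df
    ... | zero  , dy , _ = inj₂ (degree0⇒unit y dy)
    ... | suc j , dy , _ with cofactor-degree x y dy (HasDegree-resp f≈xy df)
    ...   | zero  , dx , _  = inj₁ (degree0⇒unit x dx)
    ...   | suc i , dx , eq with ℕ.≤-total (suc i) (suc j)
    ...     | inj₁ i≤j = ⊥-elim (no-small-divisor x dx (≤-⌊n/2⌋ (≡.subst (2 ℕ.* suc i ≤_) eq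
                (ℕ.+-monoʳ-≤ (suc i) (≡.subst (_≤ suc j) (≡.sym (ℕ.+-identityʳ (suc i))) i≤j))))
                (∣ʳ-respʳ-≈ (A.sym f≈xy) (x∣xy x y)))
    ...     | inj₂ j≤i = ⊥-elim (no-small-divisor y dy (≤-⌊n/2⌋ (≡.subst (2 ℕ.* suc j ≤_) eq
                (ℕ.+-mono-≤ j≤i (ℕ.≤-reflexive (ℕ.+-identityʳ (suc j)))))) (x , A.sym f≈xy))

  Irreducible⇒irreducible? : ∀ {d f} → HasDegree ⟦ f ⟧ d → Irreducible ⟦ f ⟧ → T (irreducible? d f)
  Irreducible⇒irreducible? {d} {f} df f-irr = all⁻ _ {xs = monics ⌊ d /2⌋} (All.tabulate λ {(n , s)} ns∈ → not-T λ t → no-divisor s (∈-monics⁻ ⌊ d /2⌋ ns∈) (divides⇒∣ s f t))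
    where
    no-divisor : ∀ {n} (s : Vec K.Carrier n) → 1 ≤ n × n ≤ ⌊ d /2⌋ → ¬ ⟦ s ⟧ₘ ∣ ⟦ f ⟧
    no-divisor {suc n} s (_ , n≤) (u , us≈f) with cofactor-degree u ⟦ s ⟧ₘ (⟦⟧ₘ-degree s) (HasDegree-resp (A.sym us≈f) df)
    ... | suc j , du , _  = irreducible-factor {⟦ f ⟧} {u} {⟦ s ⟧ₘ} f-irr us≈f du (⟦⟧ₘ-degree s)
    -- A constant cofactor would give the divisor the full degree d, against n ≤ d / 2.
    ... | zero  , _  , ≡.refl = ℕ.<⇒≱ (ℕ.m<m+n (suc n) (s≤s z≤n)) (⌊n/2⌋-≤ {suc n} {suc n} n≤)

  Irreducible-const-* : ∀ {p a m} → ¬ a ≈ 0# → const a *ₚ p ≈ₚ m → Irreducible p → Irreducible m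
  Irreducible-const-* {p} {a} {m} a≉0 eq p-irr = mkIrred (λ m∣1 → Irreducible.p∤1 p-irr (∣ʳ-trans p∣m m∣1)) split
    where
    p∣m = proj₁ (normalise-∣ p a≉0 eq)
    m∣p = proj₂ (normalise-∣ p a≉0 eq)
    split : ∀ {x y} → m ≈ₚ x *ₚ y → x ∣ 1ₚ ⊎ y ∣ 1ₚ
    split {x} {y} m≈xy with m∣p
    ... | b , bm≈p = Sum.map₁ (∣ʳ-trans (b , A.refl)) (Irreducible.split-∣1 p-irr {b *ₚ x} {y}
      (A.trans (A.sym bm≈p) (A.trans (A.*-cong {b} A.refl m≈xy) (A.sym (A.*-assoc b x y)))))

  Irreducible-resp : ∀ {p m} → p ≈ₚ m → Irreducible p → Irreducible m
  Irreducible-resp {p} p≈m = Irreducible-const-* {p} {1#} 1≉0 (A.trans (A.*-identityˡ p) p≈m)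

  ∈-smallIrreducibles⁻ : ∀ d {n} {s : Vec K.Carrier n} → (n , s) ∈ smallIrreducibles d →
    Irreducible ⟦ s ⟧ₘ × HasDegree ⟦ s ⟧ₘ n × n ≤ ⌊ d /2⌋
  ∈-smallIrreducibles⁻ d {n} {s} ns∈ with ∈-filter⁻ (λ (k , s) → T? (irreducible? k (monic s))) {xs = monics ⌊ d /2⌋} ns∈
  ... | ns∈monics , t with ∈-monics⁻ ⌊ d /2⌋ ns∈monics
  ...   | 1≤n , n≤ = irreducible?⇒Irreducible (monic s) 1≤n (⟦⟧ₘ-degree s) t , ⟦⟧ₘ-degree s , n≤

  smallIrreducibles-complete : ∀ d {p n} → Irreducible p → HasDegree p n → n ≤ ⌊ d /2⌋ →
    ∃₂ λ k s → (k , s) ∈ smallIrreducibles d × p ∣ ⟦ s ⟧ₘ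
  smallIrreducibles-complete d {p} {n} p-irr dp n≤ with normalise p dp
  ... | s , s∈ , a , a≉0 , eq = n , s
    , ∈-filter⁺ (λ (k , s) → T? (irreducible? k (monic s))) (∈-monics⁺ s 1≤n n≤ s∈)
        (Irreducible⇒irreducible? (⟦⟧ₘ-degree s) (Irreducible-const-* a≉0 eq p-irr))
    , proj₁ (normalise-∣ p a≉0 eq)
    where
    1≤n : 1 ≤ n
    1≤n = let k , dp′ = irreducible⇒degree p-irr in ≡.subst (1 ≤_) (HasDegree-unique {p} dp′ dp) (s≤s z≤n)

  -- A VID with low term g and top term h satisfies these hypotheses, which are just what the search
  -- tests.
  vid?-complete : ∀ {d f} g h → h +ₚ g ≈ₚ ⟦ f ⟧ → Degree< g d → ¬ g ≈ₚ 0ₚ →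
    (∀ p → Irreducible p → ∀ n → HasDegree p n → n ≤ ⌊ d /2⌋ → p ∣ g ⊎ p ∣ h) → T (vid? (smallIrreducibles d) d f)
  vid?-complete {d} {f} g h h+g≈f g<d g≉0 small with ⟦⟧ᵥ-surjective d g g<d
  ... | v , v∈ , v≈g = any⁺ _ (lose v∈ (Equivalence.from T-∧
      ( not-T (λ t → g≉0 (A.trans (A.sym v≈g) (allZero⇒≈0 v t)))
      , all⁻ _ {xs = smallIrreducibles d} (All.tabulate λ {(n , s)} ns∈ → let s-irr , ds , n≤ = ∈-smallIrreducibles⁻ d ns∈ in
          Equivalence.from T-∨ (Sum.map
            (λ s∣g → ∣⇒divides s (toList v) (∣ʳ-respʳ-≈ (A.sym v≈g) s∣g))
            (λ s∣h → ∣⇒divides s (minus f (toList v)) (∣ʳ-respʳ-≈ (A.sym f-v≈h) s∣h))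
            (small ⟦ s ⟧ₘ s-irr n ds n≤))))))
    where
    open import Algebra.Properties.Group A.+-group using (//-rightDividesʳ)
    f-v≈h : ⟦ minus f (toList v) ⟧ ≈ₚ h
    f-v≈h = A.trans (⟦minus⟧ f (toList v)) (A.trans (A.+-cong (A.sym h+g≈f) (A.-‿cong v≈g)) (//-rightDividesʳ g h))

  vid?-sound : ∀ {d f} → Irreducible ⟦ f ⟧ → HasDegree ⟦ f ⟧ d → 1 ≤ d → T (vid? (smallIrreducibles d) d f) → AdmitsVID d ⟦ f ⟧
  vid?-sound {d} {f} f-irr df 1≤d t with find (any⁻ _ (vectors d) t)
  ... | v , v∈ , tv with Equivalence.to T-∧ tv
  ...   | v≉0 , splits = 2 , fs , isVID , sum≈f
    where
    open import Algebra.Properties.Group A.+-group using (//-rightDividesˡ)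
    g h : Poly
    g = ⟦ v ⟧ᵥ
    h = ⟦ f ⟧ A.- g
    fs : Fin 2 → Poly
    fs zero       = h
    fs (suc zero) = g

    h+g≈f : h +ₚ g ≈ₚ ⟦ f ⟧
    h+g≈f = //-rightDividesˡ g ⟦ f ⟧

    sum≈f : sum fs ≈ₚ ⟦ f ⟧
    sum≈f = A.trans (A.+-cong {h} A.refl (A.+-identityʳ g)) h+g≈f

    dh : HasDegree h d
    dh = (λ p → proj₁ df (trans (sym (trans (coeff-+ ⟦ f ⟧ (-ₚ g) d) (trans (+-congˡ (Degree<-neg {g} (⟦⟧ᵥ-degree v) d ℕ.≤-refl)) (+-identityʳ _)))) p))
       , Degree<-+ {⟦ f ⟧} { -ₚ g} (proj₂ df) (Degree<-mono { -ₚ g} (ℕ.n≤1+n d) (Degree<-neg {g} (⟦⟧ᵥ-degree v)))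

    small : ∀ p → Irreducible p → ∀ m → HasDegree p m → 2 ℕ.* m ≤ d → p ∣ g ⊎ p ∣ h
    small p p-irr m dp 2m≤d with smallIrreducibles-complete d p-irr dp (≤-⌊n/2⌋ {m} 2m≤d)
    ... | n , s , ns∈ , p∣s = Sum.map
      (λ t → ∣ʳ-trans p∣s (divides⇒∣ s (toList v) t))
      (λ t → ∣ʳ-trans p∣s (∣ʳ-respʳ-≈ (⟦minus⟧ f (toList v)) (divides⇒∣ s (minus f (toList v)) t)))
      (Equivalence.to T-∨ (All.lookup (all⁺ _ (smallIrreducibles d) splits) ns∈))

    -- This upgrades "at least one term" to "all but exactly one": an irreducible dividing both
    -- terms divides f, hence is an associate of f, although its degree is at most d / 2.
    p∤f : ∀ p → Irreducible p → ∀ m → HasDegree p m → 2 ℕ.* m ≤ d → ¬ p ∣ ⟦ f ⟧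
    p∤f p p-irr m dp 2m≤d p∣f with irreducible⇒degree p-irr
    ... | n , dp′ = ℕ.<⇒≱ m<d (∣⇒degree≤ (irreducible-∣-sym p ⟦ f ⟧ p-irr f-irr p∣f) df dp)
      where
      m<d : m < d
      m<d = ℕ.<-≤-trans (ℕ.m<m+n m (≡.subst (0 <_) (≡.trans (HasDegree-unique {p} dp′ dp) (≡.sym (ℕ.+-identityʳ m))) (s≤s z≤n))) 2m≤d

    isVID : IsVID d fs
    isVID = record
      { 2≤r = s≤s (s≤s z≤n)
      ; nonzero = λ where
          zero       → HasDegree⇒≉0 dh
          (suc zero) → λ g≈0 → T-not v≉0 (≈0⇒allZero v g≈0)
      ; degree≤d = λ where
          zero       → proj₂ dh
          (suc zero) → Degree<-mono {g} (ℕ.n≤1+n d) (⟦⟧ᵥ-degree v)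
      ; vid₁ = λ p p-irr m dp 2m≤d → let p∤f = p∤f p p-irr m dp 2m≤d in
          [ (λ p∣g → zero , (λ p∣h → p∤f (∣ʳ-respʳ-≈ h+g≈f (∣-+ {p} {h} {g} p∣h p∣g)))
                   , λ { zero j≢0 → contradiction ≡.refl j≢0 ; (suc zero) _ → p∣g })
          , (λ p∣h → suc zero , (λ p∣g → p∤f (∣ʳ-respʳ-≈ h+g≈f (∣-+ {p} {h} {g} p∣h p∣g)))
                   , λ { zero _ → p∣h ; (suc zero) j≢1 → contradiction ≡.refl j≢1 })
          ]′ (small p p-irr m dp 2m≤d)
      ; vid₂ = zero , dh , λ { zero j≢0 → contradiction ≡.refl j≢0 ; (suc zero) _ → ⟦⟧ᵥ-degree v }
      }

  coeff-leading : ∀ {d} (v : Vec K.Carrier (suc d)) → coeff ⟦ v ⟧ᵥ d ≡ ι (leading v)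
  coeff-leading (a ∷ [])    = ≡.refl
  coeff-leading (_ ∷ b ∷ v) = coeff-leading (b ∷ v)

  ∈-irreducibles⁻ : ∀ {d v} → 1 ≤ d → v ∈ irreducibles d → IrreducibleOfDegree d ⟦ v ⟧ᵥ
  ∈-irreducibles⁻ {d} {v} 1≤d v∈ = irreducible?⇒Irreducible (toList v) 1≤d dv (proj₂ irr) , dv
    where
    irr = ∈-filter⁻ (λ f → T? (irreducible? d (toList f))) {xs = ofDegree d} v∈
    deg = ∈-filter⁻ (λ f → T? (not (isZero (leading f)))) {xs = vectors (suc d)} (proj₁ irr)
    dv : HasDegree ⟦ v ⟧ᵥ d
    dv = (λ p → T-not (proj₂ deg) (ι≈0⇒isZero _ (trans (reflexive (≡.sym (coeff-leading v))) p))) , ⟦⟧ᵥ-degree v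

  irreducibles-complete : ∀ {d f} → IrreducibleOfDegree d f → ∃[ v ] v ∈ irreducibles d × ⟦ v ⟧ᵥ ≈ₚ f
  irreducibles-complete {d} {f} (f-irr , df) with ⟦⟧ᵥ-surjective (suc d) f (proj₂ df)
  ... | v , v∈ , v≈f = v , ∈-filter⁺ (λ f → T? (irreducible? d (toList f))) (∈-filter⁺ (λ f → T? (not (isZero (leading f)))) v∈
        (not-T λ t → proj₁ df (trans (sym (coeff-≈ v≈f d)) (trans (reflexive (coeff-leading v)) (isZero⇒ι≈0 _ t)))))
      (Irreducible⇒irreducible? (HasDegree-resp (A.sym v≈f) df) (Irreducible-resp (A.sym v≈f) f-irr)) , v≈f

  AdmitsVID-resp : ∀ {d f g} → f ≈ₚ g → AdmitsVID d f → AdmitsVID d g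
  AdmitsVID-resp f≈g (r , fs , isVID , sum≈f) = r , fs , isVID , A.trans sum≈f f≈g

  allAdmitVID : ∀ d → 1 ≤ d → Computation.allAdmitVID? K d ≡ true → ∀ f → IrreducibleOfDegree d f → AdmitsVID d f
  allAdmitVID d 1≤d t f f-irr with irreducibles-complete f-irr
  ... | v , v∈ , v≈f = let v-irr , dv = ∈-irreducibles⁻ {d} {v} 1≤d v∈ in
    AdmitsVID-resp v≈f (vid?-sound v-irr dv 1≤d (All.lookup (all⁺ _ (irreducibles d) (Equivalence.from T-≡ t)) v∈))

  Distinct : ∀ {n} → List (Vec K.Carrier n) → Set ℓ
  Distinct = AllPairs (λ v w → ¬ ⟦ v ⟧ᵥ ≈ₚ ⟦ w ⟧ᵥ)

  distinct?⇒Distinct : ∀ {n} (vs : List (Vec K.Carrier n)) → T (distinct? vs) → Distinct vs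
  distinct?⇒Distinct []       _ = []
  distinct?⇒Distinct (v ∷ vs) t = let t₁ , t₂ = Equivalence.to T-∧ t in
    All.map (λ {w} differ v≈w → T-not differ (difference-zero v w v≈w)) (all⁺ _ vs t₁) ∷ distinct?⇒Distinct vs t₂
    where
    difference-zero : ∀ {n} (v w : Vec K.Carrier n) → ⟦ v ⟧ᵥ ≈ₚ ⟦ w ⟧ᵥ → T (allZero (Vec.zipWith K._-_ v w))
    difference-zero []      []      _   = _
    difference-zero (a ∷ v) (b ∷ w) v≈w = Equivalence.from T-∧
      ( ι≈0⇒isZero _ (trans (ι-- a b) (trans (+-congʳ (coeff-≈ v≈w 0)) (-‿inverseʳ _)))
      , difference-zero v w (tail-≈ v≈w))

  Distinct⇒injective : ∀ {n} {vs : List (Vec K.Carrier n)} → Distinct vs →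
    ∀ {i j} → ⟦ lookup vs i ⟧ᵥ ≈ₚ ⟦ lookup vs j ⟧ᵥ → i ≡ j
  Distinct⇒injective (_  ∷ _)  {zero}  {zero}  _  = ≡.refl
  Distinct⇒injective (v# ∷ _)  {zero}  {suc j} eq = contradiction eq (All.lookup v# (∈-lookup j))
  Distinct⇒injective (v# ∷ _)  {suc i} {zero}  eq = contradiction (A.sym eq) (All.lookup v# (∈-lookup i))
  Distinct⇒injective (_  ∷ ds) {suc i} {suc j} eq = ≡.cong suc (Distinct⇒injective ds eq)

  enumerate : ∀ {n ℓ′} (P : Pred Poly ℓ′) (vs : List (Vec K.Carrier n)) → Distinct vs →
    (∀ {v} → v ∈ vs → P ⟦ v ⟧ᵥ) → (∀ {f} → P f → ∃[ v ] v ∈ vs × ⟦ v ⟧ᵥ ≈ₚ f) →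
    HasCardinality (subsetoid polySetoid P) (length vs)
  enumerate P vs distinct sound complete = record
    { to        = position
    ; from      = λ i → ⟦ lookup vs i ⟧ᵥ , sound (∈-lookup i)
    -- `complete` may depend on the list and on the proof of P. Distinctness of the entries forces
    -- equal polynomials to the same position.
    ; to-cong   = λ {x} {y} x≈y → Distinct⇒injective distinct (A.trans (lookup-position x) (A.trans x≈y (A.sym (lookup-position y))))
    ; from-cong = λ { ≡.refl → A.refl }
    ; inverse   = (λ {i} {x} x≈ → Distinct⇒injective distinct (A.trans (lookup-position x) x≈))
                , λ { {x} ≡.refl → lookup-position x }
    }
    where
    position : ∃ P → Fin (length vs)
    position (f , Pf) = Any.index (proj₁ (proj₂ (complete Pf)))
    lookup-position : ∀ x → ⟦ lookup vs (position x) ⟧ᵥ ≈ₚ proj₁ x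
    lookup-position (f , Pf) = let v , v∈ , v≈f = complete Pf in
      A.trans (A.reflexive (≡.cong ⟦_⟧ᵥ (≡.sym (lookup-index v∈)))) v≈f

  irreducibles-cardinality : ∀ d → 1 ≤ d → ∀ {n} → Computation.distinct? K (Computation.irreducibles K d) ≡ true →
    length (Computation.irreducibles K d) ≡ n → HasCardinality (subsetoid polySetoid (IrreducibleOfDegree d)) n
  irreducibles-cardinality d 1≤d distinct ≡.refl = enumerate (IrreducibleOfDegree d) (irreducibles d)
    (distinct?⇒Distinct (irreducibles d) (Equivalence.from T-≡ distinct)) (∈-irreducibles⁻ 1≤d) irreducibles-complete

  irreduciblesWithVID-cardinality : ∀ d → 1 ≤ d → ∀ {n} → (∀ f → AdmitsVID d ⟦ f ⟧ → T (vid? (smallIrreducibles d) d f)) →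
    Computation.distinct? K (Computation.irreducibles K d) ≡ true → length (Computation.irreduciblesWithVID K d) ≡ n →
    HasCardinality (subsetoid polySetoid (IrreducibleOfDegree d ∩ AdmitsVID d)) n
  irreduciblesWithVID-cardinality d 1≤d AdmitsVID⇒vid? distinct ≡.refl =
    enumerate (IrreducibleOfDegree d ∩ AdmitsVID d) (irreduciblesWithVID d)
      (AllPairs-filter⁺ hasVID? (distinct?⇒Distinct (irreducibles d) (Equivalence.from T-≡ distinct))) sound complete
    where
    hasVID? : (v : Vec K.Carrier (suc d)) → Dec (T (vid? (smallIrreducibles d) d (toList v)))
    hasVID? v = T? (vid? (smallIrreducibles d) d (toList v))
    sound : ∀ {v} → v ∈ irreduciblesWithVID d → (IrreducibleOfDegree d ∩ AdmitsVID d) ⟦ v ⟧ᵥ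
    sound {v} v∈ =
      let v∈irr , t = ∈-filter⁻ hasVID? {xs = irreducibles d} v∈
          v-irr , dv = ∈-irreducibles⁻ {d} {v} 1≤d v∈irr
      in (v-irr , dv) , vid?-sound v-irr dv 1≤d t
    complete : ∀ {f} → (IrreducibleOfDegree d ∩ AdmitsVID d) f → ∃[ v ] v ∈ irreduciblesWithVID d × ⟦ v ⟧ᵥ ≈ₚ f
    complete (f-irr , admits) with irreducibles-complete f-irr
    ... | v , v∈ , v≈f = v , ∈-filter⁺ hasVID? v∈ (AdmitsVID⇒vid? (toList v) (AdmitsVID-resp (A.sym v≈f) admits)) , v≈f

  -- A computable copy of X ^ n - X, on which non-divisibility by a given monic polynomial can be
  -- tested.
  T^n-T-code : ℕ → List K.Carrier
  T^n-T-code n = minus (monic (Vec.replicate n K.0#)) (K.0# ∷ K.1# ∷ [])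

  ⟦T^n-T-code⟧ : ∀ n → ⟦ T^n-T-code n ⟧ ≈ₚ T^ n -T
  ⟦T^n-T-code⟧ n = A.trans (⟦minus⟧ (monic (Vec.replicate n K.0#)) (K.0# ∷ K.1# ∷ []))
    (A.+-cong (A.trans (⟦⟧ₘ≈ (Vec.replicate n K.0#)) (A.+-cong {⟦ Vec.replicate n K.0# ⟧ᵥ} {0ₚ} {monomial n} (⟦replicate⟧ n) A.refl))
              (∷-cong (trans (-‿cong ι-0) -0#≈0#) (∷-cong (-‿cong ι-1) A.refl)))
    where open import Algebra.Properties.Ring ring using (-0#≈0#)

  ∣T^n-T⇒divides : ∀ {k} (s : Vec K.Carrier k) n → ⟦ s ⟧ₘ ∣ T^ n -T → T (s divides T^n-T-code n)
  ∣T^n-T⇒divides s n s∣ = ∣⇒divides s (T^n-T-code n) (∣ʳ-respʳ-≈ (A.sym (⟦T^n-T-code⟧ n)) s∣)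

-- Models of the fields of prime order and of order 4

module _ {c ℓ₁ ℓ₂} (F : HeytingField c ℓ₁ ℓ₂) {q} (order : HasOrder F q) where
  open CommutativeRing (fieldRing F) hiding (zero)
  open FiniteField F order
  open IsDiscreteField isDiscreteField

  -- Pigeonhole: a missed x would extend h to an injection of q + 1 indices into q.
  injective⇒surjective : (h : Fin q → Carrier) → (∀ {i j} → h i ≈ h j → i ≡ j) → ∀ x → ∃[ i ] h i ≈ x
  injective⇒surjective h h-injective x with Fin.any? (λ i → h i ≟ x)
  ... | yes found = found
  ... | no ¬found = contradiction (Fin.injective⇒≤ extended-injective) (ℕ.n≮n q)
    where
    extended : Fin (suc q) → Fin q
    extended zero    = index x
    extended (suc i) = index (h i)
    extended-injective : ∀ {i j} → extended i ≡ extended j → i ≡ j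
    extended-injective {zero}  {zero}  _  = ≡.refl
    extended-injective {zero}  {suc j} eq = contradiction (j , index-injective (≡.sym eq)) ¬found
    extended-injective {suc i} {zero}  eq = contradiction (i , index-injective eq) ¬found
    extended-injective {suc i} {suc j} eq = ≡.cong suc (h-injective (index-injective eq))

module _ {c ℓ₁ ℓ₂} (F : HeytingField c ℓ₁ ℓ₂) {q-1} (prime : Prime (suc q-1)) (order : HasOrder F (suc q-1)) where
  open CommutativeRing (fieldRing F) hiding (zero)
  open FiniteField F order
  open IsDiscreteField isDiscreteField
  open Frobenius (fieldRing F) using (∣⇒·≈0)
  open import Algebra.Properties.Semiring.Mult semiring using (×-homo-+; ×-congˡ; ×1-homo-*; ×-homo-1) renaming (_×_ to _·_)
  open import Algebra.Properties.Ring ring using (-1*x≈-x; +-cancelˡ)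
  open import Algebra.Properties.Group +-group using (inverseʳ-unique)
  open import Relation.Binary.Reasoning.Setoid setoid
  open import Data.Nat.Divisibility using (n∣m*n)
  private
    q = suc q-1

    multiple≈0 : ∀ k → (k ℕ.* q) · 1# ≈ 0#
    multiple≈0 k = ∣⇒·≈0 q·1≈0 (n∣m*n k) 1#

    %-· : ∀ a → (a % q) · 1# ≈ a · 1#
    %-· a = begin
      (a % q) · 1#                              ≈⟨ +-identityʳ _ ⟨
      (a % q) · 1# + 0#                         ≈⟨ +-congˡ (multiple≈0 (a / q)) ⟨
      (a % q) · 1# + (a / q ℕ.* q) · 1#         ≈⟨ ×-homo-+ 1# (a % q) (a / q ℕ.* q) ⟨
      (a % q ℕ.+ a / q ℕ.* q) · 1#              ≈⟨ ×-congˡ (m≡m%n+[m/n]*n a q) ⟨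
      a · 1#                                    ∎

    q-1·≈-1 : q-1 · 1# ≈ - 1#
    q-1·≈-1 = inverseʳ-unique 1# (q-1 · 1#) q·1≈0

    -- A positive n below the prime q is coprime to it, and a Bézout identity writes 1 as a
    -- combination of n·1 and q·1. If both vanished, 1 would be 0. Over ℕ the identity comes in two
    -- forms, according to which multiple is larger.
    n·1≈0⇒n≡0 : ∀ n → n < q → n · 1# ≈ 0# → n ≡ 0
    n·1≈0⇒n≡0 zero    _   _    = ≡.refl
    n·1≈0⇒n≡0 (suc n) n<q n1≈0 = contradiction (bézout (coprime-Bézout (prime⇒coprime prime n<q))) 1≉0
      where
      n-multiple≈0 : ∀ k → (k ℕ.* suc n) · 1# ≈ 0#
      n-multiple≈0 k = ∣⇒·≈0 n1≈0 (n∣m*n k) 1#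
      1≈0 : ∀ k l → k · 1# ≈ 0# → l · 1# ≈ 0# → 1 ℕ.+ k ≡ l → 1# ≈ 0#
      1≈0 k l k≈0 l≈0 eq = begin
        1#             ≈⟨ +-identityʳ 1# ⟨
        1# + 0#        ≈⟨ +-congˡ k≈0 ⟨
        (1 ℕ.+ k) · 1# ≈⟨ ×-congˡ eq ⟩
        l · 1#         ≈⟨ l≈0 ⟩
        0#             ∎
      bézout : Bézout.Identity 1 q (suc n) → 1# ≈ 0#
      bézout (Bézout.+- x y eq) = 1≈0 (y ℕ.* suc n) (x ℕ.* q) (n-multiple≈0 y) (multiple≈0 x) eq
      bézout (Bézout.-+ x y eq) = 1≈0 (x ℕ.* q) (y ℕ.* suc n) (multiple≈0 x) (n-multiple≈0 y) eq

    ·1-injective : ∀ {i j} → i ≤ j → j < q → i · 1# ≈ j · 1# → i ≡ j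
    ·1-injective {i} {j} i≤j j<q eq = ≡.trans (≡.sym (ℕ.+-identityʳ i)) (≡.trans (≡.cong (i ℕ.+_) (≡.sym j∸i≡0)) (ℕ.m+[n∸m]≡n i≤j))
      where
      j∸i≡0 : j ℕ.∸ i ≡ 0
      j∸i≡0 = n·1≈0⇒n≡0 (j ℕ.∸ i) (ℕ.≤-<-trans (ℕ.m∸n≤m j i) j<q) (+-cancelˡ (i · 1#) _ _ (begin
        i · 1# + (j ℕ.∸ i) · 1#  ≈⟨ ×-homo-+ 1# i (j ℕ.∸ i) ⟨
        (i ℕ.+ (j ℕ.∸ i)) · 1#   ≈⟨ ×-congˡ (ℕ.m+[n∸m]≡n i≤j) ⟩
        j · 1#                   ≈⟨ eq ⟨
        i · 1#                   ≈⟨ +-identityʳ _ ⟨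
        i · 1# + 0#              ∎))

    toℕ-·-injective : ∀ {i j : Fin q} → toℕ i · 1# ≈ toℕ j · 1# → i ≡ j
    toℕ-·-injective {i} {j} eq = Fin.toℕ-injective ([ (λ i≤j → ·1-injective i≤j (Fin.toℕ<n j) eq)
      , (λ j≤i → ≡.sym (·1-injective j≤i (Fin.toℕ<n i) (sym eq))) ]′ (ℕ.≤-total (toℕ i) (toℕ j)))

  modular-isModel : IsModel (modular q-1) (fieldRing F)
  modular-isModel = record
    { ι = _· 1#
    ; ι-0 = refl
    ; ι-1 = ×-homo-1 1#
    ; ι-- = λ a b → begin
        ((a ℕ.+ q-1 ℕ.* b) % q) · 1#      ≈⟨ %-· (a ℕ.+ q-1 ℕ.* b) ⟩
        (a ℕ.+ q-1 ℕ.* b) · 1#            ≈⟨ ×-homo-+ 1# a (q-1 ℕ.* b) ⟩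
        a · 1# + (q-1 ℕ.* b) · 1#         ≈⟨ +-congˡ (×1-homo-* q-1 b) ⟩
        a · 1# + (q-1 · 1#) * (b · 1#)    ≈⟨ +-congˡ (*-congʳ q-1·≈-1) ⟩
        a · 1# + - 1# * (b · 1#)          ≈⟨ +-congˡ (-1*x≈-x _) ⟩
        a · 1# - b · 1#                   ∎
    ; ι-* = λ a b → trans (%-· (a ℕ.* b)) (×1-homo-* a b)
    ; isZero⇒ι≈0 = λ a t → trans (sym (%-· a)) (×-congˡ (ℕ.≡ᵇ⇒≡ (a % q) 0 t))
    ; ι≈0⇒isZero = λ a a1≈0 → ℕ.≡⇒≡ᵇ (a % q) 0 (n·1≈0⇒n≡0 (a % q) (m%n<n a q) (trans (%-· a) a1≈0))
    ; ι-surjective = λ x → let i , i1≈x = injective⇒surjective F order (λ i → toℕ i · 1#) toℕ-·-injective x in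
        toℕ i , ∈-upTo⁺ (Fin.toℕ<n i) , i1≈x
    }

module _ {c ℓ₁ ℓ₂} (F : HeytingField c ℓ₁ ℓ₂) (order : HasOrder F 4) where
  open CommutativeRing (fieldRing F) hiding (zero)
  open FiniteField F order
  open IsDiscreteField isDiscreteField
  open IntegerSolver (fieldRing F)
  open import Algebra.Properties.Group +-group using (x∙y⁻¹≈ε⇒x≈y)
  open import Relation.Binary.Reasoning.Setoid setoid
  private
    -- The square of 1 + 1 is 4·1, which vanishes in a field of order 4.
    2≈0 : 1# + 1# ≈ 0#
    2≈0 = [ (λ p → p) , (λ p → p) ]′ (noZeroDivisors (1# + 1#) (1# + 1#)
      (trans (solve 0 ((:1 :+ :1) :* (:1 :+ :1) := :1 :+ (:1 :+ (:1 :+ (:1 :+ :0)))) refl) q·1≈0))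

    ω-exists : ∃[ x ] ¬ x ≈ 0# × ¬ x ≈ 1#
    ω-exists with Fin.any? (λ i → ¬? (element i ≟ 0#) ×-dec ¬? (element i ≟ 1#))
    ... | yes (i , p) = element i , p
    -- If only 0 and 1 occurred, recording whether an element is 0 would embed four elements into
    -- two.
    ... | no ¬p = contradiction (Fin.injective⇒≤ bit-injective) λ { (s≤s (s≤s ())) }
      where
      bit : Fin 4 → Fin 2
      bit i with element i ≟ 0#
      ... | yes _ = zero
      ... | no  _ = suc zero
      bit-injective : ∀ {i j} → bit i ≡ bit j → i ≡ j
      bit-injective {i} {j} eq with element i ≟ 0# | element j ≟ 0#
      ... | yes p | yes r = element-injective (trans p (sym r))
      ... | no  p | no  r = element-injective (trans (≈1 i p) (sym (≈1 j r)))
        where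
        ≈1 : ∀ k → ¬ element k ≈ 0# → element k ≈ 1#
        ≈1 k k≉0 with element k ≟ 1#
        ... | yes k≈1 = k≈1
        ... | no  k≉1 = contradiction (k , k≉0 , k≉1) ¬p
      bit-injective () | yes _ | no _
      bit-injective () | no _  | yes _

    ω : Carrier
    ω = proj₁ ω-exists
    ω≉0 = proj₁ (proj₂ ω-exists)
    ω≉1 = proj₂ (proj₂ ω-exists)

    1+ω≉0 : ¬ 1# + ω ≈ 0#
    1+ω≉0 p = ω≉1 (begin
      ω                     ≈⟨ solve 1 (λ w → w := (:1 :+ w) :+ (:1 :+ :1) :* (:- :1) :+ :1) refl ω ⟩
      (1# + ω) + (1# + 1#) * (- 1#) + 1#  ≈⟨ +-congʳ (+-cong p (*-congʳ 2≈0)) ⟩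
      0# + 0# * (- 1#) + 1# ≈⟨ solve 0 (:0 :+ :0 :* (:- :1) :+ :1 := :1) refl ⟩
      1#                    ∎)

    -- The name anticipates `ω²≈1+ω`: after 0, these are the powers of ω with exponents 0, 1 and 2.
    powers : Fin 4 → Carrier
    powers zero                   = 0#
    powers (suc zero)             = 1#
    powers (suc (suc zero))       = ω
    powers (suc (suc (suc zero))) = 1# + ω

    ω≉1+ω : ¬ ω ≈ 1# + ω
    ω≉1+ω p = 1≉0 (begin
      1#            ≈⟨ solve 1 (λ w → :1 := (:1 :+ w) :- w) refl ω ⟩
      1# + ω - ω    ≈⟨ +-congʳ p ⟨
      ω - ω         ≈⟨ -‿inverseʳ ω ⟩
      0#            ∎)

    1≉1+ω : ¬ 1# ≈ 1# + ω
    1≉1+ω p = ω≉0 (begin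
      ω             ≈⟨ solve 1 (λ w → w := (:1 :+ w) :- :1) refl ω ⟩
      1# + ω - 1#   ≈⟨ +-congʳ p ⟨
      1# - 1#       ≈⟨ -‿inverseʳ 1# ⟩
      0#            ∎)

    powers-injective : ∀ {i j} → powers i ≈ powers j → i ≡ j
    powers-injective {zero} {zero} _ = ≡.refl
    powers-injective {zero} {suc zero} p = contradiction (sym p) 1≉0
    powers-injective {zero} {suc (suc zero)} p = contradiction (sym p) ω≉0
    powers-injective {zero} {suc (suc (suc zero))} p = contradiction (sym p) 1+ω≉0
    powers-injective {suc zero} {zero} p = contradiction p 1≉0
    powers-injective {suc zero} {suc zero} _ = ≡.refl
    powers-injective {suc zero} {suc (suc zero)} p = contradiction (sym p) ω≉1
    powers-injective {suc zero} {suc (suc (suc zero))} p = contradiction p 1≉1+ω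
    powers-injective {suc (suc zero)} {zero} p = contradiction p ω≉0
    powers-injective {suc (suc zero)} {suc zero} p = contradiction p ω≉1
    powers-injective {suc (suc zero)} {suc (suc zero)} _ = ≡.refl
    powers-injective {suc (suc zero)} {suc (suc (suc zero))} p = contradiction p ω≉1+ω
    powers-injective {suc (suc (suc zero))} {zero} p = contradiction p 1+ω≉0
    powers-injective {suc (suc (suc zero))} {suc zero} p = contradiction (sym p) 1≉1+ω
    powers-injective {suc (suc (suc zero))} {suc (suc zero)} p = contradiction (sym p) ω≉1+ω
    powers-injective {suc (suc (suc zero))} {suc (suc (suc zero))} _ = ≡.refl

    -- The square is one of the four listed elements, and each of the values 0, 1 and ω would force
    -- a product of two nonzero elements to vanish.
    ω²≈1+ω : ω * ω ≈ 1# + ω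
    ω²≈1+ω with injective⇒surjective F order powers powers-injective (ω * ω)
    ... | zero , p = contradiction (sym p) (x*y≉0 ω≉0 ω≉0)
    ... | suc zero , p = contradiction (begin
        (ω - 1#) * (1# + ω)  ≈⟨ solve 1 (λ w → (w :- :1) :* (:1 :+ w) := w :* w :- :1) refl ω ⟩
        ω * ω - 1#           ≈⟨ +-congʳ p ⟨
        1# - 1#              ≈⟨ -‿inverseʳ 1# ⟩
        0#                   ∎) (x*y≉0 (λ r → ω≉1 (x∙y⁻¹≈ε⇒x≈y ω 1# r)) 1+ω≉0)
    ... | suc (suc zero) , p = contradiction (begin
        ω * (ω - 1#)         ≈⟨ solve 1 (λ w → w :* (w :- :1) := w :* w :- w) refl ω ⟩
        ω * ω - ω            ≈⟨ +-congʳ p ⟨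
        ω - ω                ≈⟨ -‿inverseʳ ω ⟩
        0#                   ∎) (x*y≉0 ω≉0 (λ r → ω≉1 (x∙y⁻¹≈ε⇒x≈y ω 1# r)))
    ... | suc (suc (suc zero)) , p = sym p

    β : Bool → Carrier
    β true  = 1#
    β false = 0#

    1≈-1 : 1# ≈ - 1#
    1≈-1 = trans (solve 0 (:1 := (:1 :+ :1) :- :1) refl) (trans (+-congʳ 2≈0) (+-identityˡ _))

    β-xor : ∀ a b → β (a xor b) ≈ β a + β b
    β-xor true  true  = sym 2≈0
    β-xor true  false = sym (+-identityʳ _)
    β-xor false b     = sym (+-identityˡ _)

    β-∧ : ∀ a b → β (a ∧ b) ≈ β a * β b
    β-∧ true  b = sym (*-identityˡ _)
    β-∧ false b = sym (zeroˡ _)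

    neg-β : ∀ b → β b ≈ - β b
    neg-β true  = 1≈-1
    neg-β false = solve 0 (:0 := :- :0) refl

    ι₄ : Bool × Bool → Carrier
    ι₄ (a , b) = β a + β b * ω

    ι₄-surjective : ∀ x → ∃[ a ] a ∈ Arithmetic.elements 𝔽₄ × ι₄ a ≈ x
    ι₄-surjective x with injective⇒surjective F order powers powers-injective x
    ... | zero , p = _ , here ≡.refl , trans (solve 1 (λ w → :0 :+ :0 :* w := :0) refl ω) p
    ... | suc zero , p = _ , there (here ≡.refl) , trans (solve 1 (λ w → :1 :+ :0 :* w := :1) refl ω) p
    ... | suc (suc zero) , p = _ , there (there (here ≡.refl)) , trans (solve 1 (λ w → :0 :+ :1 :* w := w) refl ω) p
    ... | suc (suc (suc zero)) , p = _ , there (there (there (here ≡.refl))) , trans (solve 1 (λ w → :1 :+ :1 :* w := :1 :+ w) refl ω) p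

  𝔽₄-isModel : IsModel 𝔽₄ (fieldRing F)
  𝔽₄-isModel = record
    { ι = ι₄
    ; ι-0 = solve 1 (λ w → :0 :+ :0 :* w := :0) refl ω
    ; ι-1 = solve 1 (λ w → :1 :+ :0 :* w := :1) refl ω
    ; ι-- = λ (a , b) (c , d) → begin
        β (a xor c) + β (b xor d) * ω            ≈⟨ +-cong (β-xor a c) (*-congʳ (β-xor b d)) ⟩
        (β a + β c) + (β b + β d) * ω            ≈⟨ +-cong (+-congˡ (neg-β c)) (*-congʳ (+-congˡ (neg-β d))) ⟩
        (β a - β c) + (β b - β d) * ω            ≈⟨ solve 5 (λ a b c d w → (a :- c) :+ (b :- d) :* w := (a :+ b :* w) :- (c :+ d :* w)) refl (β a) (β b) (β c) (β d) ω ⟩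
        (β a + β b * ω) - (β c + β d * ω)        ∎
    ; ι-* = λ (a , b) (c , d) → begin
        β ((a ∧ c) xor (b ∧ d)) + β ((a ∧ d) xor (b ∧ c) xor (b ∧ d)) * ω
          ≈⟨ +-cong (trans (β-xor (a ∧ c) (b ∧ d)) (+-cong (β-∧ a c) (β-∧ b d)))
               (*-congʳ (trans (β-xor (a ∧ d) _) (+-cong (β-∧ a d) (trans (β-xor (b ∧ c) (b ∧ d)) (+-cong (β-∧ b c) (β-∧ b d)))))) ⟩
        (β a * β c + β b * β d) + (β a * β d + (β b * β c + β b * β d)) * ω
          ≈⟨ solve 5 (λ a b c d w → (a :* c :+ b :* d) :+ (a :* d :+ (b :* c :+ b :* d)) :* w :=
               a :* c :+ (a :* d :+ b :* c) :* w :+ b :* d :* (:1 :+ w)) refl (β a) (β b) (β c) (β d) ω ⟩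
        β a * β c + (β a * β d + β b * β c) * ω + β b * β d * (1# + ω)
          ≈⟨ +-congˡ (*-congˡ ω²≈1+ω) ⟨
        β a * β c + (β a * β d + β b * β c) * ω + β b * β d * (ω * ω)
          ≈⟨ solve 5 (λ a b c d w → a :* c :+ (a :* d :+ b :* c) :* w :+ b :* d :* (w :* w) :=
               (a :+ b :* w) :* (c :+ d :* w)) refl (β a) (β b) (β c) (β d) ω ⟩
        (β a + β b * ω) * (β c + β d * ω)        ∎
    ; isZero⇒ι≈0 = λ { (false , false) _ → solve 1 (λ w → :0 :+ :0 :* w := :0) refl ω }
    ; ι≈0⇒isZero = λ where
        (false , false) _ → _
        (true  , false) p → contradiction (trans (solve 1 (λ w → :1 := :1 :+ :0 :* w) refl ω) p) 1≉0
        (false , true)  p → contradiction (trans (solve 1 (λ w → w := :0 :+ :1 :* w) refl ω) p) ω≉0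
        (true  , true)  p → contradiction (trans (solve 1 (λ w → :1 :+ w := :1 :+ :1 :* w) refl ω) p) 1+ω≉0
    ; ι-surjective = ι₄-surjective
    }

-- Degree bounds for the terms of a VID

another-index : ∀ {r} → 2 ≤ r → (i : Fin r) → ∃[ j ] j ≢ i
another-index (s≤s (s≤s _)) zero    = suc zero , λ ()
another-index (s≤s (s≤s _)) (suc i) = zero , λ ()

two-other-indices : ∀ {r} → 3 ≤ r → (i : Fin r) → ∃₂ λ j k → j ≢ i × k ≢ i × j ≢ k
two-other-indices (s≤s (s≤s (s≤s _))) zero          = suc zero , suc (suc zero) , (λ ()) , (λ ()) , λ ()
two-other-indices (s≤s (s≤s (s≤s _))) (suc zero)    = zero , suc (suc zero) , (λ ()) , (λ ()) , λ ()
two-other-indices (s≤s (s≤s (s≤s _))) (suc (suc i)) = zero , suc zero , (λ ()) , (λ ()) , λ ()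

module VIDBounds {c ℓ₁ ℓ₂} (F : HeytingField c ℓ₁ ℓ₂) {p k : ℕ} (p-prime : Prime p) (1≤k : 1 ≤ k)
                 (order : HasOrder F (p ℕ.^ k)) {d : ℕ} (2≤d : 2 ≤ d) where
  open SmallFactors F p-prime 1≤k order using (1<q; W∣; Q≤degree; HasDegree-W) public
  open Polynomials (fieldRing F)
  open FieldPolynomials (fieldRing F) (FiniteField.isDiscreteField F order)
  open T^n-T (fieldRing F)
  open import Algebra.Definitions.RawMagma A.*-rawMagma using (_,_)

  m : ℕ
  m = ⌊ d /2⌋

  1≤m : 1 ≤ m
  1≤m = ℕ.⌊n/2⌋-mono 2≤d

  Q : ℕ
  Q = (p ℕ.^ k) ℕ.^ m

  DivisibleBySmallIrreducibles : Poly → Set _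
  DivisibleBySmallIrreducibles f = ∀ p → Irreducible p → ∀ n → HasDegree p n → n ≤ m → p ∣ f

  module _ {r} {fs : Vector Poly r} (isVID : IsVID d fs) where
    open IsVID isVID

    term-degree : ∀ i → ∃[ n ] HasDegree (fs i) n
    term-degree i = ≉0⇒HasDegree (nonzero i)

    -- VID-1 lets a small irreducible miss one term only, so of any two terms it divides at least
    -- one.
    pair-divisible : ∀ {i j} → i ≢ j → DivisibleBySmallIrreducibles (fs i *ₚ fs j)
    pair-divisible {i} {j} i≢j p p-irr n dp n≤m with vid₁ p p-irr n dp (⌊n/2⌋-≤ n≤m)
    ... | l , _ , p∣others with i Fin.≟ l
    ...   | no  i≢l    = ∣-*-split {p} {fs i} {fs j} (p∣others i i≢l)
    ...   | yes ≡.refl = x∣ʳy⇒x∣ʳzy (fs i) (p∣others j (λ j≡l → i≢j (≡.sym j≡l)))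

    pair-degree : ∀ {i j a b} → i ≢ j → HasDegree (fs i) a → HasDegree (fs j) b → Q ≤ a ℕ.+ b
    pair-degree {i} {j} i≢j di dj = Q≤degree m 1≤m (fs i *ₚ fs j) (HasDegree-* (fs i) di dj) (pair-divisible i≢j)

    top-pair : ∃₂ λ i j → i ≢ j × HasDegree (fs i) d × ∃[ b ] HasDegree (fs j) b × b < d
    top-pair with vid₂
    ... | i , di , low with another-index 2≤r i
    ...   | j , j≢i with term-degree j
    ...     | b , dj = i , j , (λ i≡j → j≢i (≡.sym i≡j)) , di , b , dj , HasDegree∧Degree<⇒< {fs j} dj (low j j≢i)

    Q<2d : Q < d ℕ.+ d
    Q<2d = let i , j , i≢j , di , b , dj , b<d = top-pair in
      ℕ.≤-<-trans (pair-degree i≢j di dj) (ℕ.+-monoʳ-< d b<d)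

    -- A small irreducible h that does not divide W has to divide the cofactor of W in the product
    -- of the two terms, so that its degree e adds to the bound.
    Q+e<2d : ∀ h {e} → Irreducible h → HasDegree h e → e ≤ m → ¬ h ∣ T^ Q -T → Q ℕ.+ e < d ℕ.+ d
    Q+e<2d h {e} h-irr dh e≤m h∤W = let i , j , i≢j , di , b , dj , b<d = top-pair in
      ℕ.≤-<-trans (bound (fs i *ₚ fs j) (HasDegree-* (fs i) di dj) (pair-divisible i≢j)) (ℕ.+-monoʳ-< d b<d)
      where
      bound : ∀ f {n} → HasDegree f n → DivisibleBySmallIrreducibles f → Q ℕ.+ e ≤ n
      bound f {n} df small = decidable-stable (Q ℕ.+ e ℕ.≤? n) λ ¬bound → W∣ m 1≤m f small λ (u , uW≈f) →
        let l , du , l+Q≡n = cofactor-degree u (T^ Q -T) (HasDegree-W m 1≤m) (HasDegree-resp (A.sym uW≈f) df)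
            h∣u = [ (λ h∣u → h∣u) , (λ h∣W → contradiction h∣W h∤W) ]′
              (irreducible⇒prime h-irr {u} {T^ Q -T} (∣ʳ-respʳ-≈ (A.sym uW≈f) (small h h-irr e dh e≤m)))
        in ¬bound (ℕ.≤-trans (ℕ.+-monoʳ-≤ Q (∣⇒degree≤ h∣u dh du)) (ℕ.≤-reflexive (≡.trans (ℕ.+-comm Q l) l+Q≡n)))

  two-terms : ∀ {r} {fs : Vector Poly r} → IsVID d fs → 2 ℕ.* ℕ.pred d < Q →
    ∃₂ λ h g → h +ₚ g ≈ₚ sum fs × Degree< g d × ¬ g ≈ₚ 0ₚ ×
      (∀ p → Irreducible p → ∀ n → HasDegree p n → n ≤ m → p ∣ g ⊎ p ∣ h)
  two-terms {zero}        isVID _ = contradiction (IsVID.2≤r isVID) λ ()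
  two-terms {suc zero}    isVID _ = contradiction (IsVID.2≤r isVID) λ { (s≤s ()) }
  two-terms {suc (suc zero)} {fs} isVID _ = choose vid₂
    where
    open IsVID isVID
    divides-one-of : ∀ i j → i ≢ j → ∀ p → Irreducible p → ∀ n → HasDegree p n → n ≤ m → p ∣ fs i ⊎ p ∣ fs j
    divides-one-of i j i≢j p p-irr n dp n≤m with vid₁ p p-irr n dp (⌊n/2⌋-≤ n≤m)
    ... | l , _ , p∣others with i Fin.≟ l
    ...   | no  i≢l    = inj₁ (p∣others i i≢l)
    ...   | yes ≡.refl = inj₂ (p∣others j (λ j≡l → i≢j (≡.sym j≡l)))
    choose : ∃[ i ] (HasDegree (fs i) d × (∀ j → j ≢ i → Degree< (fs j) d)) → _
    choose (zero , _ , low) = fs zero , fs (suc zero) , A.+-cong {fs zero} A.refl (A.sym (A.+-identityʳ (fs (suc zero)))) ,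
      low (suc zero) (λ ()) , nonzero (suc zero) , divides-one-of (suc zero) zero (λ ())
    choose (suc zero , _ , low) = fs (suc zero) , fs zero ,
      A.trans (A.+-comm (fs (suc zero)) (fs zero)) (A.+-cong {fs zero} A.refl (A.sym (A.+-identityʳ (fs (suc zero))))) ,
      low zero (λ ()) , nonzero zero , divides-one-of zero (suc zero) (λ ())
  two-terms {suc (suc (suc r))} {fs} isVID large with IsVID.vid₂ isVID
  ... | i , _ , low with two-other-indices (s≤s (s≤s (s≤s (z≤n {r})))) i
  ...   | j , l , j≢i , l≢i , j≢l with term-degree isVID j | term-degree isVID l
  ...     | a , dj | b , dl = contradiction (ℕ.<-≤-trans large (pair-degree isVID j≢l dj dl)) (ℕ.≤⇒≯ (ℕ.+-mono-≤ (bound a j≢i dj)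
              (≡.subst (b ≤_) (≡.sym (ℕ.+-identityʳ _)) (bound b l≢i dl))))
    where
    bound : ∀ n {j} → j ≢ i → HasDegree (fs j) n → n ≤ ℕ.pred d
    bound n {j} j≢i dj = ℕ.<⇒≤pred (HasDegree∧Degree<⇒< {fs j} dj (low j j≢i))

  module _ (K : Arithmetic) (model : IsModel K (fieldRing F)) (large : 2 ℕ.* ℕ.pred d < Q) where
    open Correctness (fieldRing F) (FiniteField.isDiscreteField F order) K model
    open Computation K using (vid?; smallIrreducibles)

    AdmitsVID⇒vid? : ∀ f → AdmitsVID d ⟦ f ⟧ → T (vid? (smallIrreducibles d) d f)
    AdmitsVID⇒vid? f (r , fs , isVID , sum≈f) =
      let h , g , h+g≈sum , g<d , g≉0 , small = two-terms isVID large
      in vid?-complete g h (A.trans h+g≈sum sum≈f) g<d g≉0 small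

    AdmitsVID-cardinality : ∀ {n} → Computation.distinct? K (Computation.irreducibles K d) ≡ true →
      length (Computation.irreduciblesWithVID K d) ≡ n →
      HasCardinality (subsetoid polySetoid (IrreducibleOfDegree d ∩ AdmitsVID d)) n
    AdmitsVID-cardinality = irreduciblesWithVID-cardinality d (ℕ.<⇒≤ 2≤d) AdmitsVID⇒vid?

-- The pairs (q , d) that satisfy the degree bound

eventually-large : ∀ n → 10 ℕ.+ n ℕ.+ (10 ℕ.+ n) ≤ 2 ℕ.^ ⌊ 10 ℕ.+ n /2⌋
eventually-large zero          = ℕ.≤ᵇ⇒≤ 20 32 _
eventually-large (suc zero)    = ℕ.≤ᵇ⇒≤ 22 32 _
-- Raising d by 2 adds 4 to 2 d and doubles 2 ^ ⌊ d /2⌋. The start at 10 is forced, since at d = 9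
-- the power is 16 and 2 d is 18.
eventually-large (suc (suc n)) = begin
  12 ℕ.+ n ℕ.+ (12 ℕ.+ n)          ≡⟨ solve 1 (λ n → con 12 :+ n :+ (con 12 :+ n) := con 10 :+ n :+ (con 10 :+ n) :+ con 4) ≡.refl n ⟩
  10 ℕ.+ n ℕ.+ (10 ℕ.+ n) ℕ.+ 4    ≤⟨ ℕ.+-mono-≤ (eventually-large n) (ℕ.≤-trans 4≤ (eventually-large n)) ⟩
  power ℕ.+ power                  ≡⟨ ≡.cong (power ℕ.+_) (ℕ.+-identityʳ power) ⟨
  2 ℕ.* power                      ∎
  where
  open ℕ.≤-Reasoning
  open import Data.Nat.Solver using (module +-*-Solver)
  open +-*-Solver using (solve; _:=_; _:+_; con)
  power = 2 ℕ.^ ⌊ 10 ℕ.+ n /2⌋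
  4≤ : 4 ≤ 10 ℕ.+ n ℕ.+ (10 ℕ.+ n)
  4≤ = s≤s (s≤s (s≤s (s≤s z≤n)))

Exceptional : ℕ → ℕ → Set
Exceptional q d = (q , d) ∈ alwaysVID ⊎ (q , d) ≡ (3 , 5) ⊎ (q , d) ≡ (2 , 9)

exceptional : ∀ q d → 1 < q → 2 ≤ d → q ℕ.^ ⌊ d /2⌋ < d ℕ.+ d → Exceptional q d
exceptional q d 1<q 2≤d Q<2d = by-degree q d 1<q 2≤d Q<2d
  where
  -- The power grows with q, so in each degree it suffices to refute the least order k outside the
  -- list, which is a comparison of numerals.
  too-large : ∀ k m n {q} {A : Set} → k ≤ q → q ℕ.^ m < n → {_ : T (n ℕ.≤ᵇ k ℕ.^ m)} → A
  too-large k m n k≤q q^m<n {n≤k^m} =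
    contradiction (ℕ.<-≤-trans q^m<n (ℕ.≤-trans (ℕ.≤ᵇ⇒≤ n (k ℕ.^ m) n≤k^m) (ℕ.^-monoˡ-≤ m k≤q))) (ℕ.n≮n _)

  listed : ∀ q d → {True ((q , d) ∈? alwaysVID)} → Exceptional q d
  listed q d {t} = inj₁ (toWitness t)

  by-degree : ∀ q d → 1 < q → 2 ≤ d → q ℕ.^ ⌊ d /2⌋ < d ℕ.+ d → Exceptional q d
  by-degree 0 d () _ _
  by-degree 1 d (s≤s ()) _ _
  by-degree q 0 _ () _
  by-degree q 1 _ (s≤s ()) _
  by-degree 2 2 _ _ _ = listed 2 2
  by-degree 3 2 _ _ _ = listed 3 2
  by-degree (suc (suc (suc (suc q)))) 2 _ _ lt = too-large 4 1 4 (ℕ.m≤m+n 4 q) lt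
  by-degree 2 3 _ _ _ = listed 2 3
  by-degree 3 3 _ _ _ = listed 3 3
  by-degree 4 3 _ _ _ = listed 4 3
  by-degree 5 3 _ _ _ = listed 5 3
  by-degree (suc (suc (suc (suc (suc (suc q)))))) 3 _ _ lt = too-large 6 1 6 (ℕ.m≤m+n 6 q) lt
  by-degree 2 4 _ _ _ = listed 2 4
  by-degree (suc (suc (suc q))) 4 _ _ lt = too-large 3 2 8 (ℕ.m≤m+n 3 q) lt
  by-degree 2 5 _ _ _ = listed 2 5
  by-degree 3 5 _ _ _ = inj₂ (inj₁ ≡.refl)
  by-degree (suc (suc (suc (suc q)))) 5 _ _ lt = too-large 4 2 10 (ℕ.m≤m+n 4 q) lt
  by-degree 2 6 _ _ _ = listed 2 6
  by-degree (suc (suc (suc q))) 6 _ _ lt = too-large 3 3 12 (ℕ.m≤m+n 3 q) lt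
  by-degree 2 7 _ _ _ = listed 2 7
  by-degree (suc (suc (suc q))) 7 _ _ lt = too-large 3 3 14 (ℕ.m≤m+n 3 q) lt
  -- Already 2 ^ 4 = 8 + 8, and the inequality is strict, so degree 8 is excluded for every q.
  by-degree q 8 1<q _ lt = too-large 2 4 16 1<q lt
  by-degree 2 9 _ _ _ = inj₂ (inj₂ ≡.refl)
  by-degree (suc (suc (suc q))) 9 _ _ lt = too-large 3 4 18 (ℕ.m≤m+n 3 q) lt
  by-degree q (suc (suc (suc (suc (suc (suc (suc (suc (suc (suc d)))))))))) 1<q _ lt =
    contradiction (ℕ.<-≤-trans lt (ℕ.≤-trans (eventually-large d) (ℕ.^-monoˡ-≤ ⌊ 10 ℕ.+ d /2⌋ 1<q))) (ℕ.n≮n _)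

-- Results of the searches and the three parts of the theorem

2-prime : Prime 2
2-prime = from-yes (prime? 2)

3-prime : Prime 3
3-prime = from-yes (prime? 3)

5-prime : Prime 5
5-prime = from-yes (prime? 5)

𝔽₂-2 : Computation.allAdmitVID? (modular 1) 2 ≡ true
𝔽₂-2 = ≡.refl

𝔽₂-3 : Computation.allAdmitVID? (modular 1) 3 ≡ true
𝔽₂-3 = ≡.refl

𝔽₂-4 : Computation.allAdmitVID? (modular 1) 4 ≡ true
𝔽₂-4 = ≡.refl

𝔽₂-5 : Computation.allAdmitVID? (modular 1) 5 ≡ true
𝔽₂-5 = ≡.refl

𝔽₂-6 : Computation.allAdmitVID? (modular 1) 6 ≡ true
𝔽₂-6 = ≡.refl

𝔽₂-7 : Computation.allAdmitVID? (modular 1) 7 ≡ true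
𝔽₂-7 = ≡.refl

𝔽₃-2 : Computation.allAdmitVID? (modular 2) 2 ≡ true
𝔽₃-2 = ≡.refl

𝔽₃-3 : Computation.allAdmitVID? (modular 2) 3 ≡ true
𝔽₃-3 = ≡.refl

𝔽₄-3 : Computation.allAdmitVID? 𝔽₄ 3 ≡ true
𝔽₄-3 = ≡.refl

𝔽₅-3 : Computation.allAdmitVID? (modular 4) 3 ≡ true
𝔽₅-3 = ≡.refl

𝔽₃-5-distinct : Computation.distinct? (modular 2) (Computation.irreducibles (modular 2) 5) ≡ true
𝔽₃-5-distinct = ≡.refl

-- There are (3 ^ 5 - 3) / 5 = 48 monic irreducible quintics, and each has two nonzero scalar
-- multiples.
𝔽₃-5-count : length (Computation.irreducibles (modular 2) 5) ≡ 96
𝔽₃-5-count = ≡.refl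

-- Scaling all terms of a VID by a nonzero constant gives a VID, so these come from 24 of the 48
-- monic polynomials.
𝔽₃-5-count-VID : length (Computation.irreduciblesWithVID (modular 2) 5) ≡ 48
𝔽₃-5-count-VID = ≡.refl

module _ {c ℓ₁ ℓ₂} (F : HeytingField c ℓ₁ ℓ₂) where
  private R = fieldRing F
  open Polynomials R

  private
    modular-allVID : ∀ q-1 → Prime (suc q-1) → ∀ d → 1 ≤ d → Computation.allAdmitVID? (modular q-1) d ≡ true →
      HasOrder F (suc q-1) → ∀ f → IrreducibleOfDegree d f → AdmitsVID d f
    modular-allVID q-1 q-prime d 1≤d verified order =
      Correctness.allAdmitVID R (FiniteField.isDiscreteField F order) (modular q-1) (modular-isModel F q-prime order) d 1≤d verified

    𝔽₄-allVID : ∀ d → 1 ≤ d → Computation.allAdmitVID? 𝔽₄ d ≡ true →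
      HasOrder F 4 → ∀ f → IrreducibleOfDegree d f → AdmitsVID d f
    𝔽₄-allVID d 1≤d verified order =
      Correctness.allAdmitVID R (FiniteField.isDiscreteField F order) 𝔽₄ (𝔽₄-isModel F order) d 1≤d verified

  ∈-alwaysVID⇒AdmitsVID : ∀ {q d} → (q , d) ∈ alwaysVID → HasOrder F q → ∀ f → IrreducibleOfDegree d f → AdmitsVID d f
  ∈-alwaysVID⇒AdmitsVID (here ≡.refl) = modular-allVID 1 2-prime 2 (s≤s z≤n) 𝔽₂-2
  ∈-alwaysVID⇒AdmitsVID (there (here ≡.refl)) = modular-allVID 2 3-prime 2 (s≤s z≤n) 𝔽₃-2
  ∈-alwaysVID⇒AdmitsVID (there (there (here ≡.refl))) = modular-allVID 1 2-prime 3 (s≤s z≤n) 𝔽₂-3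
  ∈-alwaysVID⇒AdmitsVID (there (there (there (here ≡.refl)))) = modular-allVID 2 3-prime 3 (s≤s z≤n) 𝔽₃-3
  ∈-alwaysVID⇒AdmitsVID (there (there (there (there (here ≡.refl))))) = 𝔽₄-allVID 3 (s≤s z≤n) 𝔽₄-3
  ∈-alwaysVID⇒AdmitsVID (there (there (there (there (there (here ≡.refl)))))) = modular-allVID 4 5-prime 3 (s≤s z≤n) 𝔽₅-3
  ∈-alwaysVID⇒AdmitsVID (there (there (there (there (there (there (here ≡.refl))))))) = modular-allVID 1 2-prime 4 (s≤s z≤n) 𝔽₂-4
  ∈-alwaysVID⇒AdmitsVID (there (there (there (there (there (there (there (here ≡.refl)))))))) = modular-allVID 1 2-prime 5 (s≤s z≤n) 𝔽₂-5
  ∈-alwaysVID⇒AdmitsVID (there (there (there (there (there (there (there (there (here ≡.refl))))))))) = modular-allVID 1 2-prime 6 (s≤s z≤n) 𝔽₂-6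
  ∈-alwaysVID⇒AdmitsVID (there (there (there (there (there (there (there (there (there (here ≡.refl)))))))))) = modular-allVID 1 2-prime 7 (s≤s z≤n) 𝔽₂-7

  -- The bound Q < 2 d reads 16 < 18 here; the factor X³ + X + 1, which X¹⁶ − X lacks, improves it to 19 < 18.
  noVID-2-9 : HasOrder F 2 → ∀ {r} {fs : Vector Poly r} → ¬ IsVID 9 fs
  noVID-2-9 order isVID = contradiction
    (Q+e<2d isVID ⟦ X³+X+1 ⟧ₘ (irreducible?⇒Irreducible (Computation.monic (modular 1) X³+X+1) (s≤s z≤n) (⟦⟧ₘ-degree X³+X+1) _) (⟦⟧ₘ-degree X³+X+1) (s≤s (s≤s (s≤s z≤n)))
      (∣T^n-T⇒divides X³+X+1 16))
    (ℕ.≤⇒≯ (ℕ.≤ᵇ⇒≤ 18 19 _))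
    where
    open VIDBounds F {2} {1} 2-prime (s≤s z≤n) order {9} (s≤s (s≤s z≤n)) using (Q+e<2d)
    open Correctness R (FiniteField.isDiscreteField F order) (modular 1) (modular-isModel F 2-prime order)
    X³+X+1 : Vec ℕ 3
    X³+X+1 = 1 ∷ 1 ∷ 0 ∷ []

  IsVID⇒q^⌊d/2⌋<2d : ∀ {q d} → IsPrimePower q → 2 ≤ d → HasOrder F q → ∀ {r} {fs : Vector Poly r} → IsVID d fs →
    1 < q × q ℕ.^ ⌊ d /2⌋ < d ℕ.+ d
  IsVID⇒q^⌊d/2⌋<2d (p , k , p-prime , 1≤k , ≡.refl) 2≤d order isVID =
    VIDBounds.1<q F p-prime 1≤k order 2≤d , VIDBounds.Q<2d F p-prime 1≤k order 2≤d isVID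

  IsVID⇒Exceptional : ∀ {q d} → IsPrimePower q → 2 ≤ d → HasOrder F q → ∀ {r} {fs : Vector Poly r} → IsVID d fs →
    (q , d) ∈ alwaysVID ⊎ (q , d) ≡ (3 , 5)
  IsVID⇒Exceptional {q} {d} isPrimePower 2≤d order isVID
    with exceptional q d (proj₁ bounds) 2≤d (proj₂ bounds)
    where bounds = IsVID⇒q^⌊d/2⌋<2d isPrimePower 2≤d order isVID
  ... | inj₁ q,d∈               = inj₁ q,d∈
  ... | inj₂ (inj₁ q,d≡)        = inj₂ q,d≡
  ... | inj₂ (inj₂ ≡.refl)      = contradiction isVID (noVID-2-9 order)

  IrreducibleOfDegree-5-cardinality : HasOrder F 3 → HasCardinality (subsetoid polySetoid (IrreducibleOfDegree 5)) 96
  IrreducibleOfDegree-5-cardinality order =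
    Correctness.irreducibles-cardinality R (FiniteField.isDiscreteField F order) (modular 2) (modular-isModel F 3-prime order)
      5 (s≤s z≤n) 𝔽₃-5-distinct 𝔽₃-5-count

  AdmitsVID-5-cardinality : HasOrder F 3 → HasCardinality (subsetoid polySetoid (IrreducibleOfDegree 5 ∩ AdmitsVID 5)) 48
  AdmitsVID-5-cardinality order =
    VIDBounds.AdmitsVID-cardinality F {3} {1} 3-prime (s≤s z≤n) order {5} (s≤s (s≤s z≤n)) (modular 2) (modular-isModel F 3-prime order)
      -- The condition excluding a third term reads 2 * 4 < 3 ^ 2, that is 9 ≤ 9.
      ℕ.≤-refl 𝔽₃-5-distinct 𝔽₃-5-count-VID

open import Data.Nat.Base using (_*_)

theorem1 : ∀ {c ℓ₁ ℓ₂} (q d : ℕ) → IsPrimePower q → 2 ≤ d →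
    (F : HeytingField c ℓ₁ ℓ₂) → HasOrder F q →
    let open Polynomials (fieldRing F) in
      ((q , d) ∈ alwaysVID → ∀ f → IrreducibleOfDegree d f → AdmitsVID d f)
    × ((q , d) ≡ (3 , 5) →
        ∃[ n ] (HasCardinality (subsetoid polySetoid (IrreducibleOfDegree d)) (2 * n)
              × HasCardinality (subsetoid polySetoid (IrreducibleOfDegree d ∩ AdmitsVID d)) n))
    × ((q , d) ∉ alwaysVID → (q , d) ≢ (3 , 5) →
        ∀ f → IrreducibleOfDegree d f → ¬ AdmitsVID d f)
theorem1 q d isPrimePower 2≤d F order =
    (λ q,d∈ → ∈-alwaysVID⇒AdmitsVID F q,d∈ order)
  , (λ { ≡.refl → 48 , IrreducibleOfDegree-5-cardinality F order , AdmitsVID-5-cardinality F order })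
  , (λ q,d∉ q,d≢ f _ (r , fs , isVID , _) →
      [ q,d∉ , q,d≢ ]′ (IsVID⇒Exceptional F isPrimePower 2≤d order isVID))
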